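{- Let $\mathbb{F}$ be a prime field and let $f \in \mathbb{F}[x_1,\ldots,x_n]$ be a cubic polynomial ($\deg(f)=3$) with $\|f\|_{U^3}=\delta$. Then there exist $c+1 = O(\log^2(1/\delta))$ quadratic polynomials $q_0,\ldots,q_{c} \in \mathbb{F}[x_1,\ldots,x_n]$ and $c$ linear functions $\ell_1,\ldots,\ell_{c} \in \mathbb{F}[x_1,\ldots,x_n]$ such that $$f = \sum_{j=1}^{c} \ell_j \cdot q_j +q_0.$$
   Context: For $f:\mathbb{F}^n\to\mathbb{F}$ and $y\in\mathbb{F}^n$, $\Delta_y(f)(x)=f(x+y)-f(x)$. The $d$-th Gowers norm is $\|f\|_{U^d} = \left|\mathbb{E}_{x,y_1,\ldots,y_d\in\mathbb{F}^n}[\omega^{\Delta_{y_d}\cdots\Delta_{y_1}(f)(x)}]\right|^{1/2^d}$ with $\omega=e^{2\pi i/|\mathbb{F}|}$. Polynomials are identified with the functions $\mathbb{F}^n\to\mathbb{F}$ they define (i.e. one works modulo $x_i^{p}-x_i$, $p=|\mathbb{F}|$), and the degree of a function is the least degree of a polynomial representing it. In the conclusion, "linear" and "quadratic" mean degree at most $1$ and $2$ (linear functions may have a constant term). The implied constants in $O(\cdot)$ may depend on the fixed field $\mathbb{F}$ but not on $n$, $f$ or $\delta$. -}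

module Defs where

open import Data.Nat as ℕ using (ℕ; zero; suc)
import Data.Nat.Properties as ℕₚ
open import Data.Nat.DivMod using (_mod_)
import Data.Integer as ℤ
import Data.Integer.Properties as ℤₚ
open import Data.Rational
import Data.Rational.Unnormalised as ℚᵘ
import Data.Rational.Unnormalised.Properties as ℚᵘₚ
open import Data.Rational.Properties
open import Data.Rational.Solver using (module +-*-Solver)
open import Data.Fin using (Fin; toℕ)
open import Data.Vec as Vec using (Vec; []; _∷_)
import Data.Vec.Functional as Vector
open import Data.List as List using (List; []; _∷_)
open import Data.List.Relation.Unary.All using (All)
open import Data.Product using (Σ; ∃; ∃-syntax; _×_; _,_; proj₁; proj₂)
open import Data.Sum using (_⊎_; inj₁; inj₂)
open import Relation.Binary.PropositionalEquality

infixl 6 _+ᴿ_ _+ᶜ_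
infixl 7 _*ᴿ_ _*ᶜ_ _·ᶜ_
infixr 8 _^_ _^ᴿ_ _^ᶜ_
infix  8 -ᴿ_
infix  4 _≈ᴿ_ _≤ᴿ_ _<ᴿ_

-- Real numbers are Cauchy sequences of rationals, taken up to _≈ᴿ_.
-- Operations act termwise.

IsCauchy : (ℕ → ℚ) → Set
IsCauchy x = ∀ ε → 0ℚ < ε →
  ∃[ N ] (∀ m n → N ℕ.≤ m → N ℕ.≤ n → ∣ x m - x n ∣ ≤ ε)

record ℝ : Set where
  constructor mkℝ
  field
    seq    : ℕ → ℚ
    cauchy : IsCauchy seq
open ℝ public

_≈ᴿ_ : ℝ → ℝ → Set
x ≈ᴿ y = ∀ ε → 0ℚ < ε → ∃[ N ] (∀ n → N ℕ.≤ n → ∣ seq x n - seq y n ∣ ≤ ε)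

_≤ᴿ_ : ℝ → ℝ → Set
x ≤ᴿ y = ∀ ε → 0ℚ < ε → ∃[ N ] (∀ n → N ℕ.≤ n → seq x n ≤ seq y n + ε)

_<ᴿ_ : ℝ → ℝ → Set
x <ᴿ y = ∃[ ε ] (0ℚ < ε × ∃[ N ] (∀ n → N ℕ.≤ n → seq x n + ε ≤ seq y n))

natℚ : ℕ → ℚ
natℚ k = ℤ.+ k / 1

-- 1/k, with the junk value 0 at k = 0.
recip : ℕ → ℚ
recip zero    = 0ℚ
recip (suc k) = ℤ.+ 1 / suc k

_^_ : ℚ → ℕ → ℚ
q ^ zero  = 1ℚ
q ^ suc k = q * q ^ k

recip! : ℕ → ℚ
recip! zero    = 1ℚ
recip! (suc k) = recip (suc k) * recip! k

module Estimates where
  open +-*-Solver using (solve; con; :-_; _:+_; _:*_; _:-_; _:=_)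

  *-mono : ∀ {a b c d} → 0ℚ ≤ c → 0ℚ ≤ b → a ≤ b → c ≤ d → a * c ≤ b * d
  *-mono {a} {b} {c} {d} 0≤c 0≤b a≤b c≤d =
    ≤-trans (*-monoʳ-≤-nonNeg c {{nonNegative 0≤c}} a≤b)
            (*-monoˡ-≤-nonNeg b {{nonNegative 0≤b}} c≤d)

  *-nonneg : ∀ {a b} → 0ℚ ≤ a → 0ℚ ≤ b → 0ℚ ≤ a * b
  *-nonneg {a} {b} 0≤a 0≤b = subst (_≤ a * b) (*-zeroˡ 0ℚ) (*-mono ≤-refl 0≤a 0≤a 0≤b)

  *-pos : ∀ {a b} → 0ℚ < a → 0ℚ < b → 0ℚ < a * b
  *-pos {a} {b} 0<a 0<b =
    subst (_< a * b) (*-zeroʳ a) (*-monoʳ-<-pos a {{positive 0<a}} 0<b)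

  +-nonneg : ∀ {a b} → 0ℚ ≤ a → 0ℚ ≤ b → 0ℚ ≤ a + b
  +-nonneg {a} {b} 0≤a 0≤b = subst (_≤ a + b) (+-identityʳ 0ℚ) (+-mono-≤ 0≤a 0≤b)

  ≤-+ʳ : ∀ a {b} → 0ℚ ≤ b → a ≤ a + b
  ≤-+ʳ a {b} 0≤b = subst (_≤ a + b) (+-identityʳ a) (+-monoʳ-≤ a 0≤b)

  0≤1 : 0ℚ ≤ 1ℚ
  0≤1 = nonNegative⁻¹ 1ℚ

  0<1 : 0ℚ < 1ℚ
  0<1 = positive⁻¹ 1ℚ

  0<½ : 0ℚ < ½
  0<½ = positive⁻¹ ½

  ½+½ : ∀ e → ½ * e + ½ * e ≡ e
  ½+½ = solve 1 (λ e → con ½ :* e :+ con ½ :* e := e) refl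

  shrink : ∀ B → 0ℚ ≤ B → ∀ ε → 0ℚ < ε → ∃[ η ] (0ℚ < η × B * η ≤ ε)
  shrink B 0≤B ε 0<ε = ε * r , *-pos 0<ε 0<r , le
    where
    0<B+1 : 0ℚ < B + 1ℚ
    0<B+1 = <-≤-trans 0<1 (subst (1ℚ ≤_) (+-comm 1ℚ B) (≤-+ʳ 1ℚ 0≤B))
    instance
      B+1-pos : Positive (B + 1ℚ)
      B+1-pos = positive 0<B+1
      B+1-nz : NonZero (B + 1ℚ)
      B+1-nz = pos⇒nonZero (B + 1ℚ)
    r = 1/ (B + 1ℚ)
    0<r : 0ℚ < r
    0<r = positive⁻¹ r {{1/pos⇒pos (B + 1ℚ)}}
    le : B * (ε * r) ≤ ε
    le = ≤-trans
      (*-monoʳ-≤-nonNeg (ε * r) {{nonNegative (<⇒≤ (*-pos 0<ε 0<r))}} (≤-+ʳ B 0≤1))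
      (≤-reflexive (begin
        (B + 1ℚ) * (ε * r)  ≡⟨ solve 3 (λ b e i → b :* (e :* i) := e :* (b :* i)) refl (B + 1ℚ) ε r ⟩
        ε * ((B + 1ℚ) * r)  ≡⟨ cong (ε *_) (*-inverseʳ (B + 1ℚ)) ⟩
        ε * 1ℚ              ≡⟨ *-identityʳ ε ⟩
        ε                   ∎))
      where open ≡-Reasoning

  natℚ-suc : ∀ k → natℚ (suc k) ≡ 1ℚ + natℚ k
  natℚ-suc k = toℚᵘ-injective (begin
    toℚᵘ (natℚ (suc k))               ≈⟨ toℚᵘ-fromℚᵘ (ℚᵘ.mkℚᵘ (ℤ.+ suc k) 0) ⟩
    ℚᵘ.mkℚᵘ (ℤ.+ suc k) 0             ≈⟨ ℚᵘ.*≡* (cong (ℤ._* ℤ.1ℤ) (cong (ℤ._+_ (ℤ.+ 1)) (sym (ℤₚ.*-identityʳ (ℤ.+ k))))) ⟩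
    ℚᵘ.1ℚᵘ ℚᵘ.+ ℚᵘ.mkℚᵘ (ℤ.+ k) 0     ≈⟨ ℚᵘₚ.+-congʳ ℚᵘ.1ℚᵘ (ℚᵘₚ.≃-sym (toℚᵘ-fromℚᵘ (ℚᵘ.mkℚᵘ (ℤ.+ k) 0))) ⟩
    toℚᵘ 1ℚ ℚᵘ.+ toℚᵘ (natℚ k)        ≈⟨ ℚᵘₚ.≃-sym (toℚᵘ-homo-+ 1ℚ (natℚ k)) ⟩
    toℚᵘ (1ℚ + natℚ k)                ∎)
    where open ℚᵘₚ.≃-Reasoning

  recip-inverse : ∀ k → natℚ (suc k) * recip (suc k) ≡ 1ℚ
  recip-inverse k = toℚᵘ-injective (begin
    toℚᵘ (natℚ (suc k) * recip (suc k))             ≈⟨ toℚᵘ-homo-* (natℚ (suc k)) (recip (suc k)) ⟩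
    toℚᵘ (natℚ (suc k)) ℚᵘ.* toℚᵘ (recip (suc k))   ≈⟨ ℚᵘₚ.*-cong (toℚᵘ-fromℚᵘ (ℚᵘ.mkℚᵘ (ℤ.+ suc k) 0)) (toℚᵘ-fromℚᵘ (ℚᵘ.mkℚᵘ (ℤ.+ 1) k)) ⟩
    ℚᵘ.mkℚᵘ (ℤ.+ suc k) 0 ℚᵘ.* ℚᵘ.mkℚᵘ (ℤ.+ 1) k    ≈⟨ ℚᵘ.*≡* (begin′ k) ⟩
    ℚᵘ.1ℚᵘ                                          ∎)
    where
    open ℚᵘₚ.≃-Reasoning
    begin′ : ∀ k → (ℤ.+ suc k ℤ.* ℤ.+ 1) ℤ.* ℤ.+ 1 ≡ ℤ.+ 1 ℤ.* (ℤ.+ (1 ℕ.* suc k))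
    begin′ k = trans (ℤₚ.*-identityʳ _) (trans (ℤₚ.*-identityʳ (ℤ.+ suc k))
      (sym (trans (ℤₚ.*-identityˡ _) (cong ℤ.+_ (ℕₚ.*-identityˡ (suc k))))))

  natℚ-nonneg : ∀ k → 0ℚ ≤ natℚ k
  natℚ-nonneg k = nonNegative⁻¹ (natℚ k) {{normalize-nonNeg k 1}}

  recip-pos : ∀ k → 0ℚ < recip (suc k)
  recip-pos k = positive⁻¹ (recip (suc k)) {{normalize-pos 1 (suc k)}}

  archimedean : ∀ q → ∃[ N ] (q ≤ natℚ N)
  archimedean q@(mkℚ n d _) = ℤ.∣ n ∣ , toℚᵘ-cancel-≤
    (ℚᵘₚ.≤-trans {j = ℚᵘ.mkℚᵘ (ℤ.+ ℤ.∣ n ∣) 0} (ℚᵘ.*≤* (bound n))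
      (ℚᵘₚ.≤-reflexive (ℚᵘₚ.≃-sym (toℚᵘ-fromℚᵘ (ℚᵘ.mkℚᵘ (ℤ.+ ℤ.∣ n ∣) 0)))))
    where
    bound : ∀ n → n ℤ.* ℤ.+ 1 ℤ.≤ ℤ.+ ℤ.∣ n ∣ ℤ.* ℤ.+ suc d
    bound n = subst₂ ℤ._≤_ (sym (ℤₚ.*-identityʳ n)) (ℤₚ.pos-* ℤ.∣ n ∣ (suc d))
      (ℤₚ.≤-trans (n≤ n) (ℤ.+≤+ (ℕₚ.m≤m*n ℤ.∣ n ∣ (suc d))))
      where
      n≤ : ∀ n → n ℤ.≤ ℤ.+ ℤ.∣ n ∣
      n≤ (ℤ.+ _)     = ℤₚ.≤-refl
      n≤ ℤ.-[1+ _ ]  = ℤ.-≤+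

  ^-nonneg : ∀ {q} → 0ℚ ≤ q → ∀ k → 0ℚ ≤ q ^ k
  ^-nonneg 0≤q zero    = 0≤1
  ^-nonneg 0≤q (suc k) = *-nonneg 0≤q (^-nonneg 0≤q k)

  ^-mono : ∀ {q r} → 0ℚ ≤ q → q ≤ r → ∀ k → q ^ k ≤ r ^ k
  ^-mono 0≤q q≤r zero    = ≤-refl
  ^-mono 0≤q q≤r (suc k) = *-mono (^-nonneg 0≤q k) (≤-trans 0≤q q≤r) q≤r (^-mono 0≤q q≤r k)

  ∣^∣ : ∀ {q B} → ∣ q ∣ ≤ B → ∀ k → ∣ q ^ k ∣ ≤ B ^ k
  ∣^∣ q≤B zero = ≤-refl
  ∣^∣ {q} q≤B (suc k) = subst (_≤ _) (sym (∣p*q∣≡∣p∣*∣q∣ q (q ^ k)))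
    (*-mono (0≤∣p∣ (q ^ k)) (≤-trans (0≤∣p∣ q) q≤B) q≤B (∣^∣ q≤B k))

  triangle : ∀ a b c → ∣ a - c ∣ ≤ ∣ a - b ∣ + ∣ b - c ∣
  triangle a b c = subst (λ z → ∣ z ∣ ≤ ∣ a - b ∣ + ∣ b - c ∣)
    (solve 3 (λ a b c → (a :- b) :+ (b :- c) := a :- c) refl a b c)
    (∣p+q∣≤∣p∣+∣q∣ (a - b) (b - c))

  ∣*-*∣ : ∀ q r q′ r′ → ∣ q * r - q′ * r′ ∣ ≤ ∣ q ∣ * ∣ r - r′ ∣ + ∣ q - q′ ∣ * ∣ r′ ∣
  ∣*-*∣ q r q′ r′ = subst₂ _≤_
    (cong ∣_∣ (solve 4 (λ q r q′ r′ → q :* (r :- r′) :+ (q :- q′) :* r′ := q :* r :- q′ :* r′) refl q r q′ r′))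
    (cong₂ _+_ (∣p*q∣≡∣p∣*∣q∣ q (r - r′)) (∣p*q∣≡∣p∣*∣q∣ (q - q′) r′))
    (∣p+q∣≤∣p∣+∣q∣ (q * (r - r′)) ((q - q′) * r′))

  ∣^-^∣ : ∀ {q r B} → ∣ q ∣ ≤ B → ∣ r ∣ ≤ B → ∀ k →
          ∣ q ^ k - r ^ k ∣ ≤ (B + 1ℚ) ^ k * ∣ q - r ∣
  ∣^-^∣ {q} {r} {B} q≤B r≤B zero = subst (_ ≤_) (sym (*-identityˡ _)) (0≤∣p∣ (q - r))
  ∣^-^∣ {q} {r} {B} q≤B r≤B (suc k) = begin
    ∣ q * q ^ k - r * r ^ k ∣
      ≤⟨ ∣*-*∣ q (q ^ k) r (r ^ k) ⟩
    ∣ q ∣ * ∣ q ^ k - r ^ k ∣ + d * ∣ r ^ k ∣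
      ≤⟨ +-mono-≤ (*-mono (0≤∣p∣ (q ^ k - r ^ k)) 0≤B q≤B (∣^-^∣ q≤B r≤B k))
                  (*-monoˡ-≤-nonNeg d {{nonNegative (0≤∣p∣ (q - r))}}
                    (≤-trans (∣^∣ r≤B k) (^-mono 0≤B (≤-+ʳ B 0≤1) k))) ⟩
    B * ((B + 1ℚ) ^ k * d) + d * (B + 1ℚ) ^ k
      ≡⟨ solve 3 (λ b m d → b :* (m :* d) :+ d :* m := (b :+ con 1ℚ) :* m :* d) refl B ((B + 1ℚ) ^ k) d ⟩
    (B + 1ℚ) * (B + 1ℚ) ^ k * d ∎
    where
    open ≤-Reasoning
    d = ∣ q - r ∣
    0≤B : 0ℚ ≤ B
    0≤B = ≤-trans (0≤∣p∣ q) q≤B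

  prefix-bound : (u : ℕ → ℚ) → ∀ K →
                 ∃[ B ] (0ℚ ≤ B × (∀ k → k ℕ.≤ K → ∣ u k ∣ ≤ B))
  prefix-bound u zero = ∣ u 0 ∣ , 0≤∣p∣ (u 0) , λ { .0 ℕ.z≤n → ≤-refl }
  prefix-bound u (suc K) = B + ∣ u (suc K) ∣ , +-nonneg 0≤B (0≤∣p∣ (u (suc K))) , go
    where
    ih = prefix-bound u K
    B = proj₁ ih
    0≤B = proj₁ (proj₂ ih)
    bd = proj₂ (proj₂ ih)
    go : ∀ k → k ℕ.≤ suc K → ∣ u k ∣ ≤ B + ∣ u (suc K) ∣
    go k k≤ = go′ k (ℕₚ.m≤n⇒m<n∨m≡n k≤)
      where
      go′ : ∀ k → k ℕ.< suc K ⊎ k ≡ suc K → ∣ u k ∣ ≤ B + ∣ u (suc K) ∣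
      go′ k (inj₁ (ℕ.s≤s k≤K)) = ≤-trans (bd k k≤K) (≤-+ʳ B (0≤∣p∣ (u (suc K))))
      go′ k (inj₂ refl) = subst (_≤ B + ∣ u (suc K) ∣) (+-identityˡ ∣ u (suc K) ∣)
                            (+-monoˡ-≤ ∣ u (suc K) ∣ 0≤B)

  cauchy-bound : ∀ {x} → IsCauchy x → ∃[ B ] (0ℚ ≤ B × (∀ n → ∣ x n ∣ ≤ B))
  cauchy-bound {x} cx = B + 1ℚ , +-nonneg 0≤B 0≤1 , λ n → go n (ℕₚ.≤-total n N)
    where
    N = proj₁ (cx 1ℚ 0<1)
    close = proj₂ (cx 1ℚ 0<1)
    B = proj₁ (prefix-bound x N)
    0≤B = proj₁ (proj₂ (prefix-bound x N))
    bd = proj₂ (proj₂ (prefix-bound x N))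
    go : ∀ n → n ℕ.≤ N ⊎ N ℕ.≤ n → ∣ x n ∣ ≤ B + 1ℚ
    go n (inj₁ n≤N) = ≤-trans (bd n n≤N) (≤-+ʳ B 0≤1)
    go n (inj₂ N≤n) = begin
      ∣ x n ∣                 ≡⟨ cong ∣_∣ (solve 2 (λ a b → a := b :+ (a :- b)) refl (x n) (x N)) ⟩
      ∣ x N + (x n - x N) ∣   ≤⟨ ∣p+q∣≤∣p∣+∣q∣ (x N) (x n - x N) ⟩
      ∣ x N ∣ + ∣ x n - x N ∣ ≤⟨ +-mono-≤ (bd N ℕₚ.≤-refl) (close n N N≤n ℕₚ.≤-refl) ⟩
      B + 1ℚ                  ∎
      where open ≤-Reasoning

  +-cauchy : ∀ {x y} → IsCauchy x → IsCauchy y → IsCauchy (λ n → x n + y n)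
  +-cauchy {x} {y} cx cy ε 0<ε =
    let N₁ , c₁ = cx (½ * ε) (*-pos 0<½ 0<ε)
        N₂ , c₂ = cy (½ * ε) (*-pos 0<½ 0<ε)
    in N₁ ℕ.⊔ N₂ , λ m n m≥ n≥ → begin
    ∣ x m + y m - (x n + y n) ∣
      ≡⟨ cong ∣_∣ (solve 4 (λ a b c d → a :+ b :- (c :+ d) := (a :- c) :+ (b :- d)) refl (x m) (y m) (x n) (y n)) ⟩
    ∣ (x m - x n) + (y m - y n) ∣
      ≤⟨ ∣p+q∣≤∣p∣+∣q∣ (x m - x n) (y m - y n) ⟩
    ∣ x m - x n ∣ + ∣ y m - y n ∣
      ≤⟨ +-mono-≤ (c₁ m n (ℕₚ.m⊔n≤o⇒m≤o N₁ N₂ m≥) (ℕₚ.m⊔n≤o⇒m≤o N₁ N₂ n≥))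
                  (c₂ m n (ℕₚ.m⊔n≤o⇒n≤o N₁ N₂ m≥) (ℕₚ.m⊔n≤o⇒n≤o N₁ N₂ n≥)) ⟩
    ½ * ε + ½ * ε ≡⟨ ½+½ ε ⟩
    ε ∎
    where open ≤-Reasoning

  neg-cauchy : ∀ {x} → IsCauchy x → IsCauchy (λ n → - x n)
  neg-cauchy {x} cx ε 0<ε = let N , c = cx ε 0<ε in N , λ m n m≥ n≥ → subst (_≤ ε)
    (trans (sym (∣-p∣≡∣p∣ (x m - x n)))
           (cong ∣_∣ (solve 2 (λ a b → :- (a :- b) := (:- a) :- (:- b)) refl (x m) (x n))))
    (c m n m≥ n≥)

  *-cauchy : ∀ {x y} → IsCauchy x → IsCauchy y → IsCauchy (λ n → x n * y n)
  *-cauchy {x} {y} cx cy ε 0<ε =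
    let A , 0≤A , ba = cauchy-bound {x} cx
        B , 0≤B , bb = cauchy-bound {y} cy
        η , 0<η , le = shrink (A + B) (+-nonneg 0≤A 0≤B) ε 0<ε
        N₁ , c₁      = cx η 0<η
        N₂ , c₂      = cy η 0<η
    in N₁ ℕ.⊔ N₂ , λ m n m≥ n≥ → begin
    ∣ x m * y m - x n * y n ∣
      ≤⟨ ∣*-*∣ (x m) (y m) (x n) (y n) ⟩
    ∣ x m ∣ * ∣ y m - y n ∣ + ∣ x m - x n ∣ * ∣ y n ∣
      ≤⟨ +-mono-≤
          (*-mono (0≤∣p∣ (y m - y n)) 0≤A (ba m)
            (c₂ m n (ℕₚ.m⊔n≤o⇒n≤o N₁ N₂ m≥) (ℕₚ.m⊔n≤o⇒n≤o N₁ N₂ n≥)))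
          (*-mono (0≤∣p∣ (y n)) (<⇒≤ 0<η)
            (c₁ m n (ℕₚ.m⊔n≤o⇒m≤o N₁ N₂ m≥) (ℕₚ.m⊔n≤o⇒m≤o N₁ N₂ n≥)) (bb n)) ⟩
    A * η + η * B
      ≡⟨ solve 3 (λ a b e → a :* e :+ e :* b := (a :+ b) :* e) refl A B η ⟩
    (A + B) * η
      ≤⟨ le ⟩
    ε ∎
    where open ≤-Reasoning

  recip!-nonneg : ∀ k → 0ℚ ≤ recip! k
  recip!-nonneg zero    = 0≤1
  recip!-nonneg (suc k) = *-nonneg (<⇒≤ (recip-pos k)) (recip!-nonneg k)

  natℚ-mono : ∀ {j k} → j ℕ.≤ k → natℚ j ≤ natℚ k
  natℚ-mono {j} {k} ℕ.z≤n = natℚ-nonneg k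
  natℚ-mono {suc j} {suc k} (ℕ.s≤s p) = subst₂ _≤_ (sym (natℚ-suc j)) (sym (natℚ-suc k))
    (+-monoʳ-≤ 1ℚ (natℚ-mono p))

  power/factorial-bound : ∀ L → 0ℚ ≤ L → ∃[ D ] (0ℚ ≤ D × (∀ k → L ^ k * recip! k ≤ D))
  power/factorial-bound L 0≤L = D , 0≤D , λ k → go k (ℕₚ.≤-total k K)
    where
    open ≤-Reasoning
    v : ℕ → ℚ
    v k = L ^ k * recip! k
    K = proj₁ (archimedean L)
    L≤K = proj₂ (archimedean L)
    D = proj₁ (prefix-bound v K)
    0≤D = proj₁ (proj₂ (prefix-bound v K))
    bd = proj₂ (proj₂ (prefix-bound v K))
    0≤v : ∀ k → 0ℚ ≤ v k
    0≤v k = *-nonneg (^-nonneg 0≤L k) (recip!-nonneg k)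
    small : ∀ k → k ℕ.≤ K → v k ≤ D
    small k k≤K = subst (_≤ D) (0≤p⇒∣p∣≡p (0≤v k)) (bd k k≤K)
    step : ∀ k → K ℕ.≤ k → v (suc k) ≤ v k
    step k K≤k = begin
      L * L ^ k * (recip (suc k) * recip! k)
        ≡⟨ solve 4 (λ l p r f → l :* p :* (r :* f) := (l :* r) :* (p :* f)) refl L (L ^ k) (recip (suc k)) (recip! k) ⟩
      (L * recip (suc k)) * v k
        ≤⟨ *-monoʳ-≤-nonNeg (v k) {{nonNegative (0≤v k)}}
             (≤-trans (*-monoʳ-≤-nonNeg (recip (suc k)) {{nonNegative (<⇒≤ (recip-pos k))}}
                         (≤-trans L≤K (natℚ-mono (ℕₚ.m≤n⇒m≤1+n K≤k))))
                      (≤-reflexive (recip-inverse k))) ⟩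
      1ℚ * v k ≡⟨ *-identityˡ (v k) ⟩
      v k ∎
    large : ∀ j → v (j ℕ.+ K) ≤ D
    large zero    = small K ℕₚ.≤-refl
    large (suc j) = ≤-trans (step (j ℕ.+ K) (ℕₚ.m≤n+m K j)) (large j)
    go : ∀ k → k ℕ.≤ K ⊎ K ℕ.≤ k → v k ≤ D
    go k (inj₁ k≤K) = small k k≤K
    go k (inj₂ K≤k) = subst (λ z → v z ≤ D) (ℕₚ.m∸n+n≡m K≤k) (large (k ℕ.∸ K))

  0≤½^ : ∀ k → 0ℚ ≤ ½ ^ k
  0≤½^ = ^-nonneg (<⇒≤ 0<½)

  ½^-* : ∀ M k → (M + M) ^ k * ½ ^ k ≡ M ^ k
  ½^-* M zero    = refl
  ½^-* M (suc k) = trans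
    (solve 3 (λ m a h → (m :+ m) :* a :* (con ½ :* h) := m :* (a :* h)) refl M ((M + M) ^ k) (½ ^ k))
    (cong (M *_) (½^-* M k))

  geometric-bound : ∀ M → 0ℚ ≤ M → ∃[ D ] (0ℚ ≤ D × (∀ k → M ^ k * recip! k ≤ D * ½ ^ k))
  geometric-bound M 0≤M =
    let D , 0≤D , bd = power/factorial-bound (M + M) (+-nonneg 0≤M 0≤M)
    in D , 0≤D , λ k → begin
    M ^ k * recip! k
      ≡⟨ cong (_* recip! k) (½^-* M k) ⟨
    (M + M) ^ k * ½ ^ k * recip! k
      ≡⟨ solve 3 (λ a h f → a :* h :* f := (a :* f) :* h) refl ((M + M) ^ k) (½ ^ k) (recip! k) ⟩
    (M + M) ^ k * recip! k * ½ ^ k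
      ≤⟨ *-monoʳ-≤-nonNeg (½ ^ k) {{nonNegative (0≤½^ k)}} (bd k) ⟩
    D * ½ ^ k ∎
    where open ≤-Reasoning

  ½^-small : ∀ k → ½ ^ k * natℚ (suc k) ≤ 1ℚ
  ½^-small zero    = ≤-refl
  ½^-small (suc k) = begin
    ½ * ½ ^ k * natℚ (suc (suc k))
      ≡⟨ cong (½ * ½ ^ k *_) (natℚ-suc (suc k)) ⟩
    ½ * ½ ^ k * (1ℚ + natℚ (suc k))
      ≤⟨ *-monoˡ-≤-nonNeg (½ * ½ ^ k) {{nonNegative (0≤½^ (suc k))}}
           (+-monoˡ-≤ (natℚ (suc k)) (natℚ-mono {1} {suc k} (ℕ.s≤s ℕ.z≤n))) ⟩
    ½ * ½ ^ k * (natℚ (suc k) + natℚ (suc k))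
      ≡⟨ solve 2 (λ h n → con ½ :* h :* (n :+ n) := h :* n) refl (½ ^ k) (natℚ (suc k)) ⟩
    ½ ^ k * natℚ (suc k)
      ≤⟨ ½^-small k ⟩
    1ℚ ∎
    where open ≤-Reasoning

  ½^-tends : ∀ ε → 0ℚ < ε → ∃[ N ] (½ ^ N ≤ ε)
  ½^-tends ε 0<ε = N , *-cancelʳ-≤-pos (natℚ (suc N)) {{normalize-pos (suc N) 1}} (begin
    ½ ^ N * natℚ (suc N)  ≤⟨ ½^-small N ⟩
    1ℚ                    ≡⟨ *-inverseʳ ε ⟨
    ε * 1/ ε              ≤⟨ *-monoˡ-≤-nonNeg ε {{nonNegative (<⇒≤ 0<ε)}}
                               (≤-trans 1/ε≤N (natℚ-mono (ℕₚ.n≤1+n N))) ⟩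
    ε * natℚ (suc N)      ∎)
    where
    open ≤-Reasoning
    instance
      ε-nz : NonZero ε
      ε-nz = pos⇒nonZero ε {{positive 0<ε}}
    N = proj₁ (archimedean (1/ ε))
    1/ε≤N = proj₂ (archimedean (1/ ε))

  telescope : (u g : ℕ → ℚ) → (∀ n → 0ℚ ≤ g n) →
              (∀ n → ∣ u (suc n) - u n ∣ + g (suc n) ≤ g n) →
              ∀ n j → ∣ u (j ℕ.+ n) - u n ∣ ≤ g n
  telescope u g 0≤g step n j = ≤-trans (≤-+ʳ _ (0≤g (j ℕ.+ n))) (go j)
    where
    open ≤-Reasoning
    go : ∀ j → ∣ u (j ℕ.+ n) - u n ∣ + g (j ℕ.+ n) ≤ g n
    go zero = ≤-reflexive (trans (cong (λ z → ∣ z ∣ + g n) (+-inverseʳ (u n))) (+-identityˡ (g n)))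
    go (suc j) = begin
      ∣ u (suc k) - u n ∣ + g (suc k)
        ≤⟨ +-monoˡ-≤ (g (suc k)) (triangle (u (suc k)) (u k) (u n)) ⟩
      ∣ u (suc k) - u k ∣ + ∣ u k - u n ∣ + g (suc k)
        ≡⟨ solve 3 (λ a b c → a :+ b :+ c := b :+ (a :+ c)) refl ∣ u (suc k) - u k ∣ ∣ u k - u n ∣ (g (suc k)) ⟩
      ∣ u k - u n ∣ + (∣ u (suc k) - u k ∣ + g (suc k))
        ≤⟨ +-monoʳ-≤ ∣ u k - u n ∣ (step k) ⟩
      ∣ u k - u n ∣ + g k
        ≤⟨ go j ⟩
      g n ∎
      where k = j ℕ.+ n

open Estimates

fromℚ : ℚ → ℝ
fromℚ q = mkℝ (λ _ → q) λ ε 0<ε → 0 , λ _ _ _ _ →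
  ≤-trans (≤-reflexive (cong ∣_∣ (+-inverseʳ q))) (<⇒≤ 0<ε)

0ᴿ 1ᴿ : ℝ
0ᴿ = fromℚ 0ℚ
1ᴿ = fromℚ 1ℚ

_+ᴿ_ _*ᴿ_ : ℝ → ℝ → ℝ
x +ᴿ y = mkℝ (λ n → seq x n + seq y n) (+-cauchy {seq x} {seq y} (cauchy x) (cauchy y))
x *ᴿ y = mkℝ (λ n → seq x n * seq y n) (*-cauchy {seq x} {seq y} (cauchy x) (cauchy y))

-ᴿ_ : ℝ → ℝ
-ᴿ x = mkℝ (λ n → - seq x n) (neg-cauchy {seq x} (cauchy x))

_^ᴿ_ : ℝ → ℕ → ℝ
x ^ᴿ zero  = 1ᴿ
x ^ᴿ suc k = x *ᴿ x ^ᴿ k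

-- The power series Σ sₖ xᵏ / k! with |sₖ| ≤ 1.  The n-th rational
-- approximation at x is the n-term partial sum at the n-th
-- approximation of x.

partialSum : (ℕ → ℚ) → ℕ → ℚ → ℚ
partialSum s zero    q = 0ℚ
partialSum s (suc n) q = partialSum s n q + s n * (q ^ n * recip! n)

module SeriesEstimates where
  open +-*-Solver using (solve; con; :-_; _:+_; _:*_; _:-_; _:=_)

  module _ {s : ℕ → ℚ} (s≤1 : ∀ k → ∣ s k ∣ ≤ 1ℚ) where
    open ≤-Reasoning

    ∣s*∣ : ∀ k q → ∣ s k * q ∣ ≤ ∣ q ∣
    ∣s*∣ k q = begin
      ∣ s k * q ∣     ≡⟨ ∣p*q∣≡∣p∣*∣q∣ (s k) q ⟩
      ∣ s k ∣ * ∣ q ∣ ≤⟨ *-monoʳ-≤-nonNeg ∣ q ∣ {{∣-∣-nonNeg q}} (s≤1 k) ⟩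
      1ℚ * ∣ q ∣      ≡⟨ *-identityˡ ∣ q ∣ ⟩
      ∣ q ∣           ∎

    ∣*recip!∣ : ∀ q k → ∣ q * recip! k ∣ ≡ ∣ q ∣ * recip! k
    ∣*recip!∣ q k = trans (∣p*q∣≡∣p∣*∣q∣ q (recip! k))
      (cong (∣ q ∣ *_) (0≤p⇒∣p∣≡p (recip!-nonneg k)))

    P : ℕ → ℚ → ℚ
    P = partialSum s

    module _ (B : ℚ) (0≤B : 0ℚ ≤ B) (D : ℚ) (0≤D : 0ℚ ≤ D)
             (bd : ∀ k → (B + 1ℚ) ^ k * recip! k ≤ D * ½ ^ k) where

      G : ℕ → ℚ
      G n = D * (½ ^ n + ½ ^ n)

      0≤G : ∀ n → 0ℚ ≤ G n
      0≤G n = *-nonneg 0≤D (+-nonneg (0≤½^ n) (0≤½^ n))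

      G-step : ∀ n → D * ½ ^ n + G (suc n) ≡ G n
      G-step n = solve 2 (λ d h → d :* h :+ d :* (con ½ :* h :+ con ½ :* h) := d :* (h :+ h)) refl D (½ ^ n)

      tail : ∀ q → ∣ q ∣ ≤ B → ∀ n j → ∣ P (j ℕ.+ n) q - P n q ∣ ≤ G n
      tail q q≤B = telescope (λ n → P n q) G 0≤G λ n →
        ≤-trans (+-monoˡ-≤ (G (suc n)) (begin
          ∣ P n q + s n * (q ^ n * recip! n) - P n q ∣
            ≡⟨ cong ∣_∣ (solve 2 (λ a b → a :+ b :- a := b) refl (P n q) (s n * (q ^ n * recip! n))) ⟩
          ∣ s n * (q ^ n * recip! n) ∣
            ≤⟨ ∣s*∣ n (q ^ n * recip! n) ⟩
          ∣ q ^ n * recip! n ∣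
            ≡⟨ ∣*recip!∣ (q ^ n) n ⟩
          ∣ q ^ n ∣ * recip! n
            ≤⟨ *-monoʳ-≤-nonNeg (recip! n) {{nonNegative (recip!-nonneg n)}}
                 (≤-trans (∣^∣ q≤B n) (^-mono 0≤B (≤-+ʳ B 0≤1) n)) ⟩
          (B + 1ℚ) ^ n * recip! n
            ≤⟨ bd n ⟩
          D * ½ ^ n ∎)) (≤-reflexive (G-step n))

      lipschitz : ∀ q r → ∣ q ∣ ≤ B → ∣ r ∣ ≤ B → ∀ n → ∣ P n q - P n r ∣ ≤ G 0 * ∣ q - r ∣
      lipschitz q r q≤B r≤B n = subst (_≤ G 0 * d)
        (cong ∣_∣ (trans (cong (λ z → P z q - P z r - (0ℚ - 0ℚ)) (ℕₚ.+-identityʳ n))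
                         (+-identityʳ (P n q - P n r))))
        (telescope (λ n → P n q - P n r) (λ n → G n * d)
          (λ n → *-nonneg (0≤G n) (0≤∣p∣ (q - r))) step 0 n)
        where
        d = ∣ q - r ∣
        step : ∀ n → ∣ (P (suc n) q - P (suc n) r) - (P n q - P n r) ∣ + G (suc n) * d ≤ G n * d
        step n = begin
          ∣ (P (suc n) q - P (suc n) r) - (P n q - P n r) ∣ + G (suc n) * d
            ≡⟨ cong (λ z → ∣ z ∣ + G (suc n) * d)
                 (solve 6 (λ a b s x y f → ((a :+ s :* (x :* f)) :- (b :+ s :* (y :* f))) :- (a :- b)
                            := s :* ((x :- y) :* f)) refl
                   (P n q) (P n r) (s n) (q ^ n) (r ^ n) (recip! n)) ⟩
          ∣ s n * ((q ^ n - r ^ n) * recip! n) ∣ + G (suc n) * d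
            ≤⟨ +-monoˡ-≤ (G (suc n) * d) (begin
                 ∣ s n * ((q ^ n - r ^ n) * recip! n) ∣
                   ≤⟨ ∣s*∣ n ((q ^ n - r ^ n) * recip! n) ⟩
                 ∣ (q ^ n - r ^ n) * recip! n ∣
                   ≡⟨ ∣*recip!∣ (q ^ n - r ^ n) n ⟩
                 ∣ q ^ n - r ^ n ∣ * recip! n
                   ≤⟨ *-monoʳ-≤-nonNeg (recip! n) {{nonNegative (recip!-nonneg n)}} (∣^-^∣ q≤B r≤B n) ⟩
                 (B + 1ℚ) ^ n * d * recip! n
                   ≡⟨ solve 3 (λ m d f → m :* d :* f := (m :* f) :* d) refl ((B + 1ℚ) ^ n) d (recip! n) ⟩
                 (B + 1ℚ) ^ n * recip! n * d
                   ≤⟨ *-monoʳ-≤-nonNeg d {{∣-∣-nonNeg (q - r)}} (bd n) ⟩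
                 D * ½ ^ n * d ∎) ⟩
          D * ½ ^ n * d + G (suc n) * d
            ≡⟨ *-distribʳ-+ d (D * ½ ^ n) (G (suc n)) ⟨
          (D * ½ ^ n + G (suc n)) * d
            ≡⟨ cong (_* d) (G-step n) ⟩
          G n * d ∎

    series-cauchy : ∀ {x} → IsCauchy x → IsCauchy (λ n → P n (x n))
    series-cauchy {x} cx ε 0<ε = N₁ ℕ.⊔ N₂ , λ m n m≥ n≥ → begin
      ∣ P m (x m) - P n (x n) ∣
        ≤⟨ triangle (P m (x m)) (P m (x n)) (P n (x n)) ⟩
      ∣ P m (x m) - P m (x n) ∣ + ∣ P m (x n) - P n (x n) ∣
        ≤⟨ +-mono-≤
             (≤-trans (lipschitz B 0≤B D 0≤D bd (x m) (x n) (x≤B m) (x≤B n) m)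
               (≤-trans (*-monoˡ-≤-nonNeg (Gk 0) {{nonNegative 0≤G₀}}
                          (close m n (ℕₚ.m⊔n≤o⇒m≤o N₁ N₂ m≥) (ℕₚ.m⊔n≤o⇒m≤o N₁ N₂ n≥)))
                 leη))
             (≤-trans (triangle (P m (x n)) (P N₂ (x n)) (P n (x n)))
               (≤-trans (+-mono-≤ (tail′ (x n) (x≤B n) m (ℕₚ.m⊔n≤o⇒n≤o N₁ N₂ m≥))
                          (subst (_≤ Gk N₂) (∣-∣-sym (P n (x n)) (P N₂ (x n)))
                            (tail′ (x n) (x≤B n) n (ℕₚ.m⊔n≤o⇒n≤o N₁ N₂ n≥))))
                 2G≤)) ⟩
      ½ * ε + ½ * ε ≡⟨ ½+½ ε ⟩
      ε ∎
      where
      B = proj₁ (cauchy-bound {x} cx)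
      0≤B = proj₁ (proj₂ (cauchy-bound {x} cx))
      x≤B = proj₂ (proj₂ (cauchy-bound {x} cx))
      geo = geometric-bound (B + 1ℚ) (+-nonneg 0≤B 0≤1)
      D = proj₁ geo
      0≤D = proj₁ (proj₂ geo)
      bd = proj₂ (proj₂ geo)
      Gk = G B 0≤B D 0≤D bd
      0≤G₀ = 0≤G B 0≤B D 0≤D bd 0
      4D = D + D + (D + D)
      0≤4D : 0ℚ ≤ 4D
      0≤4D = +-nonneg (+-nonneg 0≤D 0≤D) (+-nonneg 0≤D 0≤D)
      0<½ε = *-pos 0<½ 0<ε
      sh₁ = shrink (Gk 0) 0≤G₀ (½ * ε) 0<½ε
      η = proj₁ sh₁
      leη = proj₂ (proj₂ sh₁)
      sh₂ = shrink 4D 0≤4D (½ * ε) 0<½ε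
      θ = proj₁ sh₂
      N₁ = proj₁ (cx η (proj₁ (proj₂ sh₁)))
      close = proj₂ (cx η (proj₁ (proj₂ sh₁)))
      N₂ = proj₁ (½^-tends θ (proj₁ (proj₂ sh₂)))
      ∣-∣-sym : ∀ a b → ∣ a - b ∣ ≡ ∣ b - a ∣
      ∣-∣-sym a b = trans (sym (∣-p∣≡∣p∣ (a - b)))
        (cong ∣_∣ (solve 2 (λ a b → :- (a :- b) := b :- a) refl a b))
      tail′ : ∀ q → ∣ q ∣ ≤ B → ∀ m → N₂ ℕ.≤ m → ∣ P m q - P N₂ q ∣ ≤ Gk N₂
      tail′ q q≤B m N₂≤m = subst (λ z → ∣ P z q - P N₂ q ∣ ≤ Gk N₂) (ℕₚ.m∸n+n≡m N₂≤m)
        (tail B 0≤B D 0≤D bd q q≤B N₂ (m ℕ.∸ N₂))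
      2G≤ : Gk N₂ + Gk N₂ ≤ ½ * ε
      2G≤ = begin
        Gk N₂ + Gk N₂
          ≡⟨ solve 2 (λ d h → d :* (h :+ h) :+ d :* (h :+ h) := (d :+ d :+ (d :+ d)) :* h) refl D (½ ^ N₂) ⟩
        4D * ½ ^ N₂
          ≤⟨ *-monoˡ-≤-nonNeg 4D {{nonNegative 0≤4D}} (proj₂ (½^-tends θ (proj₁ (proj₂ sh₂)))) ⟩
        4D * θ
          ≤⟨ proj₂ (proj₂ sh₂) ⟩
        ½ * ε ∎

open SeriesEstimates

series : (s : ℕ → ℚ) → (∀ k → ∣ s k ∣ ≤ 1ℚ) → ℝ → ℝ
series s s≤1 x = mkℝ (λ n → partialSum s n (seq x n)) (series-cauchy s≤1 {seq x} (cauchy x))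

-- The real and imaginary parts of iᵏ.
re-i^ im-i^ : ℕ → ℚ
re-i^ 0             = 1ℚ
re-i^ 1             = 0ℚ
re-i^ (suc (suc k)) = - re-i^ k
im-i^ 0             = 0ℚ
im-i^ 1             = 1ℚ
im-i^ (suc (suc k)) = - im-i^ k

private
  re-i^≤1 : ∀ k → ∣ re-i^ k ∣ ≤ 1ℚ
  re-i^≤1 0             = ≤-refl
  re-i^≤1 1             = 0≤1
  re-i^≤1 (suc (suc k)) = subst (_≤ 1ℚ) (sym (∣-p∣≡∣p∣ (re-i^ k))) (re-i^≤1 k)

  im-i^≤1 : ∀ k → ∣ im-i^ k ∣ ≤ 1ℚ
  im-i^≤1 0             = 0≤1
  im-i^≤1 1             = ≤-refl
  im-i^≤1 (suc (suc k)) = subst (_≤ 1ℚ) (sym (∣-p∣≡∣p∣ (im-i^ k))) (im-i^≤1 k)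

exp cos sin : ℝ → ℝ
exp = series (λ _ → 1ℚ) (λ _ → ≤-refl)
cos = series re-i^ re-i^≤1
sin = series im-i^ im-i^≤1

-- l = log (1/x), i.e. eˡ = 1/x.
_IsLogOfInverse_ : ℝ → ℝ → Set
l IsLogOfInverse x = exp l *ᴿ x ≈ᴿ 1ᴿ

-- π is specified as the least positive zero of sin.
IsPi : ℝ → Set
IsPi π = 0ᴿ <ᴿ π × sin π ≈ᴿ 0ᴿ × (∀ x → 0ᴿ <ᴿ x → x <ᴿ π → 0ᴿ <ᴿ sin x)

record ℂ : Set where
  constructor _+i_
  field
    re im : ℝ
open ℂ public

0ᶜ 1ᶜ : ℂ
0ᶜ = 0ᴿ +i 0ᴿ
1ᶜ = 1ᴿ +i 0ᴿ

_+ᶜ_ _*ᶜ_ : ℂ → ℂ → ℂ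
(a +i b) +ᶜ (c +i d) = (a +ᴿ c) +i (b +ᴿ d)
(a +i b) *ᶜ (c +i d) = (a *ᴿ c +ᴿ -ᴿ (b *ᴿ d)) +i (a *ᴿ d +ᴿ b *ᴿ c)

_·ᶜ_ : ℚ → ℂ → ℂ
q ·ᶜ (a +i b) = (fromℚ q *ᴿ a) +i (fromℚ q *ᴿ b)

_^ᶜ_ : ℂ → ℕ → ℂ
z ^ᶜ zero  = 1ᶜ
z ^ᶜ suc k = z *ᶜ z ^ᶜ k

e^i : ℝ → ℂ
e^i θ = cos θ +i sin θ

_IsModulusOf_ : ℝ → ℂ → Set
r IsModulusOf z = 0ᴿ ≤ᴿ r × r ^ᴿ 2 ≈ᴿ re z ^ᴿ 2 +ᴿ im z ^ᴿ 2

-- The mean; it is only used on nonempty lists.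
𝔼 : {A : Set} → List A → (A → ℂ) → ℂ
𝔼 xs g = recip (List.length xs) ·ᶜ List.foldr (λ x s → g x +ᶜ s) 0ᶜ xs

vectors : {A : Set} → List A → ∀ n → List (Vec A n)
vectors xs zero    = [] ∷ []
vectors xs (suc n) = List.concatMap (λ x → List.map (x ∷_) (vectors xs n)) xs

module PrimeField (p : ℕ) .{{_ : ℕ.NonZero p}} where

  infixl 6 _+ᶠ_ _-ᶠ_ _⊕_
  infixl 7 _*ᶠ_
  infixr 8 _^ᶠ_

  𝔽 : Set
  𝔽 = Fin p

  0ᶠ 1ᶠ : 𝔽
  0ᶠ = 0 mod p
  1ᶠ = 1 mod p

  _+ᶠ_ _*ᶠ_ _-ᶠ_ : 𝔽 → 𝔽 → 𝔽
  a +ᶠ b = (toℕ a ℕ.+ toℕ b) mod p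
  a *ᶠ b = (toℕ a ℕ.* toℕ b) mod p
  a -ᶠ b = (toℕ a ℕ.+ (p ℕ.∸ toℕ b)) mod p

  _^ᶠ_ : 𝔽 → ℕ → 𝔽
  a ^ᶠ zero  = 1ᶠ
  a ^ᶠ suc k = a *ᶠ a ^ᶠ k

  ∑ : ∀ {c} → (Fin c → 𝔽) → 𝔽
  ∑ = Vector.foldr _+ᶠ_ 0ᶠ

  _⊕_ : ∀ {n} → Vec 𝔽 n → Vec 𝔽 n → Vec 𝔽 n
  _⊕_ = Vec.zipWith _+ᶠ_

  -- A polynomial is a list of terms: a coefficient with the exponents
  -- of x₁, …, xₙ.  Repeated monomials and zero coefficients are allowed,
  -- which does not affect the least degree of a representing polynomial.
  Term : ℕ → Set
  Term n = 𝔽 × Vec ℕ n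

  Polynomial : ℕ → Set
  Polynomial n = List (Term n)

  evalTerm : ∀ {n} → Term n → Vec 𝔽 n → 𝔽
  evalTerm (a , es) x = a *ᶠ Vec.foldr′ _*ᶠ_ 1ᶠ (Vec.zipWith _^ᶠ_ x es)

  eval : ∀ {n} → Polynomial n → Vec 𝔽 n → 𝔽
  eval P x = List.foldr (λ t s → evalTerm t x +ᶠ s) 0ᶠ P

  DegreeAtMost : ∀ {n} → ℕ → (Vec 𝔽 n → 𝔽) → Set
  DegreeAtMost d f = ∃[ P ] (All (λ t → Vec.sum (proj₂ t) ℕ.≤ d) P × (∀ x → eval P x ≡ f x))

  HasDegree : ∀ {n} → ℕ → (Vec 𝔽 n → 𝔽) → Set
  HasDegree d f = DegreeAtMost d f × (∀ e → DegreeAtMost e f → d ℕ.≤ e)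

  Δ : ∀ {n} → Vec 𝔽 n → (Vec 𝔽 n → 𝔽) → Vec 𝔽 n → 𝔽
  Δ y f x = f (x ⊕ y) -ᶠ f x

  -- Δ* (y₁ ∷ … ∷ y_d ∷ []) f = Δ y_d (… (Δ y₁ f)).
  Δ* : ∀ {n d} → Vec (Vec 𝔽 n) d → (Vec 𝔽 n → 𝔽) → Vec 𝔽 n → 𝔽
  Δ* []       f = f
  Δ* (y ∷ ys) f = Δ* ys (Δ y f)

  ω : ℝ → ℂ
  ω π = e^i (fromℚ (ℤ.+ 2 / p) *ᴿ π)

  -- The head of v is x, its tail y₁, …, y_d.
  gowersMean : ℝ → ∀ d {n} → (Vec 𝔽 n → 𝔽) → ℂ
  gowersMean π d {n} f = 𝔼 (vectors (vectors (List.allFin p) n) (suc d))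
    λ v → ω π ^ᶜ toℕ (Δ* (Vec.tail v) f (Vec.head v))

  -- δ = ‖f‖_{U^d}: the nonnegative real whose 2ᵈ-th power is |gowersMean|.
  IsGowersNorm : ℝ → ∀ d {n} → (Vec 𝔽 n → 𝔽) → ℝ → Set
  IsGowersNorm π d f δ = 0ᴿ ≤ᴿ δ × (δ ^ᴿ (2 ℕ.^ d)) IsModulusOf gowersMean π d f

{-# OPTIONS --safe #-}

-- Let T (y, z, w) be the third difference of f, a symmetric trilinear form.  It
-- is enough to find c = O(log²(1/δ)) linear forms on whose common zeros T
-- vanishes: projecting along them one at a time, each step splits off one
-- product ℓ q (Newton expansion in one direction), and what remains has vanishing
-- third differences, hence degree at most 2.  By orthogonality of characters, δ⁸
-- is the proportion β of pairs (y, z) with T (y, z, ·) = 0.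
--
-- Start with K = 𝔽ⁿ.  As long as there is a y such that the form T (y, ·, ·) has
-- rank at most m and is nonzero on K × K, replace K by its intersection with the
-- kernel of that form.  Suppose this happens t times, with T (yⱼ, uⱼ, vⱼ) ≠ 0.  On
-- each translate of span (yⱼ) × span (uⱼ) the conditions T (y, z, vⱼ) = 0 form a
-- triangular system with at most (2p-1)ᵗ among p²ᵗ solutions, so β ≤ (3/4)ᵗ.
-- Hence for (4/3)ᵐ > 1/β the process stops after fewer than m steps.  At that
-- point T (y, ·, ·) has rank greater than m for every y outside the subspace
-- W = {y : T (y, K, K) = 0}, so that β ≤ |W|/pⁿ + p⁻ᵐ⁻¹ and W has codimension at
-- most m.  Then T vanishes on W ∩ K, which has codimension at most m² + m, and
-- m = O(log (1/β)) because β is bounded away from 1.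
--
-- The Gowers mean is evaluated on the level of the n-th rational approximations:
-- there it equals γₙ + β (1 - γₙ), where γₙ is 1/p times the sum of the powers of
-- the approximation to ω, and γₙ → 0 because ωᵖ = 1 and Re ω < 1.

module Submission where

open import Data.Nat using (ℕ; zero; suc; NonZero; z≤n; s≤s)
open import Data.Nat.Primality using (Prime; prime⇒nonTrivial)
open import Data.Fin using (Fin; zero; suc; toℕ)
open import Data.Vec using (Vec; []; _∷_)
open import Data.Product using (Σ; ∃; ∃-syntax; _×_; _,_; proj₁; proj₂)
open import Relation.Binary.PropositionalEquality using (_≡_; _≢_; _≗_)
import Relation.Binary.PropositionalEquality as ≡
open import Relation.Binary.PropositionalEquality.Algebra using (isMagma)
import Data.Nat as ℕ
import Data.Nat.Properties as ℕₚ
import Data.Nat.DivMod as ℕ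
open import Data.Nat.DivMod using (_mod_)
import Data.Nat.Coprimality as Coprimality
open import Data.Nat.GCD using (module Bézout)
open import Data.Nat.Combinatorics using (_C_; nC1≡n; nCk+nC[k+1]≡[n+1]C[k+1]; k>n⇒nCk≡0)
import Data.Nat.Tactic.RingSolver as ℕ-Solver
import Data.Integer as ℤ
import Data.Integer.Properties as ℤₚ
import Data.Integer.Tactic.RingSolver as ℤ-Solver
import Data.Rational.Unnormalised as ℚᵘ
import Data.Rational.Unnormalised.Properties as ℚᵘₚ
import Data.Fin.Properties as Finₚ
open import Data.Fin.Permutation using (Permutation′; permutation)
import Data.Vec as Vec
import Data.Vec.Properties as Vecₚ
open import Data.Vec.Relation.Unary.All as Allᵛ using ([]; _∷_)
import Data.Vec.Relation.Unary.All.Properties as Allᵛₚ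
open import Data.List as List using (List; []; _∷_)
open import Data.List.Relation.Unary.All as All using (All; []; _∷_)
import Data.List.Relation.Unary.All.Properties as Allₚ
open import Data.Maybe using (Maybe; just; nothing)
open import Data.Sum using (_⊎_; inj₁; inj₂)
open import Data.Unit using (⊤)
open import Data.Empty using (⊥-elim)
open import Function using (_∘_; id)
open import Algebra.Bundles using (CommutativeMonoid; CommutativeRing; RawRing)
import Algebra.Properties.CommutativeMonoid.Sum
import Algebra.Properties.Ring
import Algebra.Properties.Semiring.Mult.TCOptimised
import Algebra.Solver.CommutativeMonoid
import Algebra.Solver.Ring
open import Algebra.Solver.Ring.AlmostCommutativeRing using (_-Raw-AlmostCommutative⟶_; fromCommutativeRing)
open import Relation.Nullary using (¬_; Dec; yes; no)
open import Relation.Nullary.Decidable using (toWitness)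

-- The primes 2 and 3 are allowed, so f cannot be recovered from T by dividing by 3!. What links
-- degree and differences in every characteristic is Newton's forward difference formula: no
-- division occurs in it, and modulo p its binomial coefficients are polynomials of the right
-- degree.
--
-- Rank and dimension are never defined. "Rank at most m" becomes a finite search that ends with at
-- most m forms cutting out the common kernel or with m + 1 independent ones, and smallness of a set
-- becomes an inequality for sums of weights, proved by summing along lines.
--
-- No real numbers are compared to choose m: the integers 3ᵏ p²ⁿ and 4ᵏ N are, N being the number of
-- kernel pairs. Operations on reals act termwise and the character sum is evaluated for an
-- arbitrary number in place of ω, so the formula for the mean is exact at every n.
--
-- β is bounded away from 1 because degree exactly 3 forces T ≠ 0, and a single step of the chain
-- count then gives β ≤ (2p-1)/p² ≤ 3/4. This keeps log (1/δ) bounded below, with a constant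
-- independent of p.

-- Coefficients are formal differences m - n of natural numbers, kept with one
-- side zero, whose equality is decided without deciding equality in R.
module DifferenceSolver {c ℓ} (R : CommutativeRing c ℓ) where

  open CommutativeRing R hiding (zero)
  open Algebra.Properties.Ring ring
  open Algebra.Properties.Semiring.Mult.TCOptimised semiring
    renaming (_×_ to _×ᴿ_) using (×-homo-+; ×1-homo-*; 1+×)
  open import Relation.Binary.Reasoning.Setoid setoid
  private module +-Solver = Algebra.Solver.CommutativeMonoid +-commutativeMonoid

  ⟦_⟧ᵈ : ℕ × ℕ → Carrier
  ⟦ m , zero ⟧ᵈ  = m ×ᴿ 1#
  ⟦ m , suc n ⟧ᵈ = m ×ᴿ 1# + - (suc n ×ᴿ 1#)

  private
    difference : ∀ m n → ⟦ m , n ⟧ᵈ ≈ m ×ᴿ 1# + - (n ×ᴿ 1#)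
    difference m zero    = sym (trans (+-congˡ -0#≈0#) (+-identityʳ _))
    difference m (suc n) = refl

    swap-middle : ∀ a b c d → (a + b) + (c + d) ≈ (a + c) + (b + d)
    swap-middle = +-Solver.solve 4
      (λ a b c d → (a +-Solver.⊕ b) +-Solver.⊕ (c +-Solver.⊕ d)
        +-Solver.⊜ (a +-Solver.⊕ c) +-Solver.⊕ (b +-Solver.⊕ d)) refl

    swap-last : ∀ a b c d → (a + b) + (c + d) ≈ (a + d) + (b + c)
    swap-last = +-Solver.solve 4
      (λ a b c d → (a +-Solver.⊕ b) +-Solver.⊕ (c +-Solver.⊕ d)
        +-Solver.⊜ (a +-Solver.⊕ d) +-Solver.⊕ (b +-Solver.⊕ c)) refl

    cancel : ℕ → ℕ → ℕ × ℕ
    cancel m n = m ℕ.∸ n , n ℕ.∸ m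

    difference-cancel : ∀ m n → ⟦ cancel m n ⟧ᵈ ≈ m ×ᴿ 1# + - (n ×ᴿ 1#)
    difference-cancel zero    zero    = difference zero zero
    difference-cancel zero    (suc n) = difference zero (suc n)
    difference-cancel (suc m) zero    = difference (suc m) zero
    difference-cancel (suc m) (suc n) = begin
      ⟦ cancel m n ⟧ᵈ                                 ≈⟨ difference-cancel m n ⟩
      m ×ᴿ 1# + - (n ×ᴿ 1#)                           ≈⟨ +-identityˡ _ ⟨
      0# + (m ×ᴿ 1# + - (n ×ᴿ 1#))                    ≈⟨ +-congʳ (-‿inverseʳ 1#) ⟨
      (1# + - 1#) + (m ×ᴿ 1# + - (n ×ᴿ 1#))           ≈⟨ swap-middle _ _ _ _ ⟩
      (1# + m ×ᴿ 1#) + (- 1# + - (n ×ᴿ 1#))           ≈⟨ +-cong (1+× m 1#) (trans (-‿cong (1+× n 1#)) (sym (-‿+-comm _ _))) ⟨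
      suc m ×ᴿ 1# + - (suc n ×ᴿ 1#)                   ∎

    _+ᵈ_ _*ᵈ_ : ℕ × ℕ → ℕ × ℕ → ℕ × ℕ
    (m , n) +ᵈ (k , l) = cancel (m ℕ.+ k) (n ℕ.+ l)
    (m , n) *ᵈ (k , l) = cancel (m ℕ.* k ℕ.+ n ℕ.* l) (m ℕ.* l ℕ.+ n ℕ.* k)

    -ᵈ_ : ℕ × ℕ → ℕ × ℕ
    -ᵈ (m , n) = n , m

    +-homo : ∀ x y → ⟦ x +ᵈ y ⟧ᵈ ≈ ⟦ x ⟧ᵈ + ⟦ y ⟧ᵈ
    +-homo (m , n) (k , l) = begin
      ⟦ cancel (m ℕ.+ k) (n ℕ.+ l) ⟧ᵈ
        ≈⟨ difference-cancel (m ℕ.+ k) (n ℕ.+ l) ⟩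
      (m ℕ.+ k) ×ᴿ 1# + - ((n ℕ.+ l) ×ᴿ 1#)
        ≈⟨ +-cong (×-homo-+ 1# m k) (trans (-‿cong (×-homo-+ 1# n l)) (sym (-‿+-comm _ _))) ⟩
      (m ×ᴿ 1# + k ×ᴿ 1#) + (- (n ×ᴿ 1#) + - (l ×ᴿ 1#))
        ≈⟨ swap-middle _ _ _ _ ⟩
      (m ×ᴿ 1# + - (n ×ᴿ 1#)) + (k ×ᴿ 1# + - (l ×ᴿ 1#))
        ≈⟨ +-cong (difference m n) (difference k l) ⟨
      ⟦ m , n ⟧ᵈ + ⟦ k , l ⟧ᵈ ∎

    *-homo : ∀ x y → ⟦ x *ᵈ y ⟧ᵈ ≈ ⟦ x ⟧ᵈ * ⟦ y ⟧ᵈ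
    *-homo (m , n) (k , l) = begin
      ⟦ cancel (m ℕ.* k ℕ.+ n ℕ.* l) (m ℕ.* l ℕ.+ n ℕ.* k) ⟧ᵈ
        ≈⟨ difference-cancel (m ℕ.* k ℕ.+ n ℕ.* l) (m ℕ.* l ℕ.+ n ℕ.* k) ⟩
      (m ℕ.* k ℕ.+ n ℕ.* l) ×ᴿ 1# + - ((m ℕ.* l ℕ.+ n ℕ.* k) ×ᴿ 1#)
        ≈⟨ +-cong (split m k n l)
             (trans (-‿cong (split m l n k)) (sym (-‿+-comm _ _))) ⟩
      (a * b + a′ * b′) + (- (a * b′) + - (a′ * b))
        ≈⟨ swap-last _ _ _ _ ⟩
      (a * b + - (a′ * b)) + (a′ * b′ + - (a * b′))
        ≈⟨ +-congˡ (+-comm _ _) ⟩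
      (a * b + - (a′ * b)) + (- (a * b′) + a′ * b′)
        ≈⟨ +-cong (+-congˡ (-‿distribˡ-* a′ b))
             (+-cong (-‿distribʳ-* a b′)
               (trans (sym (-‿involutive _)) (trans (-‿cong (-‿distribˡ-* a′ b′)) (-‿distribʳ-* (- a′) b′)))) ⟩
      (a * b + - a′ * b) + (a * - b′ + - a′ * - b′)
        ≈⟨ +-cong (distribʳ b a (- a′)) (distribʳ (- b′) a (- a′)) ⟨
      (a + - a′) * b + (a + - a′) * - b′
        ≈⟨ distribˡ _ _ _ ⟨
      (a + - a′) * (b + - b′)
        ≈⟨ *-cong (difference m n) (difference k l) ⟨
      ⟦ m , n ⟧ᵈ * ⟦ k , l ⟧ᵈ ∎
      where
      a = m ×ᴿ 1#; a′ = n ×ᴿ 1#; b = k ×ᴿ 1#; b′ = l ×ᴿ 1#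
      split : ∀ i j s t → (i ℕ.* j ℕ.+ s ℕ.* t) ×ᴿ 1#
            ≈ (i ×ᴿ 1#) * (j ×ᴿ 1#) + (s ×ᴿ 1#) * (t ×ᴿ 1#)
      split i j s t = trans (×-homo-+ 1# (i ℕ.* j) (s ℕ.* t)) (+-cong (×1-homo-* i j) (×1-homo-* s t))

    -‿homo : ∀ x → ⟦ -ᵈ x ⟧ᵈ ≈ - ⟦ x ⟧ᵈ
    -‿homo (m , n) = begin
      ⟦ n , m ⟧ᵈ                         ≈⟨ difference n m ⟩
      n ×ᴿ 1# + - (m ×ᴿ 1#)              ≈⟨ +-comm _ _ ⟩
      - (m ×ᴿ 1#) + n ×ᴿ 1#              ≈⟨ +-congˡ (-‿involutive _) ⟨
      - (m ×ᴿ 1#) + - - (n ×ᴿ 1#)        ≈⟨ -‿+-comm _ _ ⟩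
      - (m ×ᴿ 1# + - (n ×ᴿ 1#))          ≈⟨ -‿cong (difference m n) ⟨
      - ⟦ m , n ⟧ᵈ                       ∎

    differences : RawRing _ _
    differences = record
      { Carrier = ℕ × ℕ ; _≈_ = _≡_ ; _+_ = _+ᵈ_ ; _*_ = _*ᵈ_ ; -_ = -ᵈ_
      ; 0# = 0 , 0 ; 1# = 1 , 0 }

    morphism : differences -Raw-AlmostCommutative⟶ fromCommutativeRing R
    morphism = record
      { ⟦_⟧ = ⟦_⟧ᵈ ; +-homo = +-homo ; *-homo = *-homo ; -‿homo = -‿homo
      ; 0-homo = refl ; 1-homo = refl }

    _≟ᵈ_ : ∀ x y → Maybe (⟦ x ⟧ᵈ ≈ ⟦ y ⟧ᵈ)
    (m , n) ≟ᵈ (k , l) with m ℕ.+ l ℕ.≟ k ℕ.+ n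
    ... | no _   = nothing
    ... | yes eq = just (begin
      ⟦ m , n ⟧ᵈ                  ≈⟨ difference m n ⟩
      a + - a′                    ≈⟨ +-identityʳ _ ⟨
      (a + - a′) + 0#             ≈⟨ +-congˡ (-‿inverseʳ b′) ⟨
      (a + - a′) + (b′ + - b′)    ≈⟨ swap-middle _ _ _ _ ⟩
      (a + b′) + (- a′ + - b′)    ≈⟨ +-congʳ (×-homo-+ 1# m l) ⟨
      (m ℕ.+ l) ×ᴿ 1# + (- a′ + - b′)
        ≈⟨ +-congʳ (reflexive (≡.cong (_×ᴿ 1#) eq)) ⟩
      (k ℕ.+ n) ×ᴿ 1# + (- a′ + - b′)
        ≈⟨ +-congʳ (×-homo-+ 1# k n) ⟩
      (b + a′) + (- a′ + - b′)    ≈⟨ swap-last _ _ _ _ ⟩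
      (b + - b′) + (a′ + - a′)    ≈⟨ +-congˡ (-‿inverseʳ a′) ⟩
      (b + - b′) + 0#             ≈⟨ +-identityʳ _ ⟩
      b + - b′                    ≈⟨ difference k l ⟨
      ⟦ k , l ⟧ᵈ                  ∎)
      where a = m ×ᴿ 1#; a′ = n ×ᴿ 1#; b = k ×ᴿ 1#; b′ = l ×ᴿ 1#

  open Algebra.Solver.Ring differences (fromCommutativeRing R) morphism _≟ᵈ_ public
    using (Polynomial; solve; con; _:+_; _:*_; :-_; _:-_; _:=_)

  :0 :1 : ∀ {n} → Polynomial n
  :0 = con (0 , 0)
  :1 = con (1 , 0)

-- Binomial absorption and the integer inequalities that fix m.

module Arithmetic where

  open import Data.Nat
  open import Data.Nat.Properties
  open import Relation.Binary.PropositionalEquality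

  -- This is (k+1) C(m, k+1) = (m-k) C(m, k) freed of subtraction. Read modulo p, it turns C(a, k)
  -- into a polynomial in a.
  nC-absorption : ∀ m k → suc k * (m C suc k) + k * (m C k) ≡ m * (m C k)
  nC-absorption zero    zero    = refl
  nC-absorption zero    (suc k) = cong₂ _+_ (*-zeroʳ (suc (suc k))) (*-zeroʳ (suc k))
  nC-absorption (suc m) zero    = trans (+-identityʳ _) (trans (+-identityʳ _)
    (trans (nC1≡n (suc m)) (sym (*-identityʳ (suc m)))))
  nC-absorption (suc m) (suc j) = begin
    suc k * (suc m C suc k) + k * (suc m C k)
      ≡⟨ cong₂ (λ a b → suc k * a + k * b) (nCk+nC[k+1]≡[n+1]C[k+1] m k) (nCk+nC[k+1]≡[n+1]C[k+1] m j) ⟨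
    suc k * (x + m C suc k) + k * (w + x)
      ≡⟨ regroup k x (m C suc k) w ⟩
    (suc k * (m C suc k) + k * x) + (k * x + x + k * w)
      ≡⟨ cong (_+ (k * x + x + k * w)) (nC-absorption m k) ⟩
    m * x + (k * x + x + (suc j * w))
      ≡⟨ regroup′ m j x w ⟩
    (k * x + j * w) + (m * x + x + w)
      ≡⟨ cong (_+ (m * x + x + w)) (nC-absorption m j) ⟩
    m * w + (m * x + x + w)
      ≡⟨ regroup″ m x w ⟩
    suc m * (w + x)
      ≡⟨ cong (suc m *_) (nCk+nC[k+1]≡[n+1]C[k+1] m j) ⟩
    suc m * (suc m C k) ∎
    where
    open ≡-Reasoning
    k = suc j
    x = m C k
    w = m C j
    regroup : ∀ k x y w → suc k * (x + y) + k * (w + x)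
            ≡ (suc k * y + k * x) + (k * x + x + k * w)
    regroup = ℕ-Solver.solve-∀
    regroup′ : ∀ m j x w → m * x + (suc j * x + x + suc j * w)
             ≡ (suc j * x + j * w) + (m * x + x + w)
    regroup′ = ℕ-Solver.solve-∀
    regroup″ : ∀ m x w → m * w + (m * x + x + w) ≡ suc m * (w + x)
    regroup″ = ℕ-Solver.solve-∀

  *-^-distrib : ∀ m n k → (m * n) ^ k ≡ m ^ k * n ^ k
  *-^-distrib m n zero    = refl
  *-^-distrib m n (suc k) = trans (cong (m * n *_) (*-^-distrib m n k)) (regroup m n (m ^ k) (n ^ k))
    where
    regroup : ∀ m n a b → m * n * (a * b) ≡ m * a * (n * b)
    regroup = ℕ-Solver.solve-∀

  -- Descending from `b` until `P` first fails needs no monotonicity: the result is a place where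
  -- `P` switches on.
  least-above : ∀ {P : ℕ → Set} → (∀ k → Dec (P k)) → ¬ P 1 → ∀ {b} → 1 ≤ b → P b →
                ∃[ k ] (¬ P (suc k) × P (suc (suc k)))
  least-above {P} P? ¬P1 {suc b} _ Pb = go b Pb
    where
    go : ∀ b → P (suc b) → ∃[ k ] (¬ P (suc k) × P (suc (suc k)))
    go zero    P1 = ⊥-elim (¬P1 P1)
    go (suc b) Pb with P? (suc b)
    ... | yes Pb′ = go b Pb′
    ... | no ¬Pb′ = b , ¬Pb′ , Pb

  -- Bernoulli's (4/3)ʲ ≥ 1 + j/3 with denominators cleared.
  bernoulli-4/3 : ∀ j → 3 ^ j * (3 + j) ≤ 3 * 4 ^ j
  bernoulli-4/3 zero    = ≤-refl
  bernoulli-4/3 (suc j) = begin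
    3 * 3 ^ j * (3 + suc j)             ≤⟨ m≤m+n _ (3 ^ j * j) ⟩
    3 * 3 ^ j * (3 + suc j) + 3 ^ j * j ≡⟨ regroup (3 ^ j) j ⟩
    4 * (3 ^ j * (3 + j))               ≤⟨ *-monoʳ-≤ 4 (bernoulli-4/3 j) ⟩
    4 * (3 * 4 ^ j)                     ≡⟨ swap (4 ^ j) ⟩
    3 * (4 * 4 ^ j)                     ∎
    where
    open ≤-Reasoning
    regroup : ∀ a j → 3 * a * (3 + suc j) + a * j ≡ 4 * (a * (3 + j))
    regroup = ℕ-Solver.solve-∀
    swap : ∀ a → 4 * (3 * a) ≡ 3 * (4 * a)
    swap = ℕ-Solver.solve-∀

  -- (4/3)³ᴹ ≥ 1 + M. Since β = N / M is at least 1 / M, the exponent 3M is beyond the threshold and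
  -- bounds the search in `bias-exponent`.
  power-exceeds : ∀ M → 3 ^ (3 * M) * M < 4 ^ (3 * M)
  power-exceeds M = *-cancelˡ-< 3 (3 ^ (3 * M) * M) (4 ^ (3 * M)) (<-≤-trans
    (subst (suc (3 * (3 ^ (3 * M) * M)) ≤_) (regroup (3 ^ (3 * M)) M)
      (+-monoˡ-≤ (3 * (3 ^ (3 * M) * M)) {1} {3 ^ (3 * M) * 3} (≤-trans (m^n>0 3 (3 * M)) (m≤m*n (3 ^ (3 * M)) 3))))
    (bernoulli-4/3 (3 * M)))
    where
    regroup : ∀ a m → a * 3 + 3 * (a * m) ≡ a * (3 + 3 * m)
    regroup = ℕ-Solver.solve-∀

  -- N / M will be the bias β.
  bias-exponent : ∀ M N → 1 ≤ M → 1 ≤ N → 4 * N ≤ 3 * M →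
                  ∃[ k ] (4 ^ suc k * N ≤ 3 ^ suc k * M × 3 ^ suc (suc k) * M < 4 ^ suc (suc k) * N)
  bias-exponent M N 1≤M 1≤N small =
    let k , ¬P , P = least-above {λ k → 3 ^ k * M < 4 ^ k * N} (λ k → 3 ^ k * M <? 4 ^ k * N)
          (≤⇒≯ (subst₂ _≤_ refl refl small)) {3 * M} (≤-trans 1≤M (m≤n*m M 3))
          (<-≤-trans (power-exceeds M) (subst (_≤ 4 ^ (3 * M) * N) (*-identityʳ (4 ^ (3 * M))) (*-monoʳ-≤ (4 ^ (3 * M)) 1≤N)))
    in k , ≮⇒≥ ¬P , P

  module _ {p : ℕ} (2≤p : 2 ≤ p) where

    private
      Q = p + p ∸ 1

      instance
        p-nonZero : NonZero p
        p-nonZero = >-nonZero (≤-trans (s≤s z≤n) 2≤p)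

    -- (2p-1)/p² = 1 - (1 - 1/p)² decreases in p and equals 3/4 at p = 2. This is the origin of 3/4
    -- and 4/3 throughout.
    4Q≤3p² : 4 * Q ≤ 3 * (p * p)
    4Q≤3p² = let k , eq = m≤n⇒∃[o]m+o≡n 2≤p in subst (λ p → 4 * (p + p ∸ 1) ≤ 3 * (p * p)) eq
      (subst (4 * (suc k + suc (suc k)) ≤_) (regroup k) (m≤m+n (4 * (suc k + suc (suc k))) (3 * (k * k) + 4 * k)))
      where
      regroup : ∀ k → 4 * (suc k + suc (suc k)) + (3 * (k * k) + 4 * k) ≡ 3 * (suc (suc k) * suc (suc k))
      regroup = ℕ-Solver.solve-∀

    bias≤3/4 : ∀ {M N} → p * p * N ≤ M * Q → 4 * N ≤ 3 * M
    bias≤3/4 {M} {N} le = *-cancelˡ-≤ (p * p) {{m*n≢0 p p}} (begin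
      p * p * (4 * N)      ≡⟨ regroup (p * p) N ⟩
      4 * (p * p * N)      ≤⟨ *-monoʳ-≤ 4 le ⟩
      4 * (M * Q)          ≡⟨ regroup M Q ⟨
      M * (4 * Q)          ≤⟨ *-monoʳ-≤ M 4Q≤3p² ⟩
      M * (3 * (p * p))    ≡⟨ regroup′ M (p * p) ⟩
      p * p * (3 * M)      ∎)
      where
      open ≤-Reasoning
      regroup : ∀ a b → a * (4 * b) ≡ 4 * (a * b)
      regroup = ℕ-Solver.solve-∀
      regroup′ : ∀ a b → a * (3 * b) ≡ b * (3 * a)
      regroup′ = ℕ-Solver.solve-∀

    -- From β > (3/4)ᵐ follows 2/β < 2 (4/3)ᵐ ≤ 2ᵐ⁺¹ ≤ pᵐ⁺¹, which is incompatible with the bound of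
    -- `terminal-thin`.
    few-thin : ∀ {M N} m → 3 ^ m * M < 4 ^ m * N → 2 * M < N * p ^ suc m
    few-thin {M} {N} m lt = *-cancelˡ-< (3 ^ m) (2 * M) (N * p ^ suc m) (begin-strict
      3 ^ m * (2 * M)            ≡⟨ regroup (3 ^ m) M ⟩
      2 * (3 ^ m * M)            <⟨ *-monoʳ-< 2 lt ⟩
      2 * (4 ^ m * N)            ≤⟨ *-monoʳ-≤ 2 (*-monoˡ-≤ N (^-monoˡ-≤ m {4} {6} (m≤m+n 4 2))) ⟩
      2 * ((3 * 2) ^ m * N)      ≡⟨ cong (λ s → 2 * (s * N)) (*-^-distrib 3 2 m) ⟩
      2 * (3 ^ m * 2 ^ m * N)    ≡⟨ regroup′ (3 ^ m) (2 ^ m) N ⟩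
      3 ^ m * (N * 2 ^ suc m)    ≤⟨ *-monoʳ-≤ (3 ^ m) (*-monoʳ-≤ N (^-monoˡ-≤ (suc m) {2} {p} 2≤p)) ⟩
      3 ^ m * (N * p ^ suc m)    ∎)
      where
      open ≤-Reasoning
      regroup : ∀ a b → a * (2 * b) ≡ 2 * (a * b)
      regroup = ℕ-Solver.solve-∀
      regroup′ : ∀ a b c → 2 * (a * b * c) ≡ a * (c * (2 * b))
      regroup′ = ℕ-Solver.solve-∀

    -- β > (3/4)ᵐ ≥ (Q/p²)ᵐ, which is incompatible with `chain-bound` for a chain of length m.
    no-long-chain : ∀ {M N} m → 3 ^ m * M < 4 ^ m * N → M * Q ^ m < p ^ m * p ^ m * N
    no-long-chain {M} {N} m lt = *-cancelˡ-< (4 ^ m) (M * Q ^ m) (p ^ m * p ^ m * N) (begin-strict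
      4 ^ m * (M * Q ^ m)            ≡⟨ regroup (4 ^ m) M (Q ^ m) ⟩
      M * (4 ^ m * Q ^ m)            ≡⟨ cong (M *_) (*-^-distrib 4 Q m) ⟨
      M * (4 * Q) ^ m                ≤⟨ *-monoʳ-≤ M (^-monoˡ-≤ m 4Q≤3p²) ⟩
      M * (3 * (p * p)) ^ m          ≡⟨ cong (M *_) (trans (*-^-distrib 3 (p * p) m) (cong (3 ^ m *_) (*-^-distrib p p m))) ⟩
      M * (3 ^ m * (p ^ m * p ^ m))  ≡⟨ regroup′ M (3 ^ m) (p ^ m * p ^ m) ⟩
      (3 ^ m * M) * (p ^ m * p ^ m)  <⟨ *-monoˡ-< (p ^ m * p ^ m) {{m*n≢0 (p ^ m) (p ^ m) {{m^n≢0 p m}} {{m^n≢0 p m}}}} lt ⟩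
      (4 ^ m * N) * (p ^ m * p ^ m)  ≡⟨ regroup″ (4 ^ m) N (p ^ m * p ^ m) ⟩
      4 ^ m * (p ^ m * p ^ m * N)    ∎)
      where
      open ≤-Reasoning
      regroup : ∀ a b c → a * (b * c) ≡ b * (a * c)
      regroup = ℕ-Solver.solve-∀
      regroup′ : ∀ a b c → a * (b * c) ≡ (b * a) * c
      regroup′ = ℕ-Solver.solve-∀
      regroup″ : ∀ a b c → a * b * c ≡ a * (c * b)
      regroup″ = ℕ-Solver.solve-∀

  -- The factor 7 comes from k = 0, where the largest `suc c` is 2² + 2 + 1.
  count-bound : ∀ k c → c ≤ suc (suc k) * suc (suc k) + suc (suc k) → suc c ≤ 7 * (suc k * suc k)
  count-bound k c le = ≤-trans (s≤s le) (subst (suc (suc (suc k) * suc (suc k) + suc (suc k)) ≤_) (regroup k)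
    (m≤m+n _ (6 * (k * k) + 9 * k)))
    where
    regroup : ∀ k → suc (suc (suc k) * suc (suc k) + suc (suc k)) + (6 * (k * k) + 9 * k) ≡ 7 * (suc k * suc k)
    regroup = ℕ-Solver.solve-∀

open import Defs
open Arithmetic

-- The ring of residues modulo p, and inverses for prime p.

module Residues (p : ℕ) .{{_ : NonZero p}} where

  open import Relation.Binary.PropositionalEquality

  open PrimeField p

  ⟦_⟧ : ℕ → 𝔽
  ⟦ m ⟧ = m mod p

  toℕ-⟦⟧ : ∀ m → toℕ ⟦ m ⟧ ≡ m ℕ.% p
  toℕ-⟦⟧ m = Finₚ.toℕ-fromℕ< (ℕ.m%n<n m p)

  ⟦⟧-cong : ∀ {m n} → m ℕ.% p ≡ n ℕ.% p → ⟦ m ⟧ ≡ ⟦ n ⟧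
  ⟦⟧-cong {m} {n} e = Finₚ.toℕ-injective (trans (toℕ-⟦⟧ m) (trans e (sym (toℕ-⟦⟧ n))))

  ⟦toℕ⟧ : ∀ a → ⟦ toℕ a ⟧ ≡ a
  ⟦toℕ⟧ a = Finₚ.toℕ-injective (trans (toℕ-⟦⟧ (toℕ a)) (ℕ.m<n⇒m%n≡m (Finₚ.toℕ<n a)))

  ⟦⟧-+ : ∀ m n → ⟦ m ⟧ +ᶠ ⟦ n ⟧ ≡ ⟦ m ℕ.+ n ⟧
  ⟦⟧-+ m n = ⟦⟧-cong (trans (cong (ℕ._% p) (cong₂ ℕ._+_ (toℕ-⟦⟧ m) (toℕ-⟦⟧ n)))
                            (sym (ℕ.%-distribˡ-+ m n p)))

  ⟦⟧-* : ∀ m n → ⟦ m ⟧ *ᶠ ⟦ n ⟧ ≡ ⟦ m ℕ.* n ⟧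
  ⟦⟧-* m n = ⟦⟧-cong (trans (cong (ℕ._% p) (cong₂ ℕ._*_ (toℕ-⟦⟧ m) (toℕ-⟦⟧ n)))
                            (sym (ℕ.%-distribˡ-* m n p)))

  ⟦p⟧ : ⟦ p ⟧ ≡ 0ᶠ
  ⟦p⟧ = ⟦⟧-cong (trans (ℕ.n%n≡0 p) (sym (ℕ.m*n%n≡0 0 p)))

  infix 8 ⊖_
  ⊖_ : 𝔽 → 𝔽
  ⊖ a = ⟦ p ℕ.∸ toℕ a ⟧

  private
    ⟦⟧-+ʳ : ∀ a m → a +ᶠ ⟦ m ⟧ ≡ ⟦ toℕ a ℕ.+ m ⟧
    ⟦⟧-+ʳ a m = trans (cong (_+ᶠ ⟦ m ⟧) (sym (⟦toℕ⟧ a))) (⟦⟧-+ (toℕ a) m)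

    ⟦⟧-*ʳ : ∀ a m → a *ᶠ ⟦ m ⟧ ≡ ⟦ toℕ a ℕ.* m ⟧
    ⟦⟧-*ʳ a m = trans (cong (_*ᶠ ⟦ m ⟧) (sym (⟦toℕ⟧ a))) (⟦⟧-* (toℕ a) m)

    +-comm : ∀ a b → a +ᶠ b ≡ b +ᶠ a
    +-comm a b = cong ⟦_⟧ (ℕₚ.+-comm (toℕ a) (toℕ b))

    *-comm : ∀ a b → a *ᶠ b ≡ b *ᶠ a
    *-comm a b = cong ⟦_⟧ (ℕₚ.*-comm (toℕ a) (toℕ b))

    +-assoc : ∀ a b c → (a +ᶠ b) +ᶠ c ≡ a +ᶠ (b +ᶠ c)
    +-assoc a b c = begin
      ⟦ α ℕ.+ β ⟧ +ᶠ c      ≡⟨ +-comm ⟦ α ℕ.+ β ⟧ c ⟩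
      c +ᶠ ⟦ α ℕ.+ β ⟧      ≡⟨ ⟦⟧-+ʳ c (α ℕ.+ β) ⟩
      ⟦ γ ℕ.+ (α ℕ.+ β) ⟧   ≡⟨ cong ⟦_⟧ (trans (ℕₚ.+-comm γ _) (ℕₚ.+-assoc α β γ)) ⟩
      ⟦ α ℕ.+ (β ℕ.+ γ) ⟧   ≡⟨ ⟦⟧-+ʳ a (β ℕ.+ γ) ⟨
      a +ᶠ ⟦ β ℕ.+ γ ⟧      ∎
      where open ≡-Reasoning; α = toℕ a; β = toℕ b; γ = toℕ c

    *-assoc : ∀ a b c → (a *ᶠ b) *ᶠ c ≡ a *ᶠ (b *ᶠ c)
    *-assoc a b c = begin
      ⟦ α ℕ.* β ⟧ *ᶠ c      ≡⟨ *-comm ⟦ α ℕ.* β ⟧ c ⟩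
      c *ᶠ ⟦ α ℕ.* β ⟧      ≡⟨ ⟦⟧-*ʳ c (α ℕ.* β) ⟩
      ⟦ γ ℕ.* (α ℕ.* β) ⟧   ≡⟨ cong ⟦_⟧ (trans (ℕₚ.*-comm γ _) (ℕₚ.*-assoc α β γ)) ⟩
      ⟦ α ℕ.* (β ℕ.* γ) ⟧   ≡⟨ ⟦⟧-*ʳ a (β ℕ.* γ) ⟨
      a *ᶠ ⟦ β ℕ.* γ ⟧      ∎
      where open ≡-Reasoning; α = toℕ a; β = toℕ b; γ = toℕ c

    distribˡ : ∀ a b c → a *ᶠ (b +ᶠ c) ≡ (a *ᶠ b) +ᶠ (a *ᶠ c)
    distribˡ a b c = begin
      a *ᶠ ⟦ β ℕ.+ γ ⟧                ≡⟨ ⟦⟧-*ʳ a (β ℕ.+ γ) ⟩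
      ⟦ α ℕ.* (β ℕ.+ γ) ⟧             ≡⟨ cong ⟦_⟧ (ℕₚ.*-distribˡ-+ α β γ) ⟩
      ⟦ α ℕ.* β ℕ.+ α ℕ.* γ ⟧         ≡⟨ ⟦⟧-+ (α ℕ.* β) (α ℕ.* γ) ⟨
      ⟦ α ℕ.* β ⟧ +ᶠ ⟦ α ℕ.* γ ⟧      ∎
      where open ≡-Reasoning; α = toℕ a; β = toℕ b; γ = toℕ c

    +-identityʳ : ∀ a → a +ᶠ 0ᶠ ≡ a
    +-identityʳ a = trans (⟦⟧-+ʳ a 0) (trans (cong ⟦_⟧ (ℕₚ.+-identityʳ (toℕ a))) (⟦toℕ⟧ a))

    *-identityʳ : ∀ a → a *ᶠ 1ᶠ ≡ a
    *-identityʳ a = trans (⟦⟧-*ʳ a 1) (trans (cong ⟦_⟧ (ℕₚ.*-identityʳ (toℕ a))) (⟦toℕ⟧ a))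

    -‿inverseʳ : ∀ a → a +ᶠ ⊖ a ≡ 0ᶠ
    -‿inverseʳ a = trans (⟦⟧-+ʳ a (p ℕ.∸ toℕ a))
      (trans (cong ⟦_⟧ (ℕₚ.m+[n∸m]≡n (ℕₚ.<⇒≤ (Finₚ.toℕ<n a)))) ⟦p⟧)

  𝔽-commutativeRing : CommutativeRing _ _
  𝔽-commutativeRing = record
    { Carrier = 𝔽 ; _≈_ = _≡_ ; _+_ = _+ᶠ_ ; _*_ = _*ᶠ_ ; -_ = ⊖_ ; 0# = 0ᶠ ; 1# = 1ᶠ
    ; isCommutativeRing = record
      { isRing = record
        { +-isAbelianGroup = record
          { isGroup = record
            { isMonoid = record
              { isSemigroup = record { isMagma = isMagma _+ᶠ_ ; assoc = +-assoc }
              ; identity = (λ a → trans (+-comm 0ᶠ a) (+-identityʳ a)) , +-identityʳ }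
            ; inverse = (λ a → trans (+-comm (⊖ a) a) (-‿inverseʳ a)) , -‿inverseʳ
            ; ⁻¹-cong = cong ⊖_ }
          ; comm = +-comm }
        ; *-cong = cong₂ _*ᶠ_
        ; *-assoc = *-assoc
        ; *-identity = (λ a → trans (*-comm 1ᶠ a) (*-identityʳ a)) , *-identityʳ
        ; distrib = distribˡ , λ a b c → trans (*-comm (b +ᶠ c) a)
            (trans (distribˡ a b c) (cong₂ _+ᶠ_ (*-comm a b) (*-comm a c))) }
      ; *-comm = *-comm } }

  module F = CommutativeRing 𝔽-commutativeRing

  module 𝔽-Solver = DifferenceSolver 𝔽-commutativeRing

  sub≡+neg : ∀ a b → a -ᶠ b ≡ a +ᶠ ⊖ b
  sub≡+neg a b = sym (⟦⟧-+ʳ a (p ℕ.∸ toℕ b))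

  open 𝔽-Solver using (solve; _:+_; _:*_; :-_; _:=_; :0; :1)

  inverse : Prime p → ∀ a → a ≢ 0ᶠ → ∃[ b ] (b *ᶠ a ≡ 1ᶠ)
  inverse pr a a≢0 = fromBézout (Coprimality.coprime-Bézout
      (Coprimality.prime⇒coprime pr {{ℕ.≢-nonZero toℕa≢0}} (Finₚ.toℕ<n a)))
    where
    open ≡-Reasoning
    toℕa≢0 : toℕ a ≢ 0
    toℕa≢0 e = a≢0 (trans (sym (⟦toℕ⟧ a)) (cong ⟦_⟧ e))
    multiple : ∀ x → ⟦ x ℕ.* p ⟧ ≡ 0ᶠ
    multiple x = trans (sym (⟦⟧-* x p)) (trans (cong (⟦ x ⟧ *ᶠ_) ⟦p⟧) (F.zeroʳ ⟦ x ⟧))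
    fromBézout : Bézout.Identity 1 p (toℕ a) → ∃[ b ] (b *ᶠ a ≡ 1ᶠ)
    fromBézout (Bézout.+- x y eq) = ⊖ ⟦ y ⟧ , (begin
      ⊖ ⟦ y ⟧ *ᶠ a
        ≡⟨ solve 2 (λ y a → (:- y) :* a := :1 :+ :- (:1 :+ y :* a)) refl ⟦ y ⟧ a ⟩
      1ᶠ +ᶠ ⊖ (1ᶠ +ᶠ ⟦ y ⟧ *ᶠ a)
        ≡⟨ cong (λ z → 1ᶠ +ᶠ ⊖ (1ᶠ +ᶠ ⟦ y ⟧ *ᶠ z)) (⟦toℕ⟧ a) ⟨
      1ᶠ +ᶠ ⊖ (1ᶠ +ᶠ ⟦ y ⟧ *ᶠ ⟦ toℕ a ⟧)
        ≡⟨ cong (λ z → 1ᶠ +ᶠ ⊖ z) (trans (cong (1ᶠ +ᶠ_) (⟦⟧-* y (toℕ a)))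
             (trans (⟦⟧-+ 1 (y ℕ.* toℕ a)) (trans (cong ⟦_⟧ eq) (multiple x)))) ⟩
      1ᶠ +ᶠ ⊖ 0ᶠ
        ≡⟨ solve 0 (:1 :+ :- (:0) := :1) refl ⟩
      1ᶠ ∎)
    fromBézout (Bézout.-+ x y eq) = ⟦ y ⟧ , (begin
      ⟦ y ⟧ *ᶠ a                 ≡⟨ cong (⟦ y ⟧ *ᶠ_) (⟦toℕ⟧ a) ⟨
      ⟦ y ⟧ *ᶠ ⟦ toℕ a ⟧         ≡⟨ ⟦⟧-* y (toℕ a) ⟩
      ⟦ y ℕ.* toℕ a ⟧            ≡⟨ cong ⟦_⟧ eq ⟨
      ⟦ 1 ℕ.+ x ℕ.* p ⟧          ≡⟨ ⟦⟧-+ 1 (x ℕ.* p) ⟨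
      1ᶠ +ᶠ ⟦ x ℕ.* p ⟧          ≡⟨ cong (1ᶠ +ᶠ_) (multiple x) ⟩
      1ᶠ +ᶠ 0ᶠ                   ≡⟨ F.+-identityʳ 1ᶠ ⟩
      1ᶠ ∎)

  cancel-*ʳ : Prime p → ∀ {a b c} → c ≢ 0ᶠ → a *ᶠ c ≡ b *ᶠ c → a ≡ b
  cancel-*ʳ pr {a} {b} {c} c≢0 e = let i , ic≡1 = inverse pr c c≢0 in begin
    a                  ≡⟨ F.*-identityʳ a ⟨
    a *ᶠ 1ᶠ            ≡⟨ cong (a *ᶠ_) ic≡1 ⟨
    a *ᶠ (i *ᶠ c)      ≡⟨ solve 3 (λ a i c → a :* (i :* c) := i :* (a :* c)) refl a i c ⟩
    i *ᶠ (a *ᶠ c)      ≡⟨ cong (i *ᶠ_) e ⟩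
    i *ᶠ (b *ᶠ c)      ≡⟨ solve 3 (λ a i c → i :* (a :* c) := a :* (i :* c)) refl b i c ⟩
    b *ᶠ (i *ᶠ c)      ≡⟨ cong (b *ᶠ_) ic≡1 ⟩
    b *ᶠ 1ᶠ            ≡⟨ F.*-identityʳ b ⟩
    b ∎
    where open ≡-Reasoning

-- Finite differences, degrees and Newton expansion.

module Differences (p : ℕ) .{{_ : NonZero p}} where

  open import Relation.Binary.PropositionalEquality

  open PrimeField p
  open Residues p public
  open 𝔽-Solver using (solve; _:+_; _:*_; :-_; _:=_)

  infixr 8 _•_

  0ᵛ : ∀ {n} → Vec 𝔽 n
  0ᵛ = Vec.replicate _ 0ᶠ

  _•_ : ∀ {n} → 𝔽 → Vec 𝔽 n → Vec 𝔽 n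
  c • v = Vec.map (c *ᶠ_) v

  ⊕-comm : ∀ {n} (x y : Vec 𝔽 n) → x ⊕ y ≡ y ⊕ x
  ⊕-comm = Vecₚ.zipWith-comm F.+-comm

  ⊕-assoc : ∀ {n} (x y z : Vec 𝔽 n) → (x ⊕ y) ⊕ z ≡ x ⊕ (y ⊕ z)
  ⊕-assoc = Vecₚ.zipWith-assoc F.+-assoc

  ⊕-identityˡ : ∀ {n} (x : Vec 𝔽 n) → 0ᵛ ⊕ x ≡ x
  ⊕-identityˡ = Vecₚ.zipWith-identityˡ F.+-identityˡ

  ⊕-identityʳ : ∀ {n} (x : Vec 𝔽 n) → x ⊕ 0ᵛ ≡ x
  ⊕-identityʳ = Vecₚ.zipWith-identityʳ F.+-identityʳ

  •-distribʳ : ∀ {n} a b (v : Vec 𝔽 n) → (a +ᶠ b) • v ≡ a • v ⊕ b • v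
  •-distribʳ a b []      = refl
  •-distribʳ a b (x ∷ v) = cong₂ _∷_ (F.distribʳ x a b) (•-distribʳ a b v)

  •-identityˡ : ∀ {n} (v : Vec 𝔽 n) → 1ᶠ • v ≡ v
  •-identityˡ []      = refl
  •-identityˡ (x ∷ v) = cong₂ _∷_ (F.*-identityˡ x) (•-identityˡ v)

  •-zeroˡ : ∀ {n} (v : Vec 𝔽 n) → 0ᶠ • v ≡ 0ᵛ
  •-zeroˡ []      = refl
  •-zeroˡ (x ∷ v) = cong₂ _∷_ (F.zeroˡ x) (•-zeroˡ v)

  •-zeroʳ : ∀ {n} a → a • 0ᵛ {n} ≡ 0ᵛ
  •-zeroʳ {zero}  a = refl
  •-zeroʳ {suc n} a = cong₂ _∷_ (F.zeroʳ a) (•-zeroʳ a)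

  ⊕-swap : ∀ {n} (x y z : Vec 𝔽 n) → (x ⊕ y) ⊕ z ≡ (x ⊕ z) ⊕ y
  ⊕-swap x y z = trans (⊕-assoc x y z) (trans (cong (x ⊕_) (⊕-comm y z)) (sym (⊕-assoc x z y)))

  ⊕-cancel : ∀ {n} a (x v : Vec 𝔽 n) → (x ⊕ (⊖ a) • v) ⊕ a • v ≡ x
  ⊕-cancel a x v = begin
    (x ⊕ (⊖ a) • v) ⊕ a • v  ≡⟨ ⊕-assoc x _ _ ⟩
    x ⊕ ((⊖ a) • v ⊕ a • v)  ≡⟨ cong (x ⊕_) (•-distribʳ (⊖ a) a v) ⟨
    x ⊕ (⊖ a +ᶠ a) • v       ≡⟨ cong (λ c → x ⊕ c • v) (F.-‿inverseˡ a) ⟩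
    x ⊕ 0ᶠ • v               ≡⟨ cong (x ⊕_) (•-zeroˡ v) ⟩
    x ⊕ 0ᵛ                   ≡⟨ ⊕-identityʳ x ⟩
    x ∎
    where open ≡-Reasoning

  Additive : ∀ {n} → (Vec 𝔽 n → 𝔽) → Set
  Additive φ = ∀ x y → φ (x ⊕ y) ≡ φ x +ᶠ φ y

  additive-0 : ∀ {n} {φ : Vec 𝔽 n → 𝔽} → Additive φ → φ 0ᵛ ≡ 0ᶠ
  additive-0 {φ = φ} add = begin
    φ 0ᵛ
      ≡⟨ solve 1 (λ a → a := (a :+ a) :+ :- a) refl (φ 0ᵛ) ⟩
    (φ 0ᵛ +ᶠ φ 0ᵛ) +ᶠ ⊖ φ 0ᵛ
      ≡⟨ cong (_+ᶠ ⊖ φ 0ᵛ) (trans (sym (add 0ᵛ 0ᵛ)) (cong φ (⊕-identityˡ 0ᵛ))) ⟩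
    φ 0ᵛ +ᶠ ⊖ φ 0ᵛ
      ≡⟨ F.-‿inverseʳ (φ 0ᵛ) ⟩
    0ᶠ ∎
    where open ≡-Reasoning

  -- Every scalar of a prime field is a natural multiple of 1, so additivity alone gives linearity;
  -- this is why `Form` asks for nothing more.
  additive-• : ∀ {n} {φ : Vec 𝔽 n → 𝔽} → Additive φ → ∀ a v → φ (a • v) ≡ a *ᶠ φ v
  additive-• {φ = φ} add a v = subst (λ c → φ (c • v) ≡ c *ᶠ φ v) (⟦toℕ⟧ a) (natural (toℕ a))
    where
    open ≡-Reasoning
    natural : ∀ m → φ (⟦ m ⟧ • v) ≡ ⟦ m ⟧ *ᶠ φ v
    natural zero    = trans (cong φ (•-zeroˡ v)) (trans (additive-0 {φ = φ} add) (sym (F.zeroˡ (φ v))))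
    natural (suc m) = begin
      φ (⟦ suc m ⟧ • v)           ≡⟨ cong (λ c → φ (c • v)) (⟦⟧-+ 1 m) ⟨
      φ ((1ᶠ +ᶠ ⟦ m ⟧) • v)       ≡⟨ cong φ (•-distribʳ 1ᶠ ⟦ m ⟧ v) ⟩
      φ (1ᶠ • v ⊕ ⟦ m ⟧ • v)      ≡⟨ add _ _ ⟩
      φ (1ᶠ • v) +ᶠ φ (⟦ m ⟧ • v) ≡⟨ cong₂ _+ᶠ_ (trans (cong φ (•-identityˡ v)) (sym (F.*-identityˡ (φ v)))) (natural m) ⟩
      1ᶠ *ᶠ φ v +ᶠ ⟦ m ⟧ *ᶠ φ v   ≡⟨ F.distribʳ (φ v) 1ᶠ ⟦ m ⟧ ⟨
      (1ᶠ +ᶠ ⟦ m ⟧) *ᶠ φ v        ≡⟨ cong (_*ᶠ φ v) (⟦⟧-+ 1 m) ⟩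
      ⟦ suc m ⟧ *ᶠ φ v            ∎

  Δ-+ : ∀ {n} y (f : Vec 𝔽 n → 𝔽) x → f (x ⊕ y) ≡ f x +ᶠ Δ y f x
  Δ-+ y f x = trans (solve 2 (λ a b → a := b :+ (a :+ :- b)) refl (f (x ⊕ y)) (f x))
                    (cong (f x +ᶠ_) (sym (sub≡+neg (f (x ⊕ y)) (f x))))

  Δ-unique : ∀ {n} y (f : Vec 𝔽 n → 𝔽) x {d} → f (x ⊕ y) ≡ f x +ᶠ d → Δ y f x ≡ d
  Δ-unique y f x {d} e = trans (sub≡+neg (f (x ⊕ y)) (f x)) (trans (cong (_+ᶠ ⊖ f x) e)
    (solve 2 (λ a d → (a :+ d) :+ :- a := d) refl (f x) d))

  Δ-cong : ∀ {n} y {f g : Vec 𝔽 n → 𝔽} → f ≗ g → Δ y f ≗ Δ y g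
  Δ-cong y e x = cong₂ _-ᶠ_ (e (x ⊕ y)) (e x)

  Δ-comm : ∀ {n} y z (f : Vec 𝔽 n → 𝔽) → Δ y (Δ z f) ≗ Δ z (Δ y f)
  Δ-comm y z f x = Δ-unique y (Δ z f) x (Δ-unique z f (x ⊕ y) (begin
    f ((x ⊕ y) ⊕ z)
      ≡⟨ cong f (⊕-swap x y z) ⟩
    f ((x ⊕ z) ⊕ y)
      ≡⟨ Δ-+ y f (x ⊕ z) ⟩
    f (x ⊕ z) +ᶠ Δ y f (x ⊕ z)
      ≡⟨ cong₂ _+ᶠ_ (Δ-+ z f x) (Δ-+ z (Δ y f) x) ⟩
    (f x +ᶠ Δ z f x) +ᶠ (Δ y f x +ᶠ Δ z (Δ y f) x)
      ≡⟨ solve 4 (λ a b c d → (a :+ b) :+ (c :+ d) := (a :+ c) :+ (b :+ d)) refl (f x) (Δ z f x) (Δ y f x) (Δ z (Δ y f) x) ⟩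
    (f x +ᶠ Δ y f x) +ᶠ (Δ z f x +ᶠ Δ z (Δ y f) x)
      ≡⟨ cong (_+ᶠ (Δ z f x +ᶠ Δ z (Δ y f) x)) (Δ-+ y f x) ⟨
    f (x ⊕ y) +ᶠ (Δ z f x +ᶠ Δ z (Δ y f) x) ∎))
    where open ≡-Reasoning

  -- The intrinsic counterpart of "degree below k". No polynomial is chosen, so precomposition with
  -- an affine map costs nothing; `deg-vanish` and `vanish-deg` relate it to polynomials.
  data Vanish {n : ℕ} : ℕ → (Vec 𝔽 n → 𝔽) → Set where
    null  : ∀ {f} → (∀ x → f x ≡ 0ᶠ) → Vanish zero f
    diffs : ∀ {k f} → (∀ y → Vanish k (Δ y f)) → Vanish (suc k) f

  vanish-Δ : ∀ {n k} {f : Vec 𝔽 n → 𝔽} → Vanish (suc k) f → ∀ y → Vanish k (Δ y f)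
  vanish-Δ (diffs vf) = vf

  vanish-resp : ∀ {n} k {f g : Vec 𝔽 n → 𝔽} → f ≗ g → Vanish k f → Vanish k g
  vanish-resp zero    e (null vf)  = null λ x → trans (sym (e x)) (vf x)
  vanish-resp (suc k) e (diffs vf) = diffs λ y → vanish-resp k (Δ-cong y e) (vf y)

  vanish-0 : ∀ {n} k {f : Vec 𝔽 n → 𝔽} → (∀ x → f x ≡ 0ᶠ) → Vanish k f
  vanish-0 zero    e = null e
  vanish-0 (suc k) {f} e = diffs λ y → vanish-0 k λ x → Δ-unique y f x
    (trans (e (x ⊕ y)) (trans (sym (F.+-identityʳ 0ᶠ)) (cong (_+ᶠ 0ᶠ) (sym (e x)))))

  vanish-suc : ∀ {n} k {f : Vec 𝔽 n → 𝔽} → Vanish k f → Vanish (suc k) f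
  vanish-suc zero    (null vf)  = vanish-0 1 vf
  vanish-suc (suc k) (diffs vf) = diffs λ y → vanish-suc k (vf y)

  vanish-+ : ∀ {n} k {f g : Vec 𝔽 n → 𝔽} → Vanish k f → Vanish k g → Vanish k (λ x → f x +ᶠ g x)
  vanish-+ zero    (null vf) (null vg) = null λ x → trans (cong₂ _+ᶠ_ (vf x) (vg x)) (F.+-identityʳ 0ᶠ)
  vanish-+ (suc k) {f} {g} (diffs vf) (diffs vg) = diffs λ y → vanish-resp k
    (λ x → sym (Δ-unique y (λ x → f x +ᶠ g x) x (trans (cong₂ _+ᶠ_ (Δ-+ y f x) (Δ-+ y g x))
      (solve 4 (λ a b c d → (a :+ b) :+ (c :+ d) := (a :+ c) :+ (b :+ d)) refl (f x) (Δ y f x) (g x) (Δ y g x)))))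
    (vanish-+ k (vf y) (vg y))

  vanish-scale : ∀ {n} k a {f : Vec 𝔽 n → 𝔽} → Vanish k f → Vanish k (λ x → a *ᶠ f x)
  vanish-scale zero    a (null vf) = null λ x → trans (cong (a *ᶠ_) (vf x)) (F.zeroʳ a)
  vanish-scale (suc k) a {f} (diffs vf) = diffs λ y → vanish-resp k
    (λ x → sym (Δ-unique y (λ x → a *ᶠ f x) x (trans (cong (a *ᶠ_) (Δ-+ y f x)) (F.distribˡ a (f x) (Δ y f x)))))
    (vanish-scale k a (vf y))

  -- The product rule Δ y (xᵢ g) = xᵢ Δ y g + yᵢ Δ y g + yᵢ g: the first term falls under the
  -- induction, the other two under the hypothesis on g.
  vanish-coordinate : ∀ {n} i k {g : Vec 𝔽 n → 𝔽} → Vanish k g → Vanish (suc k) (λ x → Vec.lookup x i *ᶠ g x)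
  vanish-coordinate i zero {g} (null vg) = vanish-0 1 λ x →
    trans (cong (Vec.lookup x i *ᶠ_) (vg x)) (F.zeroʳ (Vec.lookup x i))
  vanish-coordinate i (suc k) {g} (diffs vg) = diffs λ y → vanish-resp (suc k)
    (λ x → sym (Δ-unique y (λ x → Vec.lookup x i *ᶠ g x) x
      (trans (cong₂ _*ᶠ_ (Vecₚ.lookup-zipWith _+ᶠ_ i x y) (Δ-+ y g x))
        (solve 4 (λ x y g d → (x :+ y) :* (g :+ d) := x :* g :+ (x :* d :+ (y :* d :+ y :* g))) refl
          (Vec.lookup x i) (Vec.lookup y i) (g x) (Δ y g x)))))
    (vanish-+ (suc k) (vanish-coordinate i k (vg y))
      (vanish-+ (suc k) (vanish-suc k (vanish-scale k (Vec.lookup y i) (vg y)))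
        (vanish-scale (suc k) (Vec.lookup y i) (diffs vg))))

  vanish-additive : ∀ {n} {φ : Vec 𝔽 n → 𝔽} → Additive φ → Vanish 2 φ
  vanish-additive {φ = φ} add = diffs λ y → diffs λ z → null λ x → Δ-unique z (Δ y φ) x
    (trans (constant y (x ⊕ z)) (trans (sym (F.+-identityʳ (φ y))) (cong (_+ᶠ 0ᶠ) (sym (constant y x)))))
    where
    constant : ∀ y x → Δ y φ x ≡ φ y
    constant y x = Δ-unique y φ x (add x y)

  -- `A` is an affine map and `L` its linear part, so Δ y (f ∘ A) = Δ (L y) f ∘ A.
  vanish-∘ : ∀ {m n} k {f : Vec 𝔽 n → 𝔽} (A L : Vec 𝔽 m → Vec 𝔽 n) →
             (∀ x y → A (x ⊕ y) ≡ A x ⊕ L y) → Vanish k f → Vanish k (f ∘ A)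
  vanish-∘ zero    A L aff (null vf) = null λ x → vf (A x)
  vanish-∘ (suc k) {f} A L aff (diffs vf) = diffs λ y → vanish-resp k
    (λ x → cong (λ z → f z -ᶠ f (A x)) (sym (aff x y)))
    (vanish-∘ k A L aff (vf (L y)))

  vanish-1 : ∀ {n} {f : Vec 𝔽 n → 𝔽} → Vanish 1 f → ∀ x y → f x ≡ f y
  vanish-1 {f = f} (diffs vf) x y = begin
    f x                    ≡⟨ cong f (trans (sym (⊕-cancel 1ᶠ x y)) (cong ((x ⊕ (⊖ 1ᶠ) • y) ⊕_) (•-identityˡ y))) ⟩
    f (d ⊕ y)              ≡⟨ cong f (⊕-comm d y) ⟩
    f (y ⊕ d)              ≡⟨ Δ-+ d f y ⟩
    f y +ᶠ Δ d f y         ≡⟨ cong (f y +ᶠ_) (null⁻¹ (vf d)) ⟩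
    f y +ᶠ 0ᶠ              ≡⟨ F.+-identityʳ (f y) ⟩
    f y                    ∎
    where
    open ≡-Reasoning
    d = x ⊕ (⊖ 1ᶠ) • y
    null⁻¹ : ∀ {n} {g : Vec 𝔽 n → 𝔽} {x} → Vanish 0 g → g x ≡ 0ᶠ
    null⁻¹ (null vg) = vg _

  -- Degree bounds as derivations on functions, each rule up to pointwise equality. Products and
  -- inductions are simpler here than on lists of monomials, and the two notions are translated into
  -- each other below.
  data Deg {n : ℕ} : ℕ → (Vec 𝔽 n → 𝔽) → Set where
    const : ∀ {d f} a → (∀ x → f x ≡ a) → Deg d f
    times : ∀ {d f g} i → Deg d g → (∀ x → f x ≡ Vec.lookup x i *ᶠ g x) → Deg (suc d) f
    plus  : ∀ {d f g h} → Deg d g → Deg d h → (∀ x → f x ≡ g x +ᶠ h x) → Deg d f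

  deg-resp : ∀ {n d} {f g : Vec 𝔽 n → 𝔽} → (∀ x → g x ≡ f x) → Deg d f → Deg d g
  deg-resp e (const a e′)    = const a λ x → trans (e x) (e′ x)
  deg-resp e (times i df e′) = times i df λ x → trans (e x) (e′ x)
  deg-resp e (plus df dg e′) = plus df dg λ x → trans (e x) (e′ x)

  deg-suc : ∀ {n d} {f : Vec 𝔽 n → 𝔽} → Deg d f → Deg (suc d) f
  deg-suc (const a e)    = const a e
  deg-suc (times i df e) = times i (deg-suc df) e
  deg-suc (plus df dg e) = plus (deg-suc df) (deg-suc dg) e

  deg-+ˡ : ∀ {n} k {d} {f : Vec 𝔽 n → 𝔽} → Deg d f → Deg (k ℕ.+ d) f
  deg-+ˡ zero    df = df
  deg-+ˡ (suc k) df = deg-suc (deg-+ˡ k df)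

  deg-≤ : ∀ {n d e} {f : Vec 𝔽 n → 𝔽} → d ℕ.≤ e → Deg d f → Deg e f
  deg-≤ {d = d} {e} {f} d≤e df = subst (λ k → Deg k f) (ℕₚ.m∸n+n≡m d≤e) (deg-+ˡ (e ℕ.∸ d) df)

  deg-scale : ∀ {n d} a {f : Vec 𝔽 n → 𝔽} → Deg d f → Deg d (λ x → a *ᶠ f x)
  deg-scale a (const b e) = const (a *ᶠ b) λ x → cong (a *ᶠ_) (e x)
  deg-scale a (times {g = g} i dg e) = times i (deg-scale a dg) λ x → trans (cong (a *ᶠ_) (e x))
    (solve 3 (λ a x g → a :* (x :* g) := x :* (a :* g)) refl a (Vec.lookup x i) (g x))
  deg-scale a (plus {g = g} {h} dg dh e) = plus (deg-scale a dg) (deg-scale a dh)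
    λ x → trans (cong (a *ᶠ_) (e x)) (F.distribˡ a (g x) (h x))

  deg-* : ∀ {n a b} {f g : Vec 𝔽 n → 𝔽} → Deg a f → Deg b g → Deg (a ℕ.+ b) (λ x → f x *ᶠ g x)
  deg-* {a = a} {g = g} (const c e) dg =
    deg-resp (λ x → cong (_*ᶠ g x) (e x)) (deg-+ˡ a (deg-scale c dg))
  deg-* {g = h} (times {g = g} i dg e) dh = times i (deg-* dg dh) λ x →
    trans (cong (_*ᶠ h x) (e x)) (F.*-assoc (Vec.lookup x i) (g x) (h x))
  deg-* {g = h} (plus {g = f} {g} df dg e) dh = plus (deg-* df dh) (deg-* dg dh) λ x →
    trans (cong (_*ᶠ h x) (e x)) (F.distribʳ (h x) (f x) (g x))

  deg-tail : ∀ {n d} {f : Vec 𝔽 n → 𝔽} → Deg d f → Deg d (f ∘ Vec.tail)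
  deg-tail (const a e)    = const a λ x → e (Vec.tail x)
  deg-tail (times i dg e) = times (suc i) (deg-tail dg) λ { (a ∷ x) → e x }
  deg-tail (plus dg dh e) = plus (deg-tail dg) (deg-tail dh) λ x → e (Vec.tail x)

  deg-vanish : ∀ {n d} {f : Vec 𝔽 n → 𝔽} → Deg d f → Vanish (suc d) f
  deg-vanish {d = zero} {f} (const a e) = diffs λ y → null λ x → Δ-unique y f x
    (trans (e (x ⊕ y)) (trans (sym (e x)) (sym (F.+-identityʳ (f x)))))
  deg-vanish {d = suc d} (const a e) = vanish-suc (suc d) (deg-vanish (const a e))
  deg-vanish {d = suc d} (times i dg e) =
    vanish-resp (suc (suc d)) (λ x → sym (e x)) (vanish-coordinate i (suc d) (deg-vanish dg))
  deg-vanish {d = d} (plus dg dh e) =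
    vanish-resp (suc d) (λ x → sym (e x)) (vanish-+ (suc d) (deg-vanish dg) (deg-vanish dh))

  monomial : ∀ {n} → Vec ℕ n → Vec 𝔽 n → 𝔽
  monomial es x = Vec.foldr′ _*ᶠ_ 1ᶠ (Vec.zipWith _^ᶠ_ x es)

  deg-monomial : ∀ {n} (es : Vec ℕ n) → Deg (Vec.sum es) (monomial es)
  deg-monomial []       = const 1ᶠ λ { [] → refl }
  deg-monomial (e ∷ es) = deg-resp (λ { (a ∷ x) → refl }) (deg-* (power e) (deg-tail (deg-monomial es)))
    where
    power : ∀ {n} e → Deg {suc n} e (λ x → Vec.head x ^ᶠ e)
    power zero    = const 1ᶠ λ _ → refl
    power (suc e) = times zero (power e) λ { (a ∷ x) → refl }

  degreeAtMost⇒deg : ∀ {n d} {f : Vec 𝔽 n → 𝔽} → DegreeAtMost d f → Deg d f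
  degreeAtMost⇒deg {n} {d} (P , small , e) = deg-resp (λ x → sym (e x)) (go P small)
    where
    go : ∀ (P : Polynomial n) → All (λ t → Vec.sum (proj₂ t) ℕ.≤ d) P → Deg d (eval P)
    go []             []        = const 0ᶠ λ _ → refl
    go ((a , es) ∷ P) (le ∷ les) = plus (deg-scale a (deg-≤ le (deg-monomial es))) (go P les) λ _ → refl

  monomial-1 : ∀ {n} (x : Vec 𝔽 n) → monomial (Vec.replicate n 0) x ≡ 1ᶠ
  monomial-1 []      = refl
  monomial-1 (a ∷ x) = trans (cong (1ᶠ *ᶠ_) (monomial-1 x)) (F.*-identityˡ 1ᶠ)

  sum-0 : ∀ n → Vec.sum (Vec.replicate n 0) ≡ 0
  sum-0 zero    = refl
  sum-0 (suc n) = sum-0 n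

  monomial-bump : ∀ {n} i (es : Vec ℕ n) x →
                  monomial (Vec.updateAt es i suc) x ≡ Vec.lookup x i *ᶠ monomial es x
  monomial-bump zero    (e ∷ es) (a ∷ x) = F.*-assoc a (a ^ᶠ e) (monomial es x)
  monomial-bump (suc i) (e ∷ es) (a ∷ x) = trans (cong (a ^ᶠ e *ᶠ_) (monomial-bump i es x))
    (solve 3 (λ a b c → a :* (b :* c) := b :* (a :* c)) refl (a ^ᶠ e) (Vec.lookup x i) (monomial es x))

  sum-bump : ∀ {n} i (es : Vec ℕ n) → Vec.sum (Vec.updateAt es i suc) ≡ suc (Vec.sum es)
  sum-bump zero    (e ∷ es) = refl
  sum-bump (suc i) (e ∷ es) = trans (cong (e ℕ.+_) (sum-bump i es)) (ℕₚ.+-suc e (Vec.sum es))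

  eval-++ : ∀ {n} (P Q : Polynomial n) x → eval (P List.++ Q) x ≡ eval P x +ᶠ eval Q x
  eval-++ []      Q x = sym (F.+-identityˡ (eval Q x))
  eval-++ (t ∷ P) Q x = trans (cong (evalTerm t x +ᶠ_) (eval-++ P Q x)) (sym (F.+-assoc (evalTerm t x) (eval P x) (eval Q x)))

  deg⇒degreeAtMost : ∀ {n d} {f : Vec 𝔽 n → 𝔽} → Deg d f → DegreeAtMost d f
  deg⇒degreeAtMost {n} (const a e) =
    (a , Vec.replicate n 0) ∷ [] ,
    subst (ℕ._≤ _) (sym (sum-0 n)) z≤n ∷ [] ,
    λ x → trans (F.+-identityʳ (a *ᶠ monomial (Vec.replicate n 0) x)) (trans (cong (a *ᶠ_) (monomial-1 x)) (trans (F.*-identityʳ a) (sym (e x))))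
  deg⇒degreeAtMost {n} {suc d} (times i dg e) = let P , small , ev = deg⇒degreeAtMost dg in
    List.map bump P ,
    Allₚ.map⁺ (All.map (λ {t} le → subst (ℕ._≤ suc d) (sym (sum-bump i (proj₂ t))) (s≤s le)) small) ,
    λ x → trans (eval-bump P x) (trans (cong (Vec.lookup x i *ᶠ_) (ev x)) (sym (e x)))
    where
    bump : Term n → Term n
    bump (a , es) = a , Vec.updateAt es i suc
    eval-bump : ∀ P x → eval (List.map bump P) x ≡ Vec.lookup x i *ᶠ eval P x
    eval-bump []             x = sym (F.zeroʳ (Vec.lookup x i))
    eval-bump ((a , es) ∷ P) x = trans
      (cong₂ _+ᶠ_ (cong (a *ᶠ_) (monomial-bump i es x)) (eval-bump P x))
      (solve 4 (λ a x m r → a :* (x :* m) :+ x :* r := x :* (a :* m :+ r)) refl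
        a (Vec.lookup x i) (monomial es x) (eval P x))
  deg⇒degreeAtMost (plus dg dh e) =
    let P , smallP , evP = deg⇒degreeAtMost dg
        Q , smallQ , evQ = deg⇒degreeAtMost dh
    in P List.++ Q , Allₚ.++⁺ smallP smallQ ,
       λ x → trans (eval-++ P Q x) (trans (cong₂ _+ᶠ_ (evP x) (evQ x)) (sym (e x)))

  -- The truncated Newton series, the sum over i ≤ d of b (j + i) times the i-fold difference of f
  -- in direction e at w. The weights stay arbitrary so that both the binomial coefficients and
  -- their quotients by the argument can be inserted.
  newton : ∀ {n} → (ℕ → 𝔽) → Vec 𝔽 n → ℕ → ℕ → (Vec 𝔽 n → 𝔽) → Vec 𝔽 n → 𝔽
  newton b e j zero    f w = b j *ᶠ f w
  newton b e j (suc d) f w = b j *ᶠ f w +ᶠ newton b e (suc j) d (Δ e f) w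

  newton-0 : ∀ {n} b (e : Vec 𝔽 n) j d f w → (∀ k → j ℕ.≤ k → b k ≡ 0ᶠ) → newton b e j d f w ≡ 0ᶠ
  newton-0 b e j zero    f w z = trans (cong (_*ᶠ f w) (z j ℕₚ.≤-refl)) (F.zeroˡ (f w))
  newton-0 b e j (suc d) f w z = trans
    (cong₂ _+ᶠ_ (trans (cong (_*ᶠ f w) (z j ℕₚ.≤-refl)) (F.zeroˡ (f w)))
                (newton-0 b e (suc j) d (Δ e f) w λ k j<k → z k (ℕₚ.<⇒≤ j<k)))
    (F.+-identityʳ 0ᶠ)

  newton-suc : ∀ {n} (b b′ : ℕ → 𝔽) → (∀ k → b′ (suc k) ≡ b k +ᶠ b (suc k)) → ∀ (e : Vec 𝔽 n) j d f w →
               newton b′ e (suc j) d f w ≡ newton b e j d f w +ᶠ newton b e (suc j) d f w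
  newton-suc b b′ step e j zero    f w = trans (cong (_*ᶠ f w) (step j)) (F.distribʳ (f w) (b j) (b (suc j)))
  newton-suc b b′ step e j (suc d) f w = trans
    (cong₂ _+ᶠ_ (cong (_*ᶠ f w) (step j)) (newton-suc b b′ step e (suc j) d (Δ e f) w))
    (solve 5 (λ x y f s t → (x :+ y) :* f :+ (s :+ t) := (x :* f :+ s) :+ (y :* f :+ t)) refl
      (b j) (b (suc j)) (f w) (newton b e (suc j) d (Δ e f) w) (newton b e (suc (suc j)) d (Δ e f) w))

  newton-factor : ∀ {n} (b b′ : ℕ → 𝔽) a → (∀ k → b (suc k) ≡ a *ᶠ b′ k) → ∀ (e : Vec 𝔽 n) j d f w →
                  newton b e (suc j) d f w ≡ a *ᶠ newton b′ e j d f w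
  newton-factor b b′ a step e j zero    f w = trans (cong (_*ᶠ f w) (step j)) (F.*-assoc a (b′ j) (f w))
  newton-factor b b′ a step e j (suc d) f w = trans
    (cong₂ _+ᶠ_ (cong (_*ᶠ f w) (step j)) (newton-factor b b′ a step e (suc j) d (Δ e f) w))
    (solve 4 (λ a b f s → (a :* b) :* f :+ a :* s := a :* (b :* f :+ s)) refl
      a (b′ j) (f w) (newton b′ e (suc j) d (Δ e f) w))

  binomial : ℕ → 𝔽 → 𝔽
  binomial k a = ⟦ toℕ a C k ⟧

  -- Induction on the representative of `a`: f (w + (m+1) e) = f (w + m e) + Δ e f (w + m e), and
  -- Pascal's rule recombines the two series. Stopping at d loses nothing because the next
  -- differences vanish.
  newton-expansion : ∀ {n} d {f : Vec 𝔽 n → 𝔽} → Vanish (suc d) f → ∀ e a w →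
                     f (w ⊕ a • e) ≡ newton (λ k → binomial k a) e 0 d f w
  newton-expansion d {f} vf e a w = subst (λ c → f (w ⊕ c • e) ≡ newton (λ k → binomial k a) e 0 d f w)
      (⟦toℕ⟧ a) (natural (toℕ a) d vf)
    where
    open ≡-Reasoning
    N : ℕ → ℕ → ℕ → (Vec 𝔽 _ → 𝔽) → 𝔽
    N m j d f = newton (λ k → ⟦ m C k ⟧) e j d f w
    base : ∀ d f → N 0 0 d f ≡ f w
    base zero    f = F.*-identityˡ (f w)
    base (suc d) f = trans (cong₂ _+ᶠ_ (F.*-identityˡ (f w))
      (newton-0 (λ k → ⟦ 0 C k ⟧) e 1 d (Δ e f) w λ k 0<k → cong ⟦_⟧ (k>n⇒nCk≡0 0<k))) (F.+-identityʳ (f w))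
    pascal : ∀ m k → ⟦ suc m C suc k ⟧ ≡ ⟦ m C k ⟧ +ᶠ ⟦ m C suc k ⟧
    pascal m k = sym (trans (⟦⟧-+ (m C k) (m C suc k)) (cong ⟦_⟧ (nCk+nC[k+1]≡[n+1]C[k+1] m k)))
    natural : ∀ m d {f} → Vanish (suc d) f → f (w ⊕ ⟦ m ⟧ • e) ≡ N m 0 d f
    natural zero d {f} vf = trans (cong f (trans (cong (w ⊕_) (•-zeroˡ e)) (⊕-identityʳ w))) (sym (base d f))
    natural (suc m) zero {f} vf = trans (vanish-1 vf _ w) (sym (F.*-identityˡ (f w)))
    natural (suc m) (suc d) {f} vf = begin
      f (w ⊕ ⟦ suc m ⟧ • e)
        ≡⟨ cong (λ c → f (w ⊕ c • e)) (trans (cong ⟦_⟧ (ℕₚ.+-comm 1 m)) (sym (⟦⟧-+ m 1))) ⟩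
      f (w ⊕ (⟦ m ⟧ +ᶠ 1ᶠ) • e)
        ≡⟨ cong (λ z → f (w ⊕ z)) (trans (•-distribʳ ⟦ m ⟧ 1ᶠ e) (cong (⟦ m ⟧ • e ⊕_) (•-identityˡ e))) ⟩
      f (w ⊕ (⟦ m ⟧ • e ⊕ e))
        ≡⟨ cong f (sym (⊕-assoc w _ e)) ⟩
      f ((w ⊕ ⟦ m ⟧ • e) ⊕ e)
        ≡⟨ Δ-+ e f _ ⟩
      f (w ⊕ ⟦ m ⟧ • e) +ᶠ Δ e f (w ⊕ ⟦ m ⟧ • e)
        ≡⟨ cong₂ _+ᶠ_ (natural m (suc d) vf) (natural m d (vanish-Δ vf e)) ⟩
      (⟦ m C 0 ⟧ *ᶠ f w +ᶠ N m 1 d (Δ e f)) +ᶠ N m 0 d (Δ e f)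
        ≡⟨ solve 3 (λ x y z → (x :+ y) :+ z := x :+ (z :+ y)) refl (⟦ m C 0 ⟧ *ᶠ f w) (N m 1 d (Δ e f)) (N m 0 d (Δ e f)) ⟩
      ⟦ m C 0 ⟧ *ᶠ f w +ᶠ (N m 0 d (Δ e f) +ᶠ N m 1 d (Δ e f))
        ≡⟨ cong (⟦ m C 0 ⟧ *ᶠ f w +ᶠ_) (newton-suc (λ k → ⟦ m C k ⟧) (λ k → ⟦ suc m C k ⟧) (pascal m) e 0 d (Δ e f) w) ⟨
      N (suc m) 0 (suc d) f ∎

  -- In each product the weight gains as much degree as the difference loses, so all terms have
  -- degree at most j + d.
  deg-newton : ∀ {m n} (b : ℕ → Vec 𝔽 m → 𝔽) → (∀ k → Deg k (b k)) → (W : Vec 𝔽 m → Vec 𝔽 n) →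
               (∀ d {f} → Vanish (suc d) f → Deg d (f ∘ W)) → ∀ e j d {f} → Vanish (suc d) f →
               Deg (j ℕ.+ d) (λ x → newton (λ k → b k x) e j d f (W x))
  deg-newton b db W dW e j zero    vf = deg-* (db j) (dW zero vf)
  deg-newton b db W dW e j (suc d) {f} vf = plus (deg-* (db j) (dW (suc d) vf))
    (subst (λ k → Deg k (λ x → newton (λ k → b k x) e (suc j) d (Δ e f) (W x))) (sym (ℕₚ.+-suc j d))
      (deg-newton b db W dW e (suc j) d (vanish-Δ vf e)))
    λ _ → refl

  module Degrees (pr : Prime p) where

    -- For k ≥ p the function a ↦ C(a, k) vanishes on residues; below p, the
    -- factor k + 1 of (k+1) C(a, k+1) = (a-k) C(a, k) is invertible.
    binomial-factor : ∀ k → Σ (𝔽 → 𝔽) λ b′ → (∀ a → binomial (suc k) a ≡ a *ᶠ b′ a) ×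
                      (∀ {n} {φ : Vec 𝔽 n → 𝔽} → Deg 1 φ → Deg k (b′ ∘ φ))
    binomial-factor zero = (λ _ → 1ᶠ) ,
      (λ a → trans (cong ⟦_⟧ (nC1≡n (toℕ a))) (trans (⟦toℕ⟧ a) (sym (F.*-identityʳ a)))) ,
      λ _ → const 1ᶠ λ _ → refl
    binomial-factor (suc k) with suc (suc k) ℕ.<? p
    ... | no k+2≮p = (λ _ → 0ᶠ) ,
      (λ a → trans (cong ⟦_⟧ (k>n⇒nCk≡0 (ℕₚ.<-≤-trans (Finₚ.toℕ<n a) (ℕₚ.≮⇒≥ k+2≮p)))) (sym (F.zeroʳ a))) ,
      λ _ → const 0ᶠ λ _ → refl
    ... | yes k+2<p = let b′ , e , db′ = binomial-factor k in
      (λ a → i *ᶠ ((a +ᶠ ⊖ ⟦ suc k ⟧) *ᶠ b′ a)) ,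
      (λ a → begin
        binomial (suc (suc k)) a
          ≡⟨ F.*-identityˡ (binomial (suc (suc k)) a) ⟨
        1ᶠ *ᶠ binomial (suc (suc k)) a
          ≡⟨ cong (_*ᶠ binomial (suc (suc k)) a) ik≡1 ⟨
        (i *ᶠ ⟦ suc (suc k) ⟧) *ᶠ binomial (suc (suc k)) a
          ≡⟨ solve 5 (λ i m b l c → (i :* m) :* b := i :* ((m :* b :+ l :* c) :+ :- (l :* c))) refl
               i ⟦ suc (suc k) ⟧ (binomial (suc (suc k)) a) ⟦ suc k ⟧ (binomial (suc k) a) ⟩
        i *ᶠ ((⟦ suc (suc k) ⟧ *ᶠ binomial (suc (suc k)) a +ᶠ ⟦ suc k ⟧ *ᶠ binomial (suc k) a)
              +ᶠ ⊖ (⟦ suc k ⟧ *ᶠ binomial (suc k) a))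
          ≡⟨ cong (λ z → i *ᶠ (z +ᶠ ⊖ (⟦ suc k ⟧ *ᶠ binomial (suc k) a))) (absorption a (suc k)) ⟩
        i *ᶠ (a *ᶠ binomial (suc k) a +ᶠ ⊖ (⟦ suc k ⟧ *ᶠ binomial (suc k) a))
          ≡⟨ cong (λ z → i *ᶠ (a *ᶠ z +ᶠ ⊖ (⟦ suc k ⟧ *ᶠ z))) (e a) ⟩
        i *ᶠ (a *ᶠ (a *ᶠ b′ a) +ᶠ ⊖ (⟦ suc k ⟧ *ᶠ (a *ᶠ b′ a)))
          ≡⟨ solve 4 (λ i a l b → i :* (a :* (a :* b) :+ :- (l :* (a :* b))) := a :* (i :* ((a :+ :- l) :* b)))
               refl i a ⟦ suc k ⟧ (b′ a) ⟩
        a *ᶠ (i *ᶠ ((a +ᶠ ⊖ ⟦ suc k ⟧) *ᶠ b′ a)) ∎) ,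
      λ dφ → deg-scale i (deg-* (plus dφ (const (⊖ ⟦ suc k ⟧) (λ _ → refl)) (λ _ → refl)) (db′ dφ))
      where
      open ≡-Reasoning
      ⟦k+2⟧≢0 : ⟦ suc (suc k) ⟧ ≢ 0ᶠ
      ⟦k+2⟧≢0 z with trans (trans (sym (ℕ.m<n⇒m%n≡m k+2<p)) (trans (sym (toℕ-⟦⟧ _)) (cong toℕ z)))
                           (trans (toℕ-⟦⟧ 0) (ℕ.m*n%n≡0 0 p))
      ... | ()
      i = proj₁ (inverse pr ⟦ suc (suc k) ⟧ ⟦k+2⟧≢0)
      ik≡1 = proj₂ (inverse pr ⟦ suc (suc k) ⟧ ⟦k+2⟧≢0)
      absorption : ∀ a k → ⟦ suc k ⟧ *ᶠ binomial (suc k) a +ᶠ ⟦ k ⟧ *ᶠ binomial k a ≡ a *ᶠ binomial k a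
      absorption a k = begin
        ⟦ suc k ⟧ *ᶠ binomial (suc k) a +ᶠ ⟦ k ⟧ *ᶠ binomial k a
          ≡⟨ cong₂ _+ᶠ_ (⟦⟧-* (suc k) (toℕ a C suc k)) (⟦⟧-* k (toℕ a C k)) ⟩
        ⟦ suc k ℕ.* (toℕ a C suc k) ⟧ +ᶠ ⟦ k ℕ.* (toℕ a C k) ⟧
          ≡⟨ ⟦⟧-+ (suc k ℕ.* (toℕ a C suc k)) (k ℕ.* (toℕ a C k)) ⟩
        ⟦ suc k ℕ.* (toℕ a C suc k) ℕ.+ k ℕ.* (toℕ a C k) ⟧
          ≡⟨ cong ⟦_⟧ (nC-absorption (toℕ a) k) ⟩
        ⟦ toℕ a ℕ.* (toℕ a C k) ⟧
          ≡⟨ ⟦⟧-* (toℕ a) (toℕ a C k) ⟨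
        ⟦ toℕ a ⟧ *ᶠ binomial k a
          ≡⟨ cong (_*ᶠ binomial k a) (⟦toℕ⟧ a) ⟩
        a *ᶠ binomial k a ∎

    deg-binomial : ∀ {n} {φ : Vec 𝔽 n → 𝔽} → Deg 1 φ → ∀ k → Deg k (binomial k ∘ φ)
    deg-binomial dφ zero    = const 1ᶠ λ _ → refl
    deg-binomial {φ = φ} dφ (suc k) = let b′ , e , db′ = binomial-factor k in
      deg-resp (λ x → e (φ x)) (deg-* dφ (db′ dφ))

    -- Newton expansion of f in the first coordinate, whose coefficients have one variable less.
    vanish-deg : ∀ {n} d {f : Vec 𝔽 n → 𝔽} → Vanish (suc d) f → Deg d f
    vanish-deg {zero}  d {f} vf = const (f []) λ { [] → refl }
    vanish-deg {suc n} d {f} vf = deg-resp expand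
      (deg-newton (λ k x → binomial k (Vec.head x)) (deg-binomial deg-head)
        (λ x → 0ᶠ ∷ Vec.tail x)
        (λ d vg → deg-tail (vanish-deg d (vanish-∘ (suc d) (0ᶠ ∷_) (0ᶠ ∷_)
          (λ x y → cong (_∷ (x ⊕ y)) (sym (F.+-identityˡ 0ᶠ))) vg)))
        e₀ 0 d vf)
      where
      e₀ = 1ᶠ ∷ 0ᵛ
      deg-head : Deg 1 (Vec.head {n = n})
      deg-head = times zero (const {d = 0} 1ᶠ λ _ → refl) λ { (a ∷ x) → sym (F.*-identityʳ a) }
      expand : ∀ x → f x ≡ newton (λ k → binomial k (Vec.head x)) e₀ 0 d f (0ᶠ ∷ Vec.tail x)
      expand (a ∷ x) = trans
        (cong f (cong₂ _∷_ (sym (trans (F.+-identityˡ (a *ᶠ 1ᶠ)) (F.*-identityʳ a)))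
          (sym (trans (cong (x ⊕_) (•-zeroʳ a)) (⊕-identityʳ x)))))
        (newton-expansion d vf e₀ a (0ᶠ ∷ x))

    additive-deg : ∀ {n} {φ : Vec 𝔽 n → 𝔽} → Additive φ → Deg 1 φ
    additive-deg {φ = φ} add = vanish-deg 1 (vanish-additive {φ = φ} add)

-- Exhaustive search over a finite type. The pointwise alternative `P ⊎ Q`, instead of a decision of
-- `P`, lets the failing case return positive information such as an equation to 0ᶠ.
Searchable : Set → Set₁
Searchable A = ∀ {P Q : A → Set} → (∀ x → P x ⊎ Q x) → ∃ P ⊎ (∀ x → Q x)

search-Fin : ∀ n → Searchable (Fin n)
search-Fin zero    d = inj₂ λ ()
search-Fin (suc n) d with d zero
... | inj₁ P0 = inj₁ (zero , P0)
... | inj₂ Q0 with search-Fin n (d ∘ suc)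
...   | inj₁ (i , Pi) = inj₁ (suc i , Pi)
...   | inj₂ Q        = inj₂ λ { zero → Q0 ; (suc i) → Q i }

search-× : ∀ {A B} → Searchable A → Searchable B → Searchable (A × B)
search-× sA sB d with sA (λ a → sB (λ b → d (a , b)))
... | inj₁ (a , b , P) = inj₁ ((a , b) , P)
... | inj₂ Q           = inj₂ λ { (a , b) → Q a b }

search-Vec : ∀ {A} → Searchable A → ∀ n → Searchable (Vec A n)
search-Vec sA zero d with d []
... | inj₁ P = inj₁ ([] , P)
... | inj₂ Q = inj₂ λ { [] → Q }
search-Vec sA (suc n) d with sA (λ a → search-Vec sA n (λ x → d (a ∷ x)))
... | inj₁ (a , x , P) = inj₁ (a ∷ x , P)
... | inj₂ Q           = inj₂ λ { (a ∷ x) → Q a x }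

-- Sums over 𝔽ⁿ in a commutative monoid, for counts and for character sums alike.

module VecSums (p : ℕ) .{{_ : NonZero p}} {c ℓ} (M : CommutativeMonoid c ℓ) where

  open PrimeField p
  open Differences p
  open CommutativeMonoid M
  open Algebra.Properties.CommutativeMonoid.Sum M public
  open import Relation.Binary.Reasoning.Setoid setoid

  ∑ᵛ : ∀ n → (Vec 𝔽 n → Carrier) → Carrier
  ∑ᵛ zero    g = g []
  ∑ᵛ (suc n) g = sum λ a → ∑ᵛ n λ x → g (a ∷ x)

  ∑ᵛ-cong : ∀ n {g h : Vec 𝔽 n → Carrier} → (∀ x → g x ≈ h x) → ∑ᵛ n g ≈ ∑ᵛ n h
  ∑ᵛ-cong zero    e = e []
  ∑ᵛ-cong (suc n) e = sum-cong-≋ λ a → ∑ᵛ-cong n λ x → e (a ∷ x)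

  sum-∑ᵛ-comm : ∀ {k} n (g : Fin k → Vec 𝔽 n → Carrier) →
                sum (λ i → ∑ᵛ n (g i)) ≈ ∑ᵛ n λ x → sum λ i → g i x
  sum-∑ᵛ-comm zero    g = refl
  sum-∑ᵛ-comm (suc n) g = trans (∑-comm λ i a → ∑ᵛ n λ x → g i (a ∷ x))
    (sum-cong-≋ λ a → sum-∑ᵛ-comm n λ i x → g i (a ∷ x))

  translation : 𝔽 → Permutation′ p
  translation b = permutation (_+ᶠ b) (_+ᶠ ⊖ b)
    (λ a → ≡.trans (F.+-assoc a (⊖ b) b) (≡.trans (≡.cong (a +ᶠ_) (F.-‿inverseˡ b)) (F.+-identityʳ a)))
    (λ a → ≡.trans (F.+-assoc a b (⊖ b)) (≡.trans (≡.cong (a +ᶠ_) (F.-‿inverseʳ b)) (F.+-identityʳ a)))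

  sum-translate : ∀ b (g : 𝔽 → Carrier) → sum (λ a → g (a +ᶠ b)) ≈ sum g
  sum-translate b g = sym (sum-permute g (translation b))

  ∑ᵛ-translate : ∀ n y (g : Vec 𝔽 n → Carrier) → ∑ᵛ n (λ x → g (x ⊕ y)) ≈ ∑ᵛ n g
  ∑ᵛ-translate zero    []      g = refl
  ∑ᵛ-translate (suc n) (b ∷ y) g = trans
    (sum-cong-≋ λ a → ∑ᵛ-translate n y λ x → g ((a +ᶠ b) ∷ x))
    (sum-translate b λ a → ∑ᵛ n λ x → g (a ∷ x))

  -- Each translation by c • e permutes 𝔽ⁿ, so summing along lines first counts every point p times,
  -- even for e = 0. This averaging replaces bases and cosets in `independent-thin`, `fibre-total`
  -- and `character-sum`.
  ∑ᵛ-lines : ∀ n e (g : Vec 𝔽 n → Carrier) →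
             ∑ᵛ n (λ x → sum λ c → g (x ⊕ c • e)) ≈ sum {p} λ _ → ∑ᵛ n g
  ∑ᵛ-lines n e g = trans (sym (sum-∑ᵛ-comm n λ c x → g (x ⊕ c • e)))
    (sum-cong-≋ λ c → ∑ᵛ-translate n (c • e) g)

  sumList : {A : Set} → List A → (A → Carrier) → Carrier
  sumList xs g = List.foldr (λ x s → g x ∙ s) ε xs

  sumList-cong : {A : Set} (xs : List A) {g h : A → Carrier} → (∀ x → g x ≈ h x) → sumList xs g ≈ sumList xs h
  sumList-cong []       e = refl
  sumList-cong (x ∷ xs) e = ∙-cong (e x) (sumList-cong xs e)

  sumList-++ : {A : Set} (xs ys : List A) (g : A → Carrier) →
               sumList (xs List.++ ys) g ≈ sumList xs g ∙ sumList ys g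
  sumList-++ []       ys g = sym (identityˡ _)
  sumList-++ (x ∷ xs) ys g = trans (∙-congˡ (sumList-++ xs ys g)) (sym (assoc _ _ _))

  sumList-map : {A B : Set} (h : A → B) (xs : List A) (g : B → Carrier) →
                sumList (List.map h xs) g ≈ sumList xs (g ∘ h)
  sumList-map h []       g = refl
  sumList-map h (x ∷ xs) g = ∙-congˡ (sumList-map h xs g)

  sumList-concatMap : {A B : Set} (h : A → List B) (xs : List A) (g : B → Carrier) →
                      sumList (List.concatMap h xs) g ≈ sumList xs (λ x → sumList (h x) g)
  sumList-concatMap h []       g = refl
  sumList-concatMap h (x ∷ xs) g = trans (sumList-++ (h x) _ g) (∙-congˡ (sumList-concatMap h xs g))

  sumList-vectors : {A : Set} (xs : List A) → ∀ n (g : Vec A (suc n) → Carrier) →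
                    sumList (vectors xs (suc n)) g ≈ sumList xs λ x → sumList (vectors xs n) λ v → g (x ∷ v)
  sumList-vectors xs n g = trans (sumList-concatMap (λ x → List.map (x ∷_) (vectors xs n)) xs g)
    (sumList-cong xs λ x → sumList-map (x ∷_) (vectors xs n) g)

  sumList-tabulate : ∀ {n} {A : Set} (h : Fin n → A) (g : A → Carrier) →
                     sumList (List.tabulate h) g ≈ sum (g ∘ h)
  sumList-tabulate {zero}  h g = refl
  sumList-tabulate {suc n} h g = ∙-congˡ (sumList-tabulate (h ∘ suc) g)

  sumList-∑ᵛ : ∀ n (g : Vec 𝔽 n → Carrier) → sumList (vectors (List.allFin p) n) g ≈ ∑ᵛ n g
  sumList-∑ᵛ zero    g = identityʳ _
  sumList-∑ᵛ (suc n) g = trans (sumList-vectors (List.allFin p) n g)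
    (trans (sumList-tabulate id λ a → sumList (vectors (List.allFin p) n) λ x → g (a ∷ x))
      (sum-cong-≋ λ a → sumList-∑ᵛ n λ x → g (a ∷ x)))

module ℕSums (p : ℕ) .{{_ : NonZero p}} where

  open PrimeField p
  open Differences p
  open VecSums p ℕₚ.+-0-commutativeMonoid public
  open ℕₚ.≤-Reasoning

  sum-const : ∀ n k → sum {n} (λ _ → k) ≡ n ℕ.* k
  sum-const zero    k = ≡.refl
  sum-const (suc n) k = ≡.cong (k ℕ.+_) (sum-const n k)

  sum-mono : ∀ {n} {g h : Fin n → ℕ} → (∀ i → g i ℕ.≤ h i) → sum g ℕ.≤ sum h
  sum-mono {zero}  le = z≤n
  sum-mono {suc n} le = ℕₚ.+-mono-≤ (le zero) (sum-mono (le ∘ suc))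

  ∑ᵛ-mono : ∀ n {g h : Vec 𝔽 n → ℕ} → (∀ x → g x ℕ.≤ h x) → ∑ᵛ n g ℕ.≤ ∑ᵛ n h
  ∑ᵛ-mono zero    le = le []
  ∑ᵛ-mono (suc n) le = sum-mono λ a → ∑ᵛ-mono n λ x → le (a ∷ x)

  ∑ᵛ-const : ∀ n k → ∑ᵛ n (λ _ → k) ≡ p ℕ.^ n ℕ.* k
  ∑ᵛ-const zero    k = ≡.sym (ℕₚ.+-identityʳ k)
  ∑ᵛ-const (suc n) k = ≡.trans (sum-cong-≋ {p} λ _ → ∑ᵛ-const n k)
    (≡.trans (sum-const p _) (≡.sym (ℕₚ.*-assoc p (p ℕ.^ n) k)))

  sum-*ʳ : ∀ {n} (g : Fin n → ℕ) k → sum g ℕ.* k ≡ sum λ i → g i ℕ.* k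
  sum-*ʳ {zero}  g k = ≡.refl
  sum-*ʳ {suc n} g k = ≡.trans (ℕₚ.*-distribʳ-+ k (g zero) (sum (g ∘ suc))) (≡.cong (g zero ℕ.* k ℕ.+_) (sum-*ʳ (g ∘ suc) k))

  ∑ᵛ-*ʳ : ∀ n (g : Vec 𝔽 n → ℕ) k → ∑ᵛ n g ℕ.* k ≡ ∑ᵛ n λ x → g x ℕ.* k
  ∑ᵛ-*ʳ zero    g k = ≡.refl
  ∑ᵛ-*ʳ (suc n) g k = ≡.trans (sum-*ʳ (λ a → ∑ᵛ n λ x → g (a ∷ x)) k)
    (sum-cong-≋ λ a → ∑ᵛ-*ʳ n (λ x → g (a ∷ x)) k)

  ∑ᵛ-+ : ∀ n (g h : Vec 𝔽 n → ℕ) → ∑ᵛ n (λ x → g x ℕ.+ h x) ≡ ∑ᵛ n g ℕ.+ ∑ᵛ n h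
  ∑ᵛ-+ zero    g h = ≡.refl
  ∑ᵛ-+ (suc n) g h = ≡.trans (sum-cong-≋ λ a → ∑ᵛ-+ n (λ x → g (a ∷ x)) (λ x → h (a ∷ x)))
    (∑-distrib-+ (λ a → ∑ᵛ n λ x → g (a ∷ x)) (λ a → ∑ᵛ n λ x → h (a ∷ x)))

  sum-≢0 : ∀ {n} (g : Fin n → ℕ) → sum g ≢ 0 → ∃[ i ] (g i ≢ 0)
  sum-≢0 {zero}  g ne = ⊥-elim (ne ≡.refl)
  sum-≢0 {suc n} g ne with g zero ℕ.≟ 0
  ... | no  g0≢0 = zero , g0≢0
  ... | yes g0≡0 = let i , gi≢0 = sum-≢0 (g ∘ suc) λ e → ne (≡.cong₂ ℕ._+_ g0≡0 e) in suc i , gi≢0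

  -- With at most one exceptional index the sum is at most Z + (n-1) Y; Y is added on both sides to
  -- avoid truncated subtraction. `Y ≤ Z` covers the case without an exceptional index.
  sum-exceptional : ∀ {n} (h : Fin n → ℕ) {P : Fin n → Set} → (∀ i → Dec (P i)) →
                    (∀ i j → P i → P j → i ≡ j) → ∀ {Y Z} → Y ℕ.≤ Z →
                    (∀ i → P i → h i ℕ.≤ Z) → (∀ i → ¬ P i → h i ℕ.≤ Y) →
                    sum h ℕ.+ Y ℕ.≤ Z ℕ.+ n ℕ.* Y
  sum-exceptional {zero}  h P? unique {Y} {Z} Y≤Z big small = ℕₚ.≤-trans Y≤Z (ℕₚ.m≤m+n Z 0)
  sum-exceptional {suc n} h P? unique {Y} {Z} Y≤Z big small with P? zero
  ... | yes P0 = begin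
    (h zero ℕ.+ sum (h ∘ suc)) ℕ.+ Y  ≤⟨ ℕₚ.+-monoˡ-≤ Y (ℕₚ.+-mono-≤ (big zero P0)
                                           (sum-mono λ i → small (suc i) λ Pi → 0≢suc (unique zero (suc i) P0 Pi))) ⟩
    (Z ℕ.+ sum {n} (λ _ → Y)) ℕ.+ Y   ≡⟨ ≡.cong (λ s → (Z ℕ.+ s) ℕ.+ Y) (sum-const n Y) ⟩
    (Z ℕ.+ n ℕ.* Y) ℕ.+ Y             ≡⟨ ℕₚ.+-assoc Z _ Y ⟩
    Z ℕ.+ (n ℕ.* Y ℕ.+ Y)             ≡⟨ ≡.cong (Z ℕ.+_) (ℕₚ.+-comm _ Y) ⟩
    Z ℕ.+ suc n ℕ.* Y                 ∎
    where
    0≢suc : ∀ {i : Fin n} → zero ≢ suc i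
    0≢suc ()
  ... | no ¬P0 = begin
    (h zero ℕ.+ sum (h ∘ suc)) ℕ.+ Y  ≡⟨ ℕₚ.+-assoc (h zero) _ Y ⟩
    h zero ℕ.+ (sum (h ∘ suc) ℕ.+ Y)  ≤⟨ ℕₚ.+-mono-≤ (small zero ¬P0)
                                           (sum-exceptional (h ∘ suc) (P? ∘ suc)
                                             (λ i j Pi Pj → Finₚ.suc-injective (unique (suc i) (suc j) Pi Pj))
                                             Y≤Z (big ∘ suc) (small ∘ suc)) ⟩
    Y ℕ.+ (Z ℕ.+ n ℕ.* Y)             ≡⟨ regroup Y Z (n ℕ.* Y) ⟩
    Z ℕ.+ suc n ℕ.* Y                 ∎
    where
    regroup : ∀ a b c → a ℕ.+ (b ℕ.+ c) ≡ b ℕ.+ (a ℕ.+ c)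
    regroup = ℕ-Solver.solve-∀

  sum-unique : ∀ {n} (g : Fin n → ℕ) X → (∀ i → g i ℕ.≤ X) →
               (∀ i j → g i ≢ 0 → g j ≢ 0 → i ≡ j) → sum g ℕ.≤ X
  sum-unique {n} g X le unique = begin
    sum g                ≡⟨ ℕₚ.+-identityʳ (sum g) ⟨
    sum g ℕ.+ 0          ≤⟨ sum-exceptional g (λ i → ≢0? (g i)) unique z≤n (λ i _ → le i) (λ i ¬≢0 → zero≤ (g i) ¬≢0) ⟩
    X ℕ.+ n ℕ.* 0        ≡⟨ ≡.cong (X ℕ.+_) (ℕₚ.*-zeroʳ n) ⟩
    X ℕ.+ 0              ≡⟨ ℕₚ.+-identityʳ X ⟩
    X                    ∎
    where
    ≢0? : ∀ k → Dec (k ≢ 0)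
    ≢0? zero    = no λ ne → ne ≡.refl
    ≢0? (suc k) = yes λ ()
    zero≤ : ∀ k → ¬ (k ≢ 0) → k ℕ.≤ 0
    zero≤ zero    _   = z≤n
    zero≤ (suc k) ¬≢0 = ⊥-elim (¬≢0 λ ())

  ∑ᵛ-lines-ℕ : ∀ n e (g : Vec 𝔽 n → ℕ) → ∑ᵛ n (λ x → sum λ c → g (x ⊕ c • e)) ≡ p ℕ.* ∑ᵛ n g
  ∑ᵛ-lines-ℕ n e g = ≡.trans (∑ᵛ-lines n e g) (sum-const p (∑ᵛ n g))

-- The third difference as a trilinear form, and splitting off products.

module Decomposition (p : ℕ) .{{_ : NonZero p}} where

  open import Relation.Binary.PropositionalEquality

  open PrimeField p
  open Differences p
  open 𝔽-Solver using (solve; _:+_; _:*_; :-_; _:=_; :0; :1)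

  record Form (n : ℕ) : Set where
    field
      fun      : Vec 𝔽 n → 𝔽
      additive : Additive fun
  open Form public

  Zeros : ∀ {n c} → Vec (Form n) c → Vec 𝔽 n → Set
  Zeros Λ x = Allᵛ.All (λ φ → fun φ x ≡ 0ᶠ) Λ

  vanishing? : ∀ a → a ≢ 0ᶠ ⊎ a ≡ 0ᶠ
  vanishing? a with a Finₚ.≟ 0ᶠ
  ... | yes a≡0 = inj₂ a≡0
  ... | no  a≢0 = inj₁ a≢0

  search-vector : ∀ n → Searchable (Vec 𝔽 n)
  search-vector = search-Vec (search-Fin p)

  ⊕-interchange : ∀ {n} (a b c d : Vec 𝔽 n) → (a ⊕ b) ⊕ (c ⊕ d) ≡ (a ⊕ c) ⊕ (b ⊕ d)
  ⊕-interchange a b c d = trans (sym (⊕-assoc (a ⊕ b) c d))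
    (trans (cong (_⊕ d) (⊕-swap a b c)) (⊕-assoc (a ⊕ c) b d))

  third : ∀ {n} → (Vec 𝔽 n → 𝔽) → Vec 𝔽 n → Vec 𝔽 n → Vec 𝔽 n → 𝔽
  third f y z w = Δ w (Δ z (Δ y f)) 0ᵛ

  Δ-∘ : ∀ {m n} (A : Vec 𝔽 m → Vec 𝔽 n) → (∀ x y → A (x ⊕ y) ≡ A x ⊕ A y) →
        ∀ y (f : Vec 𝔽 n → 𝔽) → Δ y (f ∘ A) ≗ Δ (A y) f ∘ A
  Δ-∘ A add y f x = cong (λ z → f z -ᶠ f (A x)) (add x y)

  third-∘ : ∀ {m n} (A : Vec 𝔽 m → Vec 𝔽 n) → (∀ x y → A (x ⊕ y) ≡ A x ⊕ A y) → A 0ᵛ ≡ 0ᵛ →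
            ∀ f y z w → third (f ∘ A) y z w ≡ third f (A y) (A z) (A w)
  third-∘ A add A0 f y z w = begin
    Δ w (Δ z (Δ y (f ∘ A))) 0ᵛ
      ≡⟨ Δ-cong w (Δ-cong z (Δ-∘ A add y f)) 0ᵛ ⟩
    Δ w (Δ z (Δ (A y) f ∘ A)) 0ᵛ
      ≡⟨ Δ-cong w (Δ-∘ A add z (Δ (A y) f)) 0ᵛ ⟩
    Δ w (Δ (A z) (Δ (A y) f) ∘ A) 0ᵛ
      ≡⟨ Δ-∘ A add w (Δ (A z) (Δ (A y) f)) 0ᵛ ⟩
    Δ (A w) (Δ (A z) (Δ (A y) f)) (A 0ᵛ)
      ≡⟨ cong (Δ (A w) (Δ (A z) (Δ (A y) f))) A0 ⟩
    third f (A y) (A z) (A w) ∎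
    where open ≡-Reasoning

  module Cubic {n : ℕ} {f : Vec 𝔽 n → 𝔽} (cubic : Vanish 4 f) where

    third-constant : ∀ y z w x → Δ w (Δ z (Δ y f)) x ≡ third f y z w
    third-constant y z w x = vanish-1 (vanish-Δ (vanish-Δ (vanish-Δ cubic y) z) w) x 0ᵛ

    third-swap₁₂ : ∀ y z w → third f y z w ≡ third f z y w
    third-swap₁₂ y z w = Δ-cong w (Δ-comm z y f) 0ᵛ

    third-swap₂₃ : ∀ y z w → third f y z w ≡ third f y w z
    third-swap₂₃ y z w = Δ-comm w z (Δ y f) 0ᵛ

    -- Δ (w + w′) g at x is Δ w g at x plus Δ w′ g at x + w, and for a cubic the shift of the base
    -- point does not change a third difference. Symmetry carries this to the other two arguments.
    third-additive₃ : ∀ y z → Additive (third f y z)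
    third-additive₃ y z w w′ = Δ-unique (w ⊕ w′) g 0ᵛ (begin
      g (0ᵛ ⊕ (w ⊕ w′))
        ≡⟨ cong g (⊕-assoc 0ᵛ w w′) ⟨
      g ((0ᵛ ⊕ w) ⊕ w′)
        ≡⟨ Δ-+ w′ g (0ᵛ ⊕ w) ⟩
      g (0ᵛ ⊕ w) +ᶠ Δ w′ g (0ᵛ ⊕ w)
        ≡⟨ cong₂ _+ᶠ_ (Δ-+ w g 0ᵛ) (third-constant y z w′ (0ᵛ ⊕ w)) ⟩
      (g 0ᵛ +ᶠ third f y z w) +ᶠ third f y z w′
        ≡⟨ F.+-assoc (g 0ᵛ) (third f y z w) (third f y z w′) ⟩
      g 0ᵛ +ᶠ (third f y z w +ᶠ third f y z w′) ∎)
      where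
      open ≡-Reasoning
      g = Δ z (Δ y f)

    third-additive₂ : ∀ y w → Additive (λ z → third f y z w)
    third-additive₂ y w z z′ = trans (third-swap₂₃ y (z ⊕ z′) w)
      (trans (third-additive₃ y w z z′) (cong₂ _+ᶠ_ (third-swap₂₃ y w z) (third-swap₂₃ y w z′)))

    third-additive₁ : ∀ z w → Additive (λ y → third f y z w)
    third-additive₁ z w y y′ = trans (third-swap₁₂ (y ⊕ y′) z w)
      (trans (third-additive₂ z w y y′) (cong₂ _+ᶠ_ (third-swap₁₂ z y w) (third-swap₁₂ z y′ w)))

    third-0⇒vanish : (∀ y z w → third f y z w ≡ 0ᶠ) → Vanish 3 f
    third-0⇒vanish z0 = diffs λ y → diffs λ z → diffs λ w → null λ x →
      trans (third-constant y z w x) (z0 y z w)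

  record Decomposed {n} (c : ℕ) (f : Vec 𝔽 n → 𝔽) : Set where
    field
      q₀      : Vec 𝔽 n → 𝔽
      q ℓ     : Fin c → Vec 𝔽 n → 𝔽
      deg-q₀  : Deg 2 q₀
      deg-q   : ∀ j → Deg 2 (q j)
      deg-ℓ   : ∀ j → Deg 1 (ℓ j)
      expand  : ∀ x → f x ≡ ∑ (λ j → ℓ j x *ᶠ q j x) +ᶠ q₀ x

  module _ (pr : Prime p) where

    open Degrees pr

    add-product : ∀ {n c} {f g : Vec 𝔽 n → 𝔽} {ℓ q} → Deg 1 ℓ → Deg 2 q →
                  (∀ x → f x ≡ g x +ᶠ ℓ x *ᶠ q x) → Decomposed c g → Decomposed (suc c) f
    add-product {ℓ = ℓ} {q} dℓ dq e D = record
      { q₀ = D.q₀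
      ; q = λ { zero → q ; (suc j) → D.q j }
      ; ℓ = λ { zero → ℓ ; (suc j) → D.ℓ j }
      ; deg-q₀ = D.deg-q₀
      ; deg-q = λ { zero → dq ; (suc j) → D.deg-q j }
      ; deg-ℓ = λ { zero → dℓ ; (suc j) → D.deg-ℓ j }
      ; expand = λ x → trans (e x) (trans (cong (_+ᶠ ℓ x *ᶠ q x) (D.expand x))
          (solve 3 (λ s q₀ m → (s :+ q₀) :+ m := (m :+ s) :+ q₀) refl
            (∑ (λ j → D.ℓ j x *ᶠ D.q j x)) (D.q₀ x) (ℓ x *ᶠ q x)))
      }
      where module D = Decomposed D

    module Projection {n} (φ : Form n) (e : Vec 𝔽 n) (φe≡1 : fun φ e ≡ 1ᶠ) where

      π : Vec 𝔽 n → Vec 𝔽 n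
      π x = x ⊕ (⊖ fun φ x) • e

      π-⊕ : ∀ x y → π (x ⊕ y) ≡ π x ⊕ π y
      π-⊕ x y = begin
        (x ⊕ y) ⊕ (⊖ fun φ (x ⊕ y)) • e
          ≡⟨ cong (λ c → (x ⊕ y) ⊕ c • e) (trans (cong ⊖_ (additive φ x y))
               (solve 2 (λ a b → :- (a :+ b) := :- a :+ :- b) refl (fun φ x) (fun φ y))) ⟩
        (x ⊕ y) ⊕ (⊖ fun φ x +ᶠ ⊖ fun φ y) • e
          ≡⟨ cong ((x ⊕ y) ⊕_) (•-distribʳ (⊖ fun φ x) (⊖ fun φ y) e) ⟩
        (x ⊕ y) ⊕ ((⊖ fun φ x) • e ⊕ (⊖ fun φ y) • e)
          ≡⟨ ⊕-interchange x y ((⊖ fun φ x) • e) ((⊖ fun φ y) • e) ⟩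
        π x ⊕ π y ∎
        where open ≡-Reasoning

      π-0 : π 0ᵛ ≡ 0ᵛ
      π-0 = trans (⊕-identityˡ _) (trans (cong (λ c → (⊖ c) • e) (additive-0 {φ = fun φ} (additive φ)))
        (trans (cong (_• e) (solve 0 (:- :0 := :0) refl)) (•-zeroˡ e)))

      φ-π : ∀ x → fun φ (π x) ≡ 0ᶠ
      φ-π x = begin
        fun φ (π x)
          ≡⟨ additive φ x ((⊖ fun φ x) • e) ⟩
        fun φ x +ᶠ fun φ ((⊖ fun φ x) • e)
          ≡⟨ cong (fun φ x +ᶠ_) (additive-• {φ = fun φ} (additive φ) (⊖ fun φ x) e) ⟩
        fun φ x +ᶠ ⊖ fun φ x *ᶠ fun φ e
          ≡⟨ cong (λ c → fun φ x +ᶠ ⊖ fun φ x *ᶠ c) φe≡1 ⟩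
        fun φ x +ᶠ ⊖ fun φ x *ᶠ 1ᶠ
          ≡⟨ solve 1 (λ a → a :+ :- a :* :1 := :0) refl (fun φ x) ⟩
        0ᶠ ∎
        where open ≡-Reasoning

      -- The terms of positive order of the Newton expansion of f at π x in
      -- the direction e are divisible by φ x.
      quotient : ∀ {f : Vec 𝔽 n → 𝔽} → Vanish 4 f →
                 ∃[ q ] (Deg 2 q × (∀ x → f x ≡ f (π x) +ᶠ fun φ x *ᶠ q x))
      quotient {f} vf = q ,
        -- Dividing the (k+1)-st binomial coefficient by φ x leaves degree k, and `Δ e f` has degree
        -- at most 2, so the series without its leading term has degree 2 after division.
        deg-newton (λ k x → b′ k (fun φ x)) (λ k → proj₂ (proj₂ (binomial-factor k)) (additive-deg (additive φ)))
          π (λ d vg → vanish-deg d (vanish-∘ (suc d) π π π-⊕ vg)) e 0 2 (vanish-Δ vf e) ,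
        λ x → begin
          f x
            ≡⟨ cong f (⊕-cancel (fun φ x) x e) ⟨
          f (π x ⊕ fun φ x • e)
            ≡⟨ newton-expansion 3 vf e (fun φ x) (π x) ⟩
          1ᶠ *ᶠ f (π x) +ᶠ newton (λ k → binomial k (fun φ x)) e 1 2 (Δ e f) (π x)
            ≡⟨ cong₂ _+ᶠ_ (F.*-identityˡ (f (π x)))
                 (newton-factor (λ k → binomial k (fun φ x)) (λ k → b′ k (fun φ x)) (fun φ x)
                   (λ k → proj₁ (proj₂ (binomial-factor k)) (fun φ x)) e 0 2 (Δ e f) (π x)) ⟩
          f (π x) +ᶠ fun φ x *ᶠ q x ∎
        where
        open ≡-Reasoning
        b′ : ℕ → 𝔽 → 𝔽
        b′ k = proj₁ (binomial-factor k)
        q : Vec 𝔽 n → 𝔽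
        q x = newton (λ k → b′ k (fun φ x)) e 0 2 (Δ e f) (π x)

    decompose : ∀ {n c} (Λ : Vec (Form n) c) {f : Vec 𝔽 n → 𝔽} → Vanish 4 f →
                (∀ y z w → Zeros Λ y → Zeros Λ z → Zeros Λ w → third f y z w ≡ 0ᶠ) → Decomposed c f
    decompose [] {f} vf z0 = record
      { q₀ = f ; q = λ () ; ℓ = λ ()
      ; deg-q₀ = vanish-deg 2 (Cubic.third-0⇒vanish vf λ y z w → z0 y z w [] [] [])
      ; deg-q = λ () ; deg-ℓ = λ ()
      ; expand = λ x → sym (F.+-identityˡ (f x)) }
    decompose {n} (φ ∷ Λ) {f} vf z0 with search-vector n (λ x → vanishing? (fun φ x))
    -- Forms are not assumed independent, and composition with a projection may annihilate later
    -- ones. A form that is identically 0 contributes a zero product, so that the number of products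
    -- stays equal to the length of the list.
    ... | inj₂ φ≡0 = add-product (const 0ᶠ λ _ → refl) (const 0ᶠ λ _ → refl)
      (λ x → sym (trans (cong (f x +ᶠ_) (F.zeroˡ 0ᶠ)) (F.+-identityʳ (f x))))
      (decompose Λ vf λ y z w Zy Zz Zw → z0 y z w (φ≡0 y ∷ Zy) (φ≡0 z ∷ Zz) (φ≡0 w ∷ Zw))
    ... | inj₁ (e′ , φe′≢0) = let q , dq , eq = quotient vf in
      add-product (additive-deg {φ = fun φ} (additive φ)) dq eq
        -- The third difference of f ∘ π at (y, z, w) is that of f at (π y, π z, π w), and π maps
        -- into the kernel of φ; only the other forms, pulled back along π, remain to be imposed.
        (decompose (Vec.map (_∘π) Λ) (vanish-∘ 4 π π π-⊕ vf) λ y z w Zy Zz Zw →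
          trans (third-∘ π π-⊕ π-0 f y z w)
            (z0 (π y) (π z) (π w) (φ-π y ∷ zeros Λ Zy) (φ-π z ∷ zeros Λ Zz) (φ-π w ∷ zeros Λ Zw)))
      where
      i = proj₁ (inverse pr (fun φ e′) φe′≢0)
      open Projection φ (i • e′) (trans (additive-• {φ = fun φ} (additive φ) i e′) (proj₂ (inverse pr (fun φ e′) φe′≢0)))
      _∘π : Form n → Form n
      ψ ∘π = record { fun = λ x → fun ψ (π x)
                    ; additive = λ x y → trans (cong (fun ψ) (π-⊕ x y)) (additive ψ (π x) (π y)) }
      zeros : ∀ {c} (Λ : Vec (Form n) c) {x} → Zeros (Vec.map _∘π Λ) x → Zeros Λ (π x)
      zeros []      []       = []
      zeros (ψ ∷ Λ) (z ∷ zs) = z ∷ zeros Λ zs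

-- Counting kernel pairs of the trilinear form.

module Trilinear (p : ℕ) .{{_ : NonZero p}} (pr : Prime p) (n : ℕ) where

  open import Relation.Binary.PropositionalEquality

  open PrimeField p
  open Differences p
  open Decomposition p
  open ℕSums p using (sum; ∑ᵛ; ∑ᵛ-cong; sum-const; sum-mono; ∑ᵛ-mono; ∑ᵛ-const; ∑ᵛ-*ʳ; ∑ᵛ-+;
    sum-≢0; sum-exceptional; sum-unique; ∑ᵛ-lines-ℕ; sum-∑ᵛ-comm)
  open 𝔽-Solver using (solve; _:+_; _:*_; :-_; _:=_)

  V : Set
  V = Vec 𝔽 n

  search-V : Searchable V
  search-V = search-vector n

  affine-unique : ∀ a {b c d} → b ≢ 0ᶠ → a +ᶠ c *ᶠ b ≡ 0ᶠ → a +ᶠ d *ᶠ b ≡ 0ᶠ → c ≡ d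
  affine-unique a {b} {c} {d} b≢0 e e′ = cancel-*ʳ pr b≢0 (begin
    c *ᶠ b                     ≡⟨ solve 2 (λ a x → x := :- a :+ (a :+ x)) refl a (c *ᶠ b) ⟩
    ⊖ a +ᶠ (a +ᶠ c *ᶠ b)       ≡⟨ cong (⊖ a +ᶠ_) (trans e (sym e′)) ⟩
    ⊖ a +ᶠ (a +ᶠ d *ᶠ b)       ≡⟨ solve 2 (λ a x → x := :- a :+ (a :+ x)) refl a (d *ᶠ b) ⟨
    d *ᶠ b                     ∎)
    where open ≡-Reasoning

  on-line : ∀ {φ : V → 𝔽} → Additive φ → ∀ x c e → φ (x ⊕ c • e) ≡ φ x +ᶠ c *ᶠ φ e
  on-line {φ} add x c e = trans (add x (c • e)) (cong (φ x +ᶠ_) (additive-• {φ = φ} add c e))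

  on-line-0 : ∀ {φ : V → 𝔽} → Additive φ → ∀ x c e → φ e ≡ 0ᶠ → φ (x ⊕ c • e) ≡ φ x
  on-line-0 {φ} add x c e φe≡0 = trans (on-line {φ} add x c e)
    (trans (cong (λ z → φ x +ᶠ c *ᶠ z) φe≡0) (trans (cong (φ x +ᶠ_) (F.zeroʳ c)) (F.+-identityʳ (φ x))))

  -- Independence is witnessed by vectors: each adjoined form comes with a common zero of the
  -- earlier ones at which it does not vanish. Summation in that direction removes the form.
  data Independent : ∀ {c} → Vec (Form n) c → Set where
    []     : Independent []
    adjoin : ∀ {c} {Λ : Vec (Form n) c} φ e → Zeros Λ e → fun φ e ≢ 0ᶠ → Independent Λ → Independent (φ ∷ Λ)

  zeros-line : ∀ {c} (Λ : Vec (Form n) c) {e} → Zeros Λ e → ∀ x a → Zeros Λ (x ⊕ a • e) → Zeros Λ x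
  zeros-line []      []        x a []       = []
  zeros-line (φ ∷ Λ) {e} (z ∷ zs) x a (w ∷ ws) =
    trans (sym (on-line-0 {fun φ} (additive φ) x a e z)) w ∷ zeros-line Λ zs x a ws

  -- |U| ≤ pⁿ⁻ᵏ, stated for weights instead of sets so that it is preserved by
  -- summation over lines.
  Thin : (V → Set) → ℕ → Set
  Thin U k = ∀ (G : V → ℕ) X → (∀ x → G x ℕ.≤ X) → (∀ x → G x ≢ 0 → U x) →
             ∑ᵛ n G ℕ.* p ℕ.^ k ℕ.≤ X ℕ.* p ℕ.^ n

  -- On a line in direction `e` the form φ has nonzero slope, so at most one point carries weight
  -- and line sums are still at most X, while the total is multiplied by p. The earlier forms are
  -- constant along `e`, so the line sums are supported on their zeros.
  independent-thin : ∀ {c} (Λ : Vec (Form n) c) → Independent Λ → Thin (Zeros Λ) c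
  independent-thin [] [] G X G≤X supp = begin
    ∑ᵛ n G ℕ.* 1           ≡⟨ ℕₚ.*-identityʳ (∑ᵛ n G) ⟩
    ∑ᵛ n G                 ≤⟨ ∑ᵛ-mono n G≤X ⟩
    ∑ᵛ n (λ _ → X)         ≡⟨ ∑ᵛ-const n X ⟩
    p ℕ.^ n ℕ.* X          ≡⟨ ℕₚ.*-comm (p ℕ.^ n) X ⟩
    X ℕ.* p ℕ.^ n          ∎
    where open ℕₚ.≤-Reasoning
  independent-thin {suc c} (φ ∷ Λ) (adjoin φ e Λe φe≢0 ind) G X G≤X supp = begin
    ∑ᵛ n G ℕ.* (p ℕ.* p ℕ.^ c)     ≡⟨ regroup (∑ᵛ n G) p (p ℕ.^ c) ⟩
    (p ℕ.* ∑ᵛ n G) ℕ.* p ℕ.^ c     ≡⟨ cong (ℕ._* p ℕ.^ c) (∑ᵛ-lines-ℕ n e G) ⟨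
    ∑ᵛ n H ℕ.* p ℕ.^ c             ≤⟨ independent-thin Λ ind H X H≤X suppH ⟩
    X ℕ.* p ℕ.^ n                  ∎
    where
    open ℕₚ.≤-Reasoning
    regroup : ∀ a b c → a ℕ.* (b ℕ.* c) ≡ (b ℕ.* a) ℕ.* c
    regroup = ℕ-Solver.solve-∀
    H : V → ℕ
    H x = sum λ c → G (x ⊕ c • e)
    H≤X : ∀ x → H x ℕ.≤ X
    H≤X x = sum-unique (λ c → G (x ⊕ c • e)) X (λ c → G≤X (x ⊕ c • e)) λ a b ga gb →
      affine-unique (fun φ x) φe≢0
        (trans (sym (on-line {fun φ} (additive φ) x a e)) (Allᵛ.head (supp _ ga)))
        (trans (sym (on-line {fun φ} (additive φ) x b e)) (Allᵛ.head (supp _ gb)))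
    suppH : ∀ x → H x ≢ 0 → Zeros Λ x
    suppH x Hx≢0 = let a , ga≢0 = sum-≢0 (λ c → G (x ⊕ c • e)) Hx≢0 in
      zeros-line Λ Λe x a (Allᵛ.tail (supp _ ga≢0))

  Cut : (V → Set) → ℕ → Set
  Cut U m = ∃[ c ] (c ℕ.≤ m × Σ (Vec (Form n) c) λ Λ → ∀ x → Zeros Λ x → U x)

  zeros? : ∀ {c} (Λ : Vec (Form n) c) x → Dec (Zeros Λ x)
  zeros? Λ x = Allᵛ.all? (λ φ → fun φ x Finₚ.≟ 0ᶠ) Λ

  -- This plays the role of the alternative "rank at most m or greater than m". A form `φ i` is
  -- adjoined as long as it is nonzero at some common zero of those already chosen: a search that
  -- gets stuck has found forms cutting out the set, and one that reaches m + 1 forms makes it thin.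
  cut-or-thin : ∀ {I} → Searchable I → (φ : I → Form n) → ∀ m →
                Cut (λ x → ∀ i → fun (φ i) x ≡ 0ᶠ) m ⊎ Thin (λ x → ∀ i → fun (φ i) x ≡ 0ᶠ) (suc m)
  cut-or-thin {I} search-I φ m = go (suc m) [] [] (λ _ _ → []) (ℕₚ.+-identityʳ (suc m))
    where
    U : V → Set
    U x = ∀ i → fun (φ i) x ≡ 0ᶠ
    go : ∀ k {c} (Λ : Vec (Form n) c) → Independent Λ → (∀ x → U x → Zeros Λ x) → k ℕ.+ c ≡ suc m →
         Cut U m ⊎ Thin U (suc m)
    go zero Λ ind sub refl = inj₂ λ G X G≤X supp → independent-thin Λ ind G X G≤X λ x Gx → sub x (supp x Gx)
    go (suc k) {c} Λ ind sub eq with search-× search-I search-V {P = λ ix → Zeros Λ (proj₂ ix) × fun (φ (proj₁ ix)) (proj₂ ix) ≢ 0ᶠ}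
        {Q = λ ix → Zeros Λ (proj₂ ix) → fun (φ (proj₁ ix)) (proj₂ ix) ≡ 0ᶠ} decide
      where
      decide : ∀ ix → (Zeros Λ (proj₂ ix) × fun (φ (proj₁ ix)) (proj₂ ix) ≢ 0ᶠ)
                    ⊎ (Zeros Λ (proj₂ ix) → fun (φ (proj₁ ix)) (proj₂ ix) ≡ 0ᶠ)
      decide (i , x) with zeros? Λ x | vanishing? (fun (φ i) x)
      ... | yes z | inj₁ ne = inj₁ (z , ne)
      ... | yes z | inj₂ eq = inj₂ λ _ → eq
      ... | no ¬z | _       = inj₂ λ z → ⊥-elim (¬z z)
    ... | inj₁ ((i , x) , z , ne) =
      go k (φ i ∷ Λ) (adjoin (φ i) x z ne ind) (λ y Uy → Uy i ∷ sub y Uy) (trans (ℕₚ.+-suc k c) eq)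
    ... | inj₂ all = inj₁ (c , subst (c ℕ.≤_) (ℕₚ.suc-injective eq) (ℕₚ.m≤n+m c k) , Λ , λ x z i → all (i , x) z)

  record Subspace : Set₁ where
    field
      mem   : V → Set
      mem-0 : mem 0ᵛ
      mem-⊕ : ∀ {x y} → mem x → mem y → mem (x ⊕ y)
      mem-• : ∀ a {x} → mem x → mem (a • x)
  open Subspace

  zeros-subspace : ∀ {c} → Vec (Form n) c → Subspace
  zeros-subspace Λ = record { mem = Zeros Λ ; mem-0 = zeros-0 Λ ; mem-⊕ = closed-⊕ Λ ; mem-• = λ a → closed-• a Λ }
    where
    zeros-0 : ∀ {c} (Λ : Vec (Form n) c) → Zeros Λ 0ᵛ
    zeros-0 []      = []
    zeros-0 (φ ∷ Λ) = additive-0 {φ = fun φ} (additive φ) ∷ zeros-0 Λ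
    closed-⊕ : ∀ {c} (Λ : Vec (Form n) c) {x y} → Zeros Λ x → Zeros Λ y → Zeros Λ (x ⊕ y)
    closed-⊕ []      []       []       = []
    closed-⊕ (φ ∷ Λ) {x} {y} (z ∷ zs) (w ∷ ws) =
      trans (additive φ x y) (trans (cong₂ _+ᶠ_ z w) (F.+-identityʳ 0ᶠ)) ∷ closed-⊕ Λ zs ws
    closed-• : ∀ {c} a (Λ : Vec (Form n) c) {x} → Zeros Λ x → Zeros Λ (a • x)
    closed-• a []      []       = []
    closed-• a (φ ∷ Λ) {x} (z ∷ zs) =
      trans (additive-• {φ = fun φ} (additive φ) a x) (trans (cong (a *ᶠ_) z) (F.zeroʳ a)) ∷ closed-• a Λ zs

  Q : ℕ
  Q = p ℕ.+ p ℕ.∸ 1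

  suc-Q : suc Q ≡ p ℕ.+ p
  suc-Q = ℕₚ.m+[n∸m]≡n {1} (ℕₚ.≤-trans (ℕ.>-nonZero⁻¹ p) (ℕₚ.m≤m+n p p))

  module _ {f : V → 𝔽} (cubic : Vanish 4 f) where

    open Cubic cubic

    T : V → V → V → 𝔽
    T = third f

    Kernel : V → V → Set
    Kernel y z = ∀ w → T y z w ≡ 0ᶠ

    -- The later u and v lie in the kernel of the earlier y; this triangularity
    -- makes the count in fibre-≤ an induction.
    data Chain (K : Subspace) : ℕ → Set₁ where
      []   : Chain K 0
      link : ∀ {t} y u v → mem K u → mem K v → T y u v ≢ 0ᶠ → (K′ : Subspace) →
             (∀ x → mem K′ x → mem K x × Kernel y x) → Chain K′ t → Chain K (suc t)

    -- The sum of G over the translate by (y₀ , z₀) of the span of the (yⱼ , 0) and (0 , uⱼ).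
    fibre : ∀ {K t} → Chain K t → (V → V → ℕ) → V → V → ℕ
    fibre []                      G y₀ z₀ = G y₀ z₀
    fibre (link y u v _ _ _ _ _ ch) G y₀ z₀ =
      sum λ b → fibre ch (λ y′ z′ → sum λ c → G (y′ ⊕ c • y) z′) y₀ (z₀ ⊕ b • u)

    -- For fixed b, either T y (z₀ ⊕ b • u) v = 0, which happens for one b only, or
    -- at most one c satisfies the condition given by v: 2p - 1 pairs (b , c) in all.
    fibre-≤ : ∀ {K t} (ch : Chain K t) (G : V → V → ℕ) X y₀ z₀ →
              (∀ y k → mem K k → G y (z₀ ⊕ k) ℕ.≤ X) →
              (∀ y z → G y z ≢ 0 → ∀ v → mem K v → T y z v ≡ 0ᶠ) →
              fibre ch G y₀ z₀ ℕ.≤ X ℕ.* Q ℕ.^ t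
    fibre-≤ {K} [] G X y₀ z₀ G≤X supp = begin
      G y₀ z₀           ≡⟨ cong (G y₀) (⊕-identityʳ z₀) ⟨
      G y₀ (z₀ ⊕ 0ᵛ)    ≤⟨ G≤X y₀ 0ᵛ (mem-0 K) ⟩
      X                 ≡⟨ ℕₚ.*-identityʳ X ⟨
      X ℕ.* 1           ∎
      where open ℕₚ.≤-Reasoning
    fibre-≤ {K} {suc t} (link y u v Ku Kv Tyuv K′ sub ch) G X y₀ z₀ G≤X supp =
      ℕₚ.+-cancelʳ-≤ Y _ _ (begin
        -- The one special `b` accounts for at most p Y and each of the p - 1 others for at most Y,
        -- together Q Y.
        sum h ℕ.+ Y
          ≤⟨ sum-exceptional h (λ b → T y (z₀ ⊕ b • u) v Finₚ.≟ 0ᶠ)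
               (λ a b ea eb → affine-unique (T y z₀ v) Tyuv (trans (sym (slice a)) ea) (trans (sym (slice b)) eb))
               (ℕₚ.m≤n*m Y p) special generic ⟩
        p ℕ.* Y ℕ.+ p ℕ.* Y
          ≡⟨ ℕₚ.*-distribʳ-+ Y p p ⟨
        (p ℕ.+ p) ℕ.* Y
          ≡⟨ cong (ℕ._* Y) suc-Q ⟨
        Y ℕ.+ Q ℕ.* Y
          ≡⟨ regroup X Q (Q ℕ.^ t) ⟩
        X ℕ.* (Q ℕ.* Q ℕ.^ t) ℕ.+ Y ∎)
      where
      open ℕₚ.≤-Reasoning
      regroup : ∀ x q r → x ℕ.* r ℕ.+ q ℕ.* (x ℕ.* r) ≡ x ℕ.* (q ℕ.* r) ℕ.+ x ℕ.* r
      regroup = ℕ-Solver.solve-∀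
      Y = X ℕ.* Q ℕ.^ t
      H : V → V → ℕ
      H y′ z′ = sum λ c → G (y′ ⊕ c • y) z′
      h : 𝔽 → ℕ
      h b = fibre ch H y₀ (z₀ ⊕ b • u)
      slice : ∀ b → T y (z₀ ⊕ b • u) v ≡ T y z₀ v +ᶠ b *ᶠ T y u v
      slice b = on-line {λ z → T y z v} (third-additive₂ y v) z₀ b u
      slice₁ : ∀ y′ z c v → T (y′ ⊕ c • y) z v ≡ T y′ z v +ᶠ c *ᶠ T y z v
      slice₁ y′ z c v = on-line {λ y → T y z v} (third-additive₁ z v) y′ c y
      -- For v in `K′` the condition T y′ z v = 0 is unaffected by moving y′ along y, because `K′`
      -- lies in the kernel of T y. Hence the line sums keep the conditions needed further down the
      -- chain.
      suppH : ∀ y′ z → H y′ z ≢ 0 → ∀ v → mem K′ v → T y′ z v ≡ 0ᶠ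
      suppH y′ z Hne v K′v =
        let c , Gne = sum-≢0 (λ c → G (y′ ⊕ c • y) z) Hne
            Kv , kerv = sub v K′v
        in trans (sym (on-line-0 {λ y → T y z v} (third-additive₁ z v) y′ c y
                        (trans (third-swap₂₃ y z v) (kerv z))))
                 (supp _ _ Gne v Kv)
      shift : ∀ b k → (z₀ ⊕ b • u) ⊕ k ≡ z₀ ⊕ (b • u ⊕ k)
      shift b k = ⊕-assoc z₀ (b • u) k
      G≤X′ : ∀ b y′ k → mem K′ k → G y′ ((z₀ ⊕ b • u) ⊕ k) ℕ.≤ X
      G≤X′ b y′ k K′k = subst (λ z → G y′ z ℕ.≤ X) (sym (shift b k))
        (G≤X y′ (b • u ⊕ k) (mem-⊕ K (mem-• K b Ku) (proj₁ (sub k K′k))))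
      special : ∀ b → T y (z₀ ⊕ b • u) v ≡ 0ᶠ → h b ℕ.≤ p ℕ.* Y
      special b _ = ℕₚ.≤-trans (fibre-≤ ch H (p ℕ.* X) y₀ (z₀ ⊕ b • u)
          (λ y′ k K′k → ℕₚ.≤-trans (sum-mono λ c → G≤X′ b (y′ ⊕ c • y) k K′k) (ℕₚ.≤-reflexive (sum-const p X)))
          suppH)
        (ℕₚ.≤-reflexive (ℕₚ.*-assoc p X (Q ℕ.^ t)))
      generic : ∀ b → T y (z₀ ⊕ b • u) v ≢ 0ᶠ → h b ℕ.≤ Y
      generic b ne = fibre-≤ ch H X y₀ (z₀ ⊕ b • u)
        (λ y′ k K′k → sum-unique (λ c → G (y′ ⊕ c • y) ((z₀ ⊕ b • u) ⊕ k)) X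
          (λ c → G≤X′ b (y′ ⊕ c • y) k K′k)
          λ c d Gc Gd → affine-unique (T y′ ((z₀ ⊕ b • u) ⊕ k) v) (ne ∘ trans (sym (invariant k K′k)))
            (trans (sym (slice₁ y′ _ c v)) (supp _ _ Gc v Kv))
            (trans (sym (slice₁ y′ _ d v)) (supp _ _ Gd v Kv)))
        suppH
        where
        -- Every z reached further down differs from `z₀ ⊕ b • u` by an element of `K′`. So the
        -- slope, in c, of the condition given by v is the same nonzero number on the whole inner
        -- fibre.
        invariant : ∀ k → mem K′ k → T y ((z₀ ⊕ b • u) ⊕ k) v ≡ T y (z₀ ⊕ b • u) v
        invariant k K′k = trans (third-additive₂ y v (z₀ ⊕ b • u) k)
          (trans (cong (T y (z₀ ⊕ b • u) v +ᶠ_) (proj₂ (sub k K′k) v)) (F.+-identityʳ (T y (z₀ ⊕ b • u) v)))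

    -- Each link averages along one line in either variable, and each average contributes a factor
    -- p.
    fibre-total : ∀ {K t} (ch : Chain K t) (G : V → V → ℕ) →
                  ∑ᵛ n (λ y → ∑ᵛ n (λ z → fibre ch G y z))
                  ≡ (p ℕ.^ t ℕ.* p ℕ.^ t) ℕ.* ∑ᵛ n (λ y → ∑ᵛ n (G y))
    fibre-total [] G = sym (ℕₚ.*-identityˡ _)
    fibre-total {t = suc t} (link y u v _ _ _ _ _ ch) G = begin
      ∑ᵛ n (λ y₀ → ∑ᵛ n λ z₀ → sum λ b → fibre ch H y₀ (z₀ ⊕ b • u))
        ≡⟨ ∑ᵛ-cong n (λ y₀ → ∑ᵛ-lines-ℕ n u (fibre ch H y₀)) ⟩
      ∑ᵛ n (λ y₀ → p ℕ.* ∑ᵛ n (fibre ch H y₀))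
        ≡⟨ pull (λ y₀ → ∑ᵛ n (fibre ch H y₀)) ⟩
      p ℕ.* ∑ᵛ n (λ y₀ → ∑ᵛ n (fibre ch H y₀))
        ≡⟨ cong (p ℕ.*_) (fibre-total ch H) ⟩
      p ℕ.* (pᵗ ℕ.* ∑ᵛ n (λ y′ → ∑ᵛ n λ z → sum λ c → G (y′ ⊕ c • y) z))
        ≡⟨ cong (λ s → p ℕ.* (pᵗ ℕ.* s)) (trans
             (∑ᵛ-cong n (λ y′ → sym (sum-∑ᵛ-comm n λ c z → G (y′ ⊕ c • y) z)))
             (∑ᵛ-lines-ℕ n y λ y′ → ∑ᵛ n (G y′))) ⟩
      p ℕ.* (pᵗ ℕ.* (p ℕ.* ∑ᵛ n (λ y → ∑ᵛ n (G y))))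
        ≡⟨ regroup p (p ℕ.^ t) _ ⟩
      (p ℕ.^ suc t ℕ.* p ℕ.^ suc t) ℕ.* ∑ᵛ n (λ y → ∑ᵛ n (G y)) ∎
      where
      open ≡-Reasoning
      H : V → V → ℕ
      H y′ z′ = sum λ c → G (y′ ⊕ c • y) z′
      pᵗ = p ℕ.^ t ℕ.* p ℕ.^ t
      regroup : ∀ p r s → p ℕ.* ((r ℕ.* r) ℕ.* (p ℕ.* s)) ≡ ((p ℕ.* r) ℕ.* (p ℕ.* r)) ℕ.* s
      regroup = ℕ-Solver.solve-∀
      pull : ∀ (g : V → ℕ) → ∑ᵛ n (λ x → p ℕ.* g x) ≡ p ℕ.* ∑ᵛ n g
      pull g = trans (∑ᵛ-cong n λ x → ℕₚ.*-comm p (g x)) (trans (sym (∑ᵛ-*ʳ n g p)) (ℕₚ.*-comm (∑ᵛ n g) p))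

    kernel? : ∀ y z → ∃ (λ w → T y z w ≢ 0ᶠ) ⊎ Kernel y z
    kernel? y z = search-V λ w → vanishing? (T y z w)

    indicator : ∀ {A B : Set} → A ⊎ B → ℕ
    indicator (inj₁ _) = 0
    indicator (inj₂ _) = 1

    indicator≤1 : ∀ {A B : Set} (d : A ⊎ B) → indicator d ℕ.≤ 1
    indicator≤1 (inj₁ _) = z≤n
    indicator≤1 (inj₂ _) = s≤s z≤n

    indicator≢0 : ∀ {A B : Set} (d : A ⊎ B) → indicator d ≢ 0 → B
    indicator≢0 (inj₁ _) ne = ⊥-elim (ne refl)
    indicator≢0 (inj₂ b) ne = b

    kernelSize : V → ℕ
    kernelSize y = ∑ᵛ n λ z → indicator (kernel? y z)

    kernelPairs : ℕ
    kernelPairs = ∑ᵛ n kernelSize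

    chain-bound : ∀ {K t} → Chain K t →
                  (p ℕ.^ t ℕ.* p ℕ.^ t) ℕ.* kernelPairs ℕ.≤ (p ℕ.^ n ℕ.* p ℕ.^ n) ℕ.* Q ℕ.^ t
    chain-bound {t = t} ch = begin
      (p ℕ.^ t ℕ.* p ℕ.^ t) ℕ.* kernelPairs
        ≡⟨ fibre-total ch G ⟨
      ∑ᵛ n (λ y → ∑ᵛ n (λ z → fibre ch G y z))
        ≤⟨ ∑ᵛ-mono n (λ y → ∑ᵛ-mono n λ z → fibre-≤ ch G 1 y z
             (λ y′ k _ → indicator≤1 (kernel? y′ (z ⊕ k)))
             (λ y′ z′ ne v _ → indicator≢0 (kernel? y′ z′) ne v)) ⟩
      ∑ᵛ n (λ y → ∑ᵛ n (λ z → 1 ℕ.* Q ℕ.^ t))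
        ≡⟨ ∑ᵛ-cong n (λ y → ∑ᵛ-const n (1 ℕ.* Q ℕ.^ t)) ⟩
      ∑ᵛ n (λ y → p ℕ.^ n ℕ.* (1 ℕ.* Q ℕ.^ t))
        ≡⟨ ∑ᵛ-const n _ ⟩
      p ℕ.^ n ℕ.* (p ℕ.^ n ℕ.* (1 ℕ.* Q ℕ.^ t))
        ≡⟨ regroup (p ℕ.^ n) (Q ℕ.^ t) ⟩
      (p ℕ.^ n ℕ.* p ℕ.^ n) ℕ.* Q ℕ.^ t ∎
      where
      open ℕₚ.≤-Reasoning
      regroup : ∀ a q → a ℕ.* (a ℕ.* (1 ℕ.* q)) ≡ (a ℕ.* a) ℕ.* q
      regroup = ℕ-Solver.solve-∀
      G : V → V → ℕ
      G y z = indicator (kernel? y z)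

    third-form₂ : V → V → Form n
    third-form₂ y w = record { fun = λ z → T y z w ; additive = third-additive₂ y w }

    -- The forms in y whose common zeros are W. Pairs (u, v) outside K receive the zero form, which
    -- imposes no condition, so that the index type is simply V × V and can be searched.
    restricted-form : ∀ {c} → Vec (Form n) c → V × V → Form n
    restricted-form Λ (u , v) with zeros? Λ u | zeros? Λ v
    ... | yes _ | yes _ = record { fun = λ y → T y u v ; additive = third-additive₁ u v }
    ... | _     | _     = record { fun = λ _ → 0ᶠ ; additive = λ _ _ → sym (F.+-identityʳ 0ᶠ) }

    restricted-form-zero : ∀ {c} (Λ : Vec (Form n) c) {u v} → Zeros Λ u → Zeros Λ v →
                           ∀ y → fun (restricted-form Λ (u , v)) y ≡ T y u v
    restricted-form-zero Λ {u} {v} Zu Zv y with zeros? Λ u | zeros? Λ v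
    ... | yes _ | yes _ = refl
    ... | no ¬u | _     = ⊥-elim (¬u Zu)
    ... | yes _ | no ¬v = ⊥-elim (¬v Zv)

    vanishing⇒restricted : ∀ {c} (Λ : Vec (Form n) c) y → (∀ u v → Zeros Λ u → Zeros Λ v → T y u v ≡ 0ᶠ) →
                           ∀ uv → fun (restricted-form Λ uv) y ≡ 0ᶠ
    vanishing⇒restricted Λ y van (u , v) with zeros? Λ u | zeros? Λ v
    ... | yes Zu | yes Zv = van u v Zu Zv
    ... | no  _  | _      = refl
    ... | yes _  | no  _  = refl

    module _ (m : ℕ) where

      Terminal : ∀ {c} → Vec (Form n) c → Set
      Terminal Λ = ∀ y → Thin (Kernel y) (suc m) ⊎ (∀ u v → Zeros Λ u → Zeros Λ v → T y u v ≡ 0ᶠ)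

      -- `t` is the number of steps still allowed. If all of them succeed, the recorded vectors are
      -- a chain of length t; each step adds at most m forms to the list.
      greedy : ∀ t {c} (Λ : Vec (Form n) c) →
               Chain (zeros-subspace Λ) t ⊎ ∃[ c′ ] (c′ ℕ.≤ t ℕ.* m ℕ.+ c × Σ (Vec (Form n) c′) Terminal)
      greedy zero    Λ = inj₁ []
      greedy (suc t) {c} Λ with search-V extend?
        where
        Extend : V → Set
        Extend y = Cut (Kernel y) m × ∃[ uv ] (Zeros Λ (proj₁ uv) × Zeros Λ (proj₂ uv) × T y (proj₁ uv) (proj₂ uv) ≢ 0ᶠ)
        extend? : ∀ y → Extend y ⊎ (Thin (Kernel y) (suc m) ⊎ (∀ u v → Zeros Λ u → Zeros Λ v → T y u v ≡ 0ᶠ))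
        extend? y with cut-or-thin search-V (third-form₂ y) m
        ... | inj₂ thin = inj₂ (inj₁ thin)
        ... | inj₁ cut with search-× search-V search-V
                {P = λ uv → Zeros Λ (proj₁ uv) × Zeros Λ (proj₂ uv) × T y (proj₁ uv) (proj₂ uv) ≢ 0ᶠ}
                {Q = λ uv → Zeros Λ (proj₁ uv) → Zeros Λ (proj₂ uv) → T y (proj₁ uv) (proj₂ uv) ≡ 0ᶠ} decide
          where
          decide : ∀ uv → (Zeros Λ (proj₁ uv) × Zeros Λ (proj₂ uv) × T y (proj₁ uv) (proj₂ uv) ≢ 0ᶠ)
                        ⊎ (Zeros Λ (proj₁ uv) → Zeros Λ (proj₂ uv) → T y (proj₁ uv) (proj₂ uv) ≡ 0ᶠ)
          decide (u , v) with zeros? Λ u | zeros? Λ v | vanishing? (T y u v)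
          ... | yes Zu | yes Zv | inj₁ ne = inj₁ (Zu , Zv , ne)
          ... | yes Zu | yes Zv | inj₂ eq = inj₂ λ _ _ → eq
          ... | no ¬Zu | _      | _       = inj₂ λ Zu → ⊥-elim (¬Zu Zu)
          ... | yes _  | no ¬Zv | _       = inj₂ λ _ Zv → ⊥-elim (¬Zv Zv)
        ...   | inj₁ found = inj₁ (cut , found)
        ...   | inj₂ none  = inj₂ (inj₂ λ u v → none (u , v))
      ... | inj₂ terminal = inj₂ (c , ℕₚ.m≤n+m c (suc t ℕ.* m) , Λ , terminal)
      ... | inj₁ (y , (k , k≤m , M , M⊂) , (u , v) , Zu , Zv , ne) with greedy t (M Vec.++ Λ)
      ...   | inj₁ ch = inj₁ (link y u v Zu Zv ne (zeros-subspace (M Vec.++ Λ))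
                (λ x Zx → Allᵛₚ.++ʳ⁻ M Zx , M⊂ x (Allᵛₚ.++ˡ⁻ M Zx)) ch)
      ...   | inj₂ (c′ , c′≤ , Λ′ , terminal) = inj₂ (c′ , ℕₚ.≤-trans c′≤ (begin
                t ℕ.* m ℕ.+ (k ℕ.+ c)     ≤⟨ ℕₚ.+-monoʳ-≤ (t ℕ.* m) (ℕₚ.+-monoˡ-≤ c k≤m) ⟩
                t ℕ.* m ℕ.+ (m ℕ.+ c)     ≡⟨ regroup (t ℕ.* m) m c ⟩
                suc t ℕ.* m ℕ.+ c         ∎) , Λ′ , terminal)
        where
        open ℕₚ.≤-Reasoning
        regroup : ∀ a m c → a ℕ.+ (m ℕ.+ c) ≡ (m ℕ.+ a) ℕ.+ c
        regroup = ℕ-Solver.solve-∀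

      -- Multiplied by pᵐ⁺¹, the kernel of a y of the first kind counts at most pⁿ. The other y lie
      -- in W, and thinness of W is applied to the kernel sizes as weights, bounded by X = pⁿ. Each
      -- kind thus contributes at most p²ⁿ.
      terminal-thin : ∀ {c} (Λ : Vec (Form n) c) → Terminal Λ →
                      Thin (λ y → ∀ uv → fun (restricted-form Λ uv) y ≡ 0ᶠ) (suc m) →
                      kernelPairs ℕ.* p ℕ.^ suc m ℕ.≤ 2 ℕ.* (p ℕ.^ n ℕ.* p ℕ.^ n)
      terminal-thin Λ terminal thin = begin
        kernelPairs ℕ.* pᵐ
          ≡⟨ ∑ᵛ-*ʳ n kernelSize pᵐ ⟩
        ∑ᵛ n (λ y → kernelSize y ℕ.* pᵐ)
          ≤⟨ ∑ᵛ-mono n split ⟩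
        ∑ᵛ n (λ y → G y ℕ.* pᵐ ℕ.+ pⁿ)
          ≡⟨ ∑ᵛ-+ n (λ y → G y ℕ.* pᵐ) (λ _ → pⁿ) ⟩
        ∑ᵛ n (λ y → G y ℕ.* pᵐ) ℕ.+ ∑ᵛ n (λ _ → pⁿ)
          ≡⟨ cong₂ ℕ._+_ (sym (∑ᵛ-*ʳ n G pᵐ)) (∑ᵛ-const n pⁿ) ⟩
        ∑ᵛ n G ℕ.* pᵐ ℕ.+ pⁿ ℕ.* pⁿ
          ≤⟨ ℕₚ.+-monoˡ-≤ (pⁿ ℕ.* pⁿ) (thin G pⁿ G≤ suppG) ⟩
        pⁿ ℕ.* pⁿ ℕ.+ pⁿ ℕ.* pⁿ
          ≡⟨ cong (pⁿ ℕ.* pⁿ ℕ.+_) (ℕₚ.+-identityʳ (pⁿ ℕ.* pⁿ)) ⟨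
        2 ℕ.* (pⁿ ℕ.* pⁿ) ∎
        where
        open ℕₚ.≤-Reasoning
        pᵐ = p ℕ.^ suc m
        pⁿ = p ℕ.^ n
        size≤ : ∀ y → kernelSize y ℕ.≤ pⁿ
        size≤ y = ℕₚ.≤-trans (∑ᵛ-mono n λ z → indicator≤1 (kernel? y z))
          (ℕₚ.≤-reflexive (trans (∑ᵛ-const n 1) (ℕₚ.*-identityʳ pⁿ)))
        weight : ∀ {A B : Set} → A ⊎ B → ℕ → ℕ
        weight (inj₁ _) k = 0
        weight (inj₂ _) k = k
        G : V → ℕ
        G y = weight (terminal y) (kernelSize y)
        G≤ : ∀ y → G y ℕ.≤ pⁿ
        G≤ y with terminal y
        ... | inj₁ _ = z≤n
        ... | inj₂ _ = size≤ y
        suppG : ∀ y → G y ≢ 0 → ∀ uv → fun (restricted-form Λ uv) y ≡ 0ᶠ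
        suppG y ne with terminal y
        ... | inj₁ _    = ⊥-elim (ne refl)
        ... | inj₂ van = vanishing⇒restricted Λ y van
        split : ∀ y → kernelSize y ℕ.* pᵐ ℕ.≤ G y ℕ.* pᵐ ℕ.+ pⁿ
        split y with terminal y
        ... | inj₂ _    = ℕₚ.m≤m+n _ pⁿ
        ... | inj₁ thin = ℕₚ.≤-trans
          (thin (λ z → indicator (kernel? y z)) 1 (λ z → indicator≤1 (kernel? y z)) (λ z → indicator≢0 (kernel? y z)))
          (ℕₚ.≤-reflexive (ℕₚ.*-identityˡ pⁿ))

      structure : 2 ℕ.* (p ℕ.^ n ℕ.* p ℕ.^ n) ℕ.< kernelPairs ℕ.* p ℕ.^ suc m →
                  (p ℕ.^ n ℕ.* p ℕ.^ n) ℕ.* Q ℕ.^ m ℕ.< (p ℕ.^ m ℕ.* p ℕ.^ m) ℕ.* kernelPairs →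
                  ∃[ c ] (c ℕ.≤ m ℕ.* m ℕ.+ m × Decomposed c f)
      structure large no-chain with greedy m []
      ... | inj₁ ch = ⊥-elim (ℕₚ.<⇒≱ no-chain (chain-bound ch))
      ... | inj₂ (c , c≤ , Λ , terminal) with cut-or-thin (search-× search-V search-V) (restricted-form Λ) m
      ...   | inj₂ thin = ⊥-elim (ℕₚ.<⇒≱ large (terminal-thin Λ terminal thin))
      ...   | inj₁ (k , k≤m , M , M⊂) = k ℕ.+ c ,
              ℕₚ.≤-trans (ℕₚ.+-mono-≤ k≤m c≤) (ℕₚ.≤-reflexive (regroup m (m ℕ.* m))) ,
              decompose pr (M Vec.++ Λ) cubic λ x y z Zx Zy Zz →
                trans (sym (restricted-form-zero Λ (Allᵛₚ.++ʳ⁻ M Zy) (Allᵛₚ.++ʳ⁻ M Zz) x))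
                  (M⊂ x (Allᵛₚ.++ˡ⁻ M Zx) (y , z))
        where
        regroup : ∀ m s → m ℕ.+ (s ℕ.+ 0) ≡ s ℕ.+ m
        regroup = ℕ-Solver.solve-∀

    -- A chain of length one, from the whole space to the zero space. It bounds β away from 1
    -- uniformly in n as soon as T is not zero.
    nonzero-bound : ∀ y u v → T y u v ≢ 0ᶠ → (p ℕ.* p) ℕ.* kernelPairs ℕ.≤ (p ℕ.^ n ℕ.* p ℕ.^ n) ℕ.* Q
    nonzero-bound y u v ne = subst₂ (λ a b → (a ℕ.* a) ℕ.* kernelPairs ℕ.≤ (p ℕ.^ n ℕ.* p ℕ.^ n) ℕ.* b)
      (ℕₚ.*-identityʳ p) (ℕₚ.*-identityʳ Q) (chain-bound (link {K = everything} y u v _ _ ne origin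
        (λ x x≡0 → _ , λ w → trans (cong (λ x → T y x w) x≡0) (additive-0 {φ = λ x → T y x w} (third-additive₂ y w))) []))
      where
      everything origin : Subspace
      everything = record { mem = λ _ → ⊤ }
      origin = record
        { mem = _≡ 0ᵛ ; mem-0 = refl
        ; mem-⊕ = λ e e′ → trans (cong₂ _⊕_ e e′) (⊕-identityʳ 0ᵛ)
        ; mem-• = λ a e → trans (cong (a •_) e) (•-zeroʳ a) }

-- Rationals, Gaussian rationals and null sequences.

open import Data.Rational hiding (NonZero)
open import Data.Rational.Properties
open import Data.Rational.Solver using (module +-*-Solver)
open import Relation.Binary.PropositionalEquality hiding (J)

open Estimates
open +-*-Solver using (solve; con; :-_; _:+_; _:*_; _:-_; _:=_)

+-cancelʳ-≤ : ∀ c {a b} → a + c ≤ b + c → a ≤ b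
+-cancelʳ-≤ c {a} {b} le = subst₂ _≤_ (undo a) (undo b) (+-monoˡ-≤ (- c) le)
  where
  undo : ∀ a → a + c + - c ≡ a
  undo a = solve 2 (λ a c → a :+ c :+ :- c := a) refl a c

0≤1- : ∀ {x} → x ≤ 1ℚ → 0ℚ ≤ 1ℚ - x
0≤1- {x} x≤1 = subst (_≤ 1ℚ - x) (+-inverseʳ x) (+-monoˡ-≤ (- x) x≤1)

p≤∣p∣ : ∀ q → q ≤ ∣ q ∣
p≤∣p∣ q with ≤-total 0ℚ q
... | inj₁ 0≤q = ≤-reflexive (sym (0≤p⇒∣p∣≡p 0≤q))
... | inj₂ q≤0 = ≤-trans q≤0 (0≤∣p∣ q)

square≥0 : ∀ q → 0ℚ ≤ q * q
square≥0 q with ∣p∣≡p∨∣p∣≡-p q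
... | inj₁ e = subst (λ a → 0ℚ ≤ a * a) e (*-nonneg (0≤∣p∣ q) (0≤∣p∣ q))
... | inj₂ e = subst (0ℚ ≤_) (trans (cong₂ _*_ e e) (solve 1 (λ a → :- a :* :- a := a :* a) refl q))
                 (*-nonneg (0≤∣p∣ q) (0≤∣p∣ q))

infixl 6 _+ᴳ_ _⊖ᴳ_
infixl 7 _*ᴳ_
infix  8 -ᴳ_

-- The rational approximations to a complex number are Gaussian rationals.
record ℚ[i] : Set where
  constructor _,ᴳ_
  field
    reᴳ imᴳ : ℚ
open ℚ[i] public

0ᴳ 1ᴳ : ℚ[i]
0ᴳ = 0ℚ ,ᴳ 0ℚ
1ᴳ = 1ℚ ,ᴳ 0ℚ

_+ᴳ_ _*ᴳ_ _⊖ᴳ_ : ℚ[i] → ℚ[i] → ℚ[i]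
(a ,ᴳ b) +ᴳ (c ,ᴳ d) = (a + c) ,ᴳ (b + d)
(a ,ᴳ b) *ᴳ (c ,ᴳ d) = (a * c + - (b * d)) ,ᴳ (a * d + b * c)

-ᴳ_ : ℚ[i] → ℚ[i]
-ᴳ (a ,ᴳ b) = (- a) ,ᴳ (- b)

z ⊖ᴳ w = z +ᴳ -ᴳ w

realᴳ : ℚ → ℚ[i]
realᴳ q = q ,ᴳ 0ℚ

conj : ℚ[i] → ℚ[i]
conj (a ,ᴳ b) = a ,ᴳ (- b)

ℚ[i]-commutativeRing : CommutativeRing _ _
ℚ[i]-commutativeRing = record
  { Carrier = ℚ[i] ; _≈_ = _≡_ ; _+_ = _+ᴳ_ ; _*_ = _*ᴳ_ ; -_ = -ᴳ_ ; 0# = 0ᴳ ; 1# = 1ᴳ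
  ; isCommutativeRing = record
    { isRing = record
      { +-isAbelianGroup = record
        { isGroup = record
          { isMonoid = record
            { isSemigroup = record { isMagma = isMagma _+ᴳ_ ; assoc = +-assocᴳ }
            ; identity = (λ z → trans (+-commᴳ 0ᴳ z) (+-identityʳᴳ z)) , +-identityʳᴳ }
          ; inverse = (λ z → trans (+-commᴳ (-ᴳ z) z) (-‿inverseʳᴳ z)) , -‿inverseʳᴳ
          ; ⁻¹-cong = cong -ᴳ_ }
        ; comm = +-commᴳ }
      ; *-cong = cong₂ _*ᴳ_
      ; *-assoc = *-assocᴳ
      ; *-identity = (λ z → trans (*-commᴳ 1ᴳ z) (*-identityʳᴳ z)) , *-identityʳᴳ
      ; distrib = distribˡᴳ , λ z u w → trans (*-commᴳ (u +ᴳ w) z)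
          (trans (distribˡᴳ z u w) (cong₂ _+ᴳ_ (*-commᴳ z u) (*-commᴳ z w))) }
    ; *-comm = *-commᴳ } }
  where
  +-assocᴳ : ∀ z u w → (z +ᴳ u) +ᴳ w ≡ z +ᴳ (u +ᴳ w)
  +-assocᴳ (a ,ᴳ b) (c ,ᴳ d) (e ,ᴳ f) = cong₂ _,ᴳ_ (+-assoc a c e) (+-assoc b d f)
  +-commᴳ : ∀ z u → z +ᴳ u ≡ u +ᴳ z
  +-commᴳ (a ,ᴳ b) (c ,ᴳ d) = cong₂ _,ᴳ_ (+-comm a c) (+-comm b d)
  +-identityʳᴳ : ∀ z → z +ᴳ 0ᴳ ≡ z
  +-identityʳᴳ (a ,ᴳ b) = cong₂ _,ᴳ_ (+-identityʳ a) (+-identityʳ b)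
  -‿inverseʳᴳ : ∀ z → z +ᴳ -ᴳ z ≡ 0ᴳ
  -‿inverseʳᴳ (a ,ᴳ b) = cong₂ _,ᴳ_ (+-inverseʳ a) (+-inverseʳ b)
  *-commᴳ : ∀ z u → z *ᴳ u ≡ u *ᴳ z
  *-commᴳ (a ,ᴳ b) (c ,ᴳ d) = cong₂ _,ᴳ_
    (solve 4 (λ a b c d → a :* c :+ :- (b :* d) := c :* a :+ :- (d :* b)) refl a b c d)
    (solve 4 (λ a b c d → a :* d :+ b :* c := c :* b :+ d :* a) refl a b c d)
  *-identityʳᴳ : ∀ z → z *ᴳ 1ᴳ ≡ z
  *-identityʳᴳ (a ,ᴳ b) = cong₂ _,ᴳ_
    (solve 2 (λ a b → a :* con 1ℚ :+ :- (b :* con 0ℚ) := a) refl a b)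
    (solve 2 (λ a b → a :* con 0ℚ :+ b :* con 1ℚ := b) refl a b)
  *-assocᴳ : ∀ z u w → (z *ᴳ u) *ᴳ w ≡ z *ᴳ (u *ᴳ w)
  *-assocᴳ (a ,ᴳ b) (c ,ᴳ d) (e ,ᴳ f) = cong₂ _,ᴳ_
    (solve 6 (λ a b c d e f → (a :* c :+ :- (b :* d)) :* e :+ :- ((a :* d :+ b :* c) :* f)
      := a :* (c :* e :+ :- (d :* f)) :+ :- (b :* (c :* f :+ d :* e))) refl a b c d e f)
    (solve 6 (λ a b c d e f → (a :* c :+ :- (b :* d)) :* f :+ (a :* d :+ b :* c) :* e
      := a :* (c :* f :+ d :* e) :+ b :* (c :* e :+ :- (d :* f))) refl a b c d e f)
  distribˡᴳ : ∀ z u w → z *ᴳ (u +ᴳ w) ≡ z *ᴳ u +ᴳ z *ᴳ w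
  distribˡᴳ (a ,ᴳ b) (c ,ᴳ d) (e ,ᴳ f) = cong₂ _,ᴳ_
    (solve 6 (λ a b c d e f → a :* (c :+ e) :+ :- (b :* (d :+ f))
      := (a :* c :+ :- (b :* d)) :+ (a :* e :+ :- (b :* f))) refl a b c d e f)
    (solve 6 (λ a b c d e f → a :* (d :+ f) :+ b :* (c :+ e)
      := (a :* d :+ b :* c) :+ (a :* f :+ b :* e)) refl a b c d e f)

module G = CommutativeRing ℚ[i]-commutativeRing
module G-Solver = DifferenceSolver ℚ[i]-commutativeRing
open G-Solver using () renaming (solve to solveᴳ; _:+_ to _⊞_; _:*_ to _⊠_; :-_ to ⊟_; _:=_ to _⩵_; :0 to 𝟘; :1 to 𝟙)

-- The ℓ¹ norm: unlike the modulus it is rational, and it is still submultiplicative.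
‖_‖ : ℚ[i] → ℚ
‖ a ,ᴳ b ‖ = ∣ a ∣ + ∣ b ∣

0≤‖_‖ : ∀ z → 0ℚ ≤ ‖ z ‖
0≤‖ a ,ᴳ b ‖ = +-nonneg (0≤∣p∣ a) (0≤∣p∣ b)

‖+‖ : ∀ z w → ‖ z +ᴳ w ‖ ≤ ‖ z ‖ + ‖ w ‖
‖+‖ (a ,ᴳ b) (c ,ᴳ d) = begin
  ∣ a + c ∣ + ∣ b + d ∣                      ≤⟨ +-mono-≤ (∣p+q∣≤∣p∣+∣q∣ a c) (∣p+q∣≤∣p∣+∣q∣ b d) ⟩
  (∣ a ∣ + ∣ c ∣) + (∣ b ∣ + ∣ d ∣)          ≡⟨ solve 4 (λ a b c d → (a :+ c) :+ (b :+ d) := (a :+ b) :+ (c :+ d)) refl (∣ a ∣) (∣ b ∣) (∣ c ∣) (∣ d ∣) ⟩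
  (∣ a ∣ + ∣ b ∣) + (∣ c ∣ + ∣ d ∣)          ∎
  where open ≤-Reasoning

‖-‖ : ∀ z → ‖ -ᴳ z ‖ ≡ ‖ z ‖
‖-‖ (a ,ᴳ b) = cong₂ _+_ (∣-p∣≡∣p∣ a) (∣-p∣≡∣p∣ b)

‖*‖ : ∀ z w → ‖ z *ᴳ w ‖ ≤ ‖ z ‖ * ‖ w ‖
‖*‖ (a ,ᴳ b) (c ,ᴳ d) = begin
  ∣ a * c + - (b * d) ∣ + ∣ a * d + b * c ∣
    ≤⟨ +-mono-≤ (∣p+q∣≤∣p∣+∣q∣ (a * c) (- (b * d))) (∣p+q∣≤∣p∣+∣q∣ (a * d) (b * c)) ⟩
  (∣ a * c ∣ + ∣ - (b * d) ∣) + (∣ a * d ∣ + ∣ b * c ∣)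
    ≡⟨ cong₂ _+_ (cong₂ _+_ (∣p*q∣≡∣p∣*∣q∣ a c) (trans (∣-p∣≡∣p∣ (b * d)) (∣p*q∣≡∣p∣*∣q∣ b d)))
                 (cong₂ _+_ (∣p*q∣≡∣p∣*∣q∣ a d) (∣p*q∣≡∣p∣*∣q∣ b c)) ⟩
  (∣ a ∣ * ∣ c ∣ + ∣ b ∣ * ∣ d ∣) + (∣ a ∣ * ∣ d ∣ + ∣ b ∣ * ∣ c ∣)
    ≡⟨ solve 4 (λ a b c d → (a :* c :+ b :* d) :+ (a :* d :+ b :* c) := (a :+ b) :* (c :+ d)) refl (∣ a ∣) (∣ b ∣) (∣ c ∣) (∣ d ∣) ⟩
  (∣ a ∣ + ∣ b ∣) * (∣ c ∣ + ∣ d ∣) ∎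
  where open ≤-Reasoning

‖real*‖ : ∀ q z → 0ℚ ≤ q → ‖ realᴳ q *ᴳ z ‖ ≡ q * ‖ z ‖
‖real*‖ q (a ,ᴳ b) 0≤q = begin
  ∣ q * a + - (0ℚ * b) ∣ + ∣ q * b + 0ℚ * a ∣
    ≡⟨ cong₂ _+_ (cong ∣_∣ (solve 3 (λ q a b → q :* a :+ :- (con 0ℚ :* b) := q :* a) refl q a b))
                 (cong ∣_∣ (solve 3 (λ q a b → q :* b :+ con 0ℚ :* a := q :* b) refl q a b)) ⟩
  ∣ q * a ∣ + ∣ q * b ∣
    ≡⟨ cong₂ _+_ (trans (∣p*q∣≡∣p∣*∣q∣ q a) (cong (_* ∣ a ∣) (0≤p⇒∣p∣≡p 0≤q)))
                 (trans (∣p*q∣≡∣p∣*∣q∣ q b) (cong (_* ∣ b ∣) (0≤p⇒∣p∣≡p 0≤q))) ⟩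
  q * ∣ a ∣ + q * ∣ b ∣
    ≡⟨ *-distribˡ-+ q (∣ a ∣) (∣ b ∣) ⟨
  q * (∣ a ∣ + ∣ b ∣) ∎
  where open ≡-Reasoning

∣re∣≤ : ∀ z → ∣ reᴳ z ∣ ≤ ‖ z ‖
∣re∣≤ (a ,ᴳ b) = ≤-+ʳ (∣ a ∣) (0≤∣p∣ b)

-- Used for sequences of nonnegative rationals: convergence to 0.
Null : (ℕ → ℚ) → Set
Null u = ∀ ε → 0ℚ < ε → ∃[ N ] (∀ n → N ℕ.≤ n → u n ≤ ε)

null-≤ : ∀ {u v} N → (∀ n → N ℕ.≤ n → u n ≤ v n) → Null v → Null u
null-≤ N u≤v nv ε 0<ε = let M , c = nv ε 0<ε in N ℕ.⊔ M , λ n n≥ →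
  ≤-trans (u≤v n (ℕₚ.m⊔n≤o⇒m≤o N M n≥)) (c n (ℕₚ.m⊔n≤o⇒n≤o N M n≥))

null-+ : ∀ {u v} → Null u → Null v → Null (λ n → u n + v n)
null-+ nu nv ε 0<ε =
  let N , c = nu (½ * ε) (*-pos 0<½ 0<ε)
      M , d = nv (½ * ε) (*-pos 0<½ 0<ε)
  in N ℕ.⊔ M , λ n n≥ → ≤-trans
    (+-mono-≤ (c n (ℕₚ.m⊔n≤o⇒m≤o N M n≥)) (d n (ℕₚ.m⊔n≤o⇒n≤o N M n≥)))
    (≤-reflexive (½+½ ε))

null-* : ∀ {u} B → 0ℚ ≤ B → Null u → Null (λ n → B * u n)
null-* B 0≤B nu ε 0<ε =
  let η , 0<η , le = shrink B 0≤B ε 0<ε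
      N , c = nu η 0<η
  in N , λ n n≥ → ≤-trans (*-monoˡ-≤-nonNeg B {{nonNegative 0≤B}} (c n n≥)) le

null-cancel : ∀ {u} κ → 0ℚ < κ → Null (λ n → κ * u n) → Null u
null-cancel κ 0<κ nu ε 0<ε = let N , c = nu (κ * ε) (*-pos 0<κ 0<ε) in
  N , λ n n≥ → *-cancelˡ-≤-pos κ {{positive 0<κ}} (c n n≥)

½^-anti : ∀ {m n} → m ℕ.≤ n → ½ ^ n ≤ ½ ^ m
½^-anti {m} {n} m≤n = subst (λ k → ½ ^ k ≤ ½ ^ m) (ℕₚ.m∸n+n≡m m≤n) (go (n ℕ.∸ m))
  where
  go : ∀ j → ½ ^ (j ℕ.+ m) ≤ ½ ^ m
  go zero    = ≤-refl
  go (suc j) = ≤-trans (≤-trans (*-monoʳ-≤-nonNeg (½ ^ (j ℕ.+ m)) {{nonNegative (0≤½^ (j ℕ.+ m))}} ½≤1)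
    (≤-reflexive (*-identityˡ _))) (go j)
    where
    ½≤1 : ½ ≤ 1ℚ
    ½≤1 = subst (½ ≤_) refl (≤-+ʳ ½ (<⇒≤ 0<½))

null-½^ : Null (½ ^_)
null-½^ ε 0<ε = let N , le = ½^-tends ε 0<ε in N , λ n n≥ → ≤-trans (½^-anti n≥) le

infix 4 _≈₀_

record _≈₀_ (z w : ℕ → ℚ[i]) : Set where
  constructor ≈₀-intro
  field
    ≈₀-null : Null λ n → ‖ z n ⊖ᴳ w n ‖
open _≈₀_ public

Bounded : (ℕ → ℚ[i]) → Set
Bounded z = ∃[ B ] (0ℚ ≤ B × ∀ n → ‖ z n ‖ ≤ B)

≈₀-trans : ∀ {z w v} → z ≈₀ w → w ≈₀ v → z ≈₀ v
≈₀-trans {z} {w} {v} (≈₀-intro zw) (≈₀-intro wv) = ≈₀-intro (null-≤ 0 (λ n _ → subst (λ t → ‖ t ‖ ≤ ‖ z n ⊖ᴳ w n ‖ + ‖ w n ⊖ᴳ v n ‖)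
    (solveᴳ 3 (λ z w v → (z ⊞ ⊟ w) ⊞ (w ⊞ ⊟ v)
      ⩵ z ⊞ ⊟ v) refl (z n) (w n) (v n))
    (‖+‖ (z n ⊖ᴳ w n) (w n ⊖ᴳ v n)))
  (null-+ zw wv))

≈₀-sym : ∀ {z w} → z ≈₀ w → w ≈₀ z
≈₀-sym {z} {w} (≈₀-intro zw) = ≈₀-intro (null-≤ 0 (λ n _ → ≤-reflexive (trans
    (cong ‖_‖ (solveᴳ 2 (λ z w → w ⊞ ⊟ z
      ⩵ ⊟ (z ⊞ ⊟ w)) refl (z n) (w n)))
    (‖-‖ (z n ⊖ᴳ w n)))) zw)

≈₀-*ˡ : ∀ {z w} v → Bounded v → z ≈₀ w → (λ n → v n *ᴳ z n) ≈₀ (λ n → v n *ᴳ w n)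
≈₀-*ˡ {z} {w} v (B , 0≤B , v≤B) (≈₀-intro zw) = ≈₀-intro (null-≤ 0 (λ n _ → begin
    ‖ v n *ᴳ z n ⊖ᴳ v n *ᴳ w n ‖
      ≡⟨ cong ‖_‖ (solveᴳ 3 (λ v z w → v ⊠ z ⊞ ⊟ (v ⊠ w)
           ⩵ v ⊠ (z ⊞ ⊟ w)) refl (v n) (z n) (w n)) ⟩
    ‖ v n *ᴳ (z n ⊖ᴳ w n) ‖
      ≤⟨ ‖*‖ (v n) (z n ⊖ᴳ w n) ⟩
    ‖ v n ‖ * ‖ z n ⊖ᴳ w n ‖
      ≤⟨ *-monoʳ-≤-nonNeg (‖ z n ⊖ᴳ w n ‖) {{nonNegative (0≤‖ z n ⊖ᴳ w n ‖)}} (v≤B n) ⟩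
    B * ‖ z n ⊖ᴳ w n ‖ ∎)
  (null-* B 0≤B zw))
  where open ≤-Reasoning

-- Cauchy products and formal derivatives.

psum : (ℕ → ℚ[i]) → ℕ → ℚ[i]
psum a zero    = 0ᴳ
psum a (suc n) = psum a n +ᴳ a n

-- The coefficient of the Cauchy product, the sum of a i · b j over i + j = m.
conv : (ℕ → ℚ[i]) → (ℕ → ℚ[i]) → ℕ → ℚ[i]
conv a b zero    = a 0 *ᴳ b 0
conv a b (suc m) = a 0 *ᴳ b (suc m) +ᴳ conv (λ j → a (suc j)) b m

module Convolution where
  psum-front : ∀ a n → psum a (suc n) ≡ a 0 +ᴳ psum (λ j → a (suc j)) n
  psum-front a zero    = solveᴳ 1 (λ x → 𝟘 ⊞ x ⩵ x ⊞ 𝟘) refl (a 0)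
  psum-front a (suc n) = trans (cong (_+ᴳ a (suc n)) (psum-front a n))
    (G.+-assoc (a 0) (psum (λ j → a (suc j)) n) (a (suc n)))

  psum-conv : ∀ a b n → psum (conv a b) (suc n) ≡ a 0 *ᴳ psum b (suc n) +ᴳ psum (conv (λ j → a (suc j)) b) n
  psum-conv a b zero    = solveᴳ 2 (λ x y → 𝟘 ⊞ x ⊠ y ⩵ x ⊠ (𝟘 ⊞ y) ⊞ 𝟘) refl (a 0) (b 0)
  psum-conv a b (suc n) = trans (cong (_+ᴳ conv a b (suc n)) (psum-conv a b n))
    (solveᴳ 5 (λ x s t y c → (x ⊠ s ⊞ t) ⊞ (x ⊠ y ⊞ c) ⩵ x ⊠ (s ⊞ y) ⊞ (t ⊞ c)) refl
      (a 0) (psum b (suc n)) (psum (conv (λ j → a (suc j)) b) n) (b (suc n)) (conv (λ j → a (suc j)) b n))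

  remainder : (ℕ → ℚ[i]) → (ℕ → ℚ[i]) → ℕ → ℚ[i]
  remainder a b n = psum a n *ᴳ psum b n ⊖ᴳ psum (conv a b) n

  remainder-suc : ∀ a b n → remainder a b (suc n)
                ≡ psum (λ j → a (suc j)) n *ᴳ b n +ᴳ remainder (λ j → a (suc j)) b n
  remainder-suc a b n = trans
    (cong₂ (λ s t → s *ᴳ psum b (suc n) ⊖ᴳ t) (psum-front a n) (psum-conv a b n))
    (solveᴳ 5 (λ x s t y c → (x ⊞ s) ⊠ (t ⊞ y) ⊞ ⊟ (x ⊠ (t ⊞ y) ⊞ c) ⩵ s ⊠ y ⊞ (s ⊠ t ⊞ ⊟ c)) refl
      (a 0) (psum (λ j → a (suc j)) n) (psum b n) (b n) (psum (conv (λ j → a (suc j)) b) n))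

  -- The summand (D + D) ½ⁿ stands for the geometric tail still to come; carrying it along makes the
  -- induction close.
  psum-bound : ∀ a D → (∀ j → ‖ a j ‖ ≤ D * ½ ^ j) → ∀ n → ‖ psum a n ‖ + (D + D) * ½ ^ n ≤ D + D
  psum-bound a D a≤ zero    = ≤-reflexive (solve 1 (λ d → con 0ℚ :+ (d :+ d) :* con 1ℚ := d :+ d) refl D)
  psum-bound a D a≤ (suc n) = begin
    ‖ psum a n +ᴳ a n ‖ + (D + D) * (½ * ½ ^ n)
      ≤⟨ +-monoˡ-≤ ((D + D) * (½ * ½ ^ n)) (≤-trans (‖+‖ (psum a n) (a n)) (+-monoʳ-≤ (‖ psum a n ‖) (a≤ n))) ⟩
    ‖ psum a n ‖ + D * ½ ^ n + (D + D) * (½ * ½ ^ n)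
      ≡⟨ solve 3 (λ s d h → s :+ d :* h :+ (d :+ d) :* (con ½ :* h) := s :+ (d :+ d) :* h) refl (‖ psum a n ‖) D (½ ^ n) ⟩
    ‖ psum a n ‖ + (D + D) * ½ ^ n
      ≤⟨ psum-bound a D a≤ n ⟩
    D + D ∎
    where open ≤-Reasoning

  psum-bounded : ∀ a D → 0ℚ ≤ D → (∀ j → ‖ a j ‖ ≤ D * ½ ^ j) → ∀ n → ‖ psum a n ‖ ≤ D + D
  psum-bounded a D 0≤D a≤ n = ≤-trans (≤-+ʳ (‖ psum a n ‖) (*-nonneg (+-nonneg 0≤D 0≤D) (0≤½^ n))) (psum-bound a D a≤ n)

  -- Shifting `a` halves D, and the split-off product is at most D D′ 4⁻ⁿ. Together with the quarter
  -- of the extra term K 4⁻ⁿ, which is again D D′ 4⁻ⁿ, it makes up the extra term for the shifted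
  -- sequence. The faster decay of `b` is what makes the product small, as partial sums of `a` are
  -- merely bounded.
  remainder-bound : ∀ n a b D D′ → 0ℚ ≤ D → 0ℚ ≤ D′ →
    (∀ j → ‖ a j ‖ ≤ D * ½ ^ j) → (∀ j → ‖ b j ‖ ≤ D′ * (½ ^ j * ½ ^ j)) →
    let K = (D + D) * (D′ + D′) in ‖ remainder a b n ‖ + K * (½ ^ n * ½ ^ n) ≤ K * ½ ^ n
  remainder-bound zero a b D D′ 0≤D 0≤D′ a≤ b≤ =
    ≤-reflexive (solve 1 (λ k → con 0ℚ :+ k :* (con 1ℚ :* con 1ℚ) := k :* con 1ℚ) refl ((D + D) * (D′ + D′)))
  remainder-bound (suc n) a b D D′ 0≤D 0≤D′ a≤ b≤ = begin
    ‖ remainder a b (suc n) ‖ + (D + D) * (D′ + D′) * (½ * h * (½ * h))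
      ≡⟨ cong (λ z → ‖ z ‖ + (D + D) * (D′ + D′) * (½ * h * (½ * h))) (remainder-suc a b n) ⟩
    ‖ psum a′ n *ᴳ b n +ᴳ remainder a′ b n ‖ + (D + D) * (D′ + D′) * (½ * h * (½ * h))
      ≤⟨ +-monoˡ-≤ _ (≤-trans (‖+‖ (psum a′ n *ᴳ b n) (remainder a′ b n))
           (+-monoˡ-≤ (‖ remainder a′ b n ‖) (≤-trans (‖*‖ (psum a′ n) (b n))
             (*-mono (0≤‖ b n ‖) (+-nonneg 0≤½D 0≤½D) (psum-bounded a′ (½ * D) 0≤½D a′≤ n) (b≤ n))))) ⟩
    (½ * D + ½ * D) * (D′ * (h * h)) + ‖ remainder a′ b n ‖ + (D + D) * (D′ + D′) * (½ * h * (½ * h))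
      ≡⟨ solve 4 (λ d e h r → (con ½ :* d :+ con ½ :* d) :* (e :* (h :* h)) :+ r :+ (d :+ d) :* (e :+ e) :* (con ½ :* h :* (con ½ :* h))
           := r :+ (con ½ :* d :+ con ½ :* d) :* (e :+ e) :* (h :* h)) refl D D′ h (‖ remainder a′ b n ‖) ⟩
    ‖ remainder a′ b n ‖ + (½ * D + ½ * D) * (D′ + D′) * (h * h)
      ≤⟨ remainder-bound n a′ b (½ * D) D′ 0≤½D 0≤D′ a′≤ b≤ ⟩
    (½ * D + ½ * D) * (D′ + D′) * h
      ≡⟨ solve 3 (λ d e h → (con ½ :* d :+ con ½ :* d) :* (e :+ e) :* h := (d :+ d) :* (e :+ e) :* (con ½ :* h)) refl D D′ h ⟩
    (D + D) * (D′ + D′) * (½ * h) ∎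
    where
    open ≤-Reasoning
    h = ½ ^ n
    a′ : ℕ → ℚ[i]
    a′ j = a (suc j)
    0≤½D : 0ℚ ≤ ½ * D
    0≤½D = *-nonneg (<⇒≤ 0<½) 0≤D
    a′≤ : ∀ j → ‖ a′ j ‖ ≤ (½ * D) * ½ ^ j
    a′≤ j = ≤-trans (a≤ (suc j)) (≤-reflexive (solve 2 (λ d h → d :* (con ½ :* h) := (con ½ :* d) :* h) refl D (½ ^ j)))

  conv-cong : ∀ {a a′ b b′ : ℕ → ℚ[i]} → a ≗ a′ → b ≗ b′ → conv a b ≗ conv a′ b′
  conv-cong e e′ zero    = cong₂ _*ᴳ_ (e 0) (e′ 0)
  conv-cong e e′ (suc m) = cong₂ _+ᴳ_ (cong₂ _*ᴳ_ (e 0) (e′ (suc m))) (conv-cong (λ j → e (suc j)) e′ m)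

  conv-scaleˡ : ∀ x a b m → conv (λ j → x *ᴳ a j) b m ≡ x *ᴳ conv a b m
  conv-scaleˡ x a b zero    = G.*-assoc x (a 0) (b 0)
  conv-scaleˡ x a b (suc m) = trans (cong (x *ᴳ a 0 *ᴳ b (suc m) +ᴳ_) (conv-scaleˡ x (λ j → a (suc j)) b m))
    (solveᴳ 4 (λ x a b c → x ⊠ a ⊠ b ⊞ x ⊠ c ⩵ x ⊠ (a ⊠ b ⊞ c)) refl x (a 0) (b (suc m)) (conv (λ j → a (suc j)) b m))

  conv-scaleʳ : ∀ x a b m → conv a (λ j → x *ᴳ b j) m ≡ x *ᴳ conv a b m
  conv-scaleʳ x a b zero    = solveᴳ 3 (λ x a b → a ⊠ (x ⊠ b) ⩵ x ⊠ (a ⊠ b)) refl x (a 0) (b 0)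
  conv-scaleʳ x a b (suc m) = trans (cong (a 0 *ᴳ (x *ᴳ b (suc m)) +ᴳ_) (conv-scaleʳ x (λ j → a (suc j)) b m))
    (solveᴳ 4 (λ x a b c → a ⊠ (x ⊠ b) ⊞ x ⊠ c ⩵ x ⊠ (a ⊠ b ⊞ c)) refl x (a 0) (b (suc m)) (conv (λ j → a (suc j)) b m))

  conv-+ˡ : ∀ a a′ b m → conv (λ j → a j +ᴳ a′ j) b m ≡ conv a b m +ᴳ conv a′ b m
  conv-+ˡ a a′ b zero    = G.distribʳ (b 0) (a 0) (a′ 0)
  conv-+ˡ a a′ b (suc m) = trans (cong ((a 0 +ᴳ a′ 0) *ᴳ b (suc m) +ᴳ_) (conv-+ˡ (λ j → a (suc j)) (λ j → a′ (suc j)) b m))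
    (solveᴳ 5 (λ a a′ b c c′ → (a ⊞ a′) ⊠ b ⊞ (c ⊞ c′) ⩵ (a ⊠ b ⊞ c) ⊞ (a′ ⊠ b ⊞ c′)) refl
      (a 0) (a′ 0) (b (suc m)) (conv (λ j → a (suc j)) b m) (conv (λ j → a′ (suc j)) b m))

  natᴳ : ℕ → ℚ[i]
  natᴳ k = realᴳ (natℚ k)

  natᴳ-suc : ∀ k → natᴳ (suc k) ≡ 1ᴳ +ᴳ natᴳ k
  natᴳ-suc k = cong₂ _,ᴳ_ (natℚ-suc k) refl

  -- Coefficients of the formal derivative. The product rule `leibniz` and a differential equation
  -- replace the binomial theorem in `conv-term`.
  derivative : (ℕ → ℚ[i]) → ℕ → ℚ[i]
  derivative a j = natᴳ (suc j) *ᴳ a (suc j)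

  leibniz : ∀ m a b → natᴳ (suc m) *ᴳ conv a b (suc m) ≡ conv (derivative a) b m +ᴳ conv a (derivative b) m
  leibniz zero a b = solveᴳ 5 (λ n x y z w → n ⊠ (x ⊠ y ⊞ z ⊠ w) ⩵ n ⊠ z ⊠ w ⊞ x ⊠ (n ⊠ y)) refl
    (natᴳ 1) (a 0) (b 1) (a 1) (b 0)
  leibniz (suc m) a b = begin
    natᴳ (suc (suc m)) *ᴳ (a 0 *ᴳ b (suc (suc m)) +ᴳ (a 1 *ᴳ b (suc m) +ᴳ C″))
      ≡⟨ cong (_*ᴳ (a 0 *ᴳ b (suc (suc m)) +ᴳ (a 1 *ᴳ b (suc m) +ᴳ C″))) (natᴳ-suc (suc m)) ⟩
    (1ᴳ +ᴳ natᴳ (suc m)) *ᴳ (a 0 *ᴳ b (suc (suc m)) +ᴳ (a 1 *ᴳ b (suc m) +ᴳ C″))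
      ≡⟨ solveᴳ 6 (λ n x y z w c → (𝟙 ⊞ n) ⊠ (x ⊠ y ⊞ (z ⊠ w ⊞ c))
           ⩵ (z ⊠ w ⊞ c) ⊞ (x ⊠ ((𝟙 ⊞ n) ⊠ y) ⊞ n ⊠ (z ⊠ w ⊞ c))) refl
           (natᴳ (suc m)) (a 0) (b (suc (suc m))) (a 1) (b (suc m)) C″ ⟩
    (a 1 *ᴳ b (suc m) +ᴳ C″) +ᴳ (a 0 *ᴳ ((1ᴳ +ᴳ natᴳ (suc m)) *ᴳ b (suc (suc m))) +ᴳ natᴳ (suc m) *ᴳ conv a′ b (suc m))
      ≡⟨ cong₂ (λ s t → (a 1 *ᴳ b (suc m) +ᴳ C″) +ᴳ (a 0 *ᴳ (s *ᴳ b (suc (suc m))) +ᴳ t))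
           (sym (natᴳ-suc (suc m))) (leibniz m a′ b) ⟩
    (a 1 *ᴳ b (suc m) +ᴳ C″) +ᴳ (a 0 *ᴳ derivative b (suc m) +ᴳ (conv (derivative a′) b m +ᴳ conv a′ (derivative b) m))
      ≡⟨ solveᴳ 6 (λ z w c x d e → (z ⊠ w ⊞ c) ⊞ (x ⊞ (d ⊞ e)) ⩵ (𝟙 ⊠ z ⊠ w ⊞ (d ⊞ c)) ⊞ (x ⊞ e)) refl
           (a 1) (b (suc m)) C″ (a 0 *ᴳ derivative b (suc m)) (conv (derivative a′) b m) (conv a′ (derivative b) m) ⟩
    (1ᴳ *ᴳ a 1 *ᴳ b (suc m) +ᴳ (conv (derivative a′) b m +ᴳ C″)) +ᴳ (a 0 *ᴳ derivative b (suc m) +ᴳ conv a′ (derivative b) m)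
      ≡⟨ cong (λ s → (1ᴳ *ᴳ a 1 *ᴳ b (suc m) +ᴳ s) +ᴳ (a 0 *ᴳ derivative b (suc m) +ᴳ conv a′ (derivative b) m)) (begin
           conv (derivative a′) b m +ᴳ C″
             ≡⟨ conv-+ˡ (derivative a′) a″ b m ⟨
           conv (λ j → derivative a′ j +ᴳ a″ j) b m
             ≡⟨ conv-cong {b = b} (λ j → trans (solveᴳ 2 (λ n x → n ⊠ x ⊞ x ⩵ (𝟙 ⊞ n) ⊠ x) refl (natᴳ (suc j)) (a″ j))
                  (cong (_*ᴳ a″ j) (sym (natᴳ-suc (suc j))))) (λ _ → refl) m ⟩
           conv (λ j → derivative a (suc j)) b m ∎) ⟩
    conv (derivative a) b (suc m) +ᴳ conv a (derivative b) (suc m) ∎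
    where
    open ≡-Reasoning
    a′ a″ : ℕ → ℚ[i]
    a′ j = a (suc j)
    a″ j = a (suc (suc j))
    C″ = conv a″ b m

open Convolution

-- The exponential on the imaginary axis, by partial sums.

recip-inverseʳ : ∀ k .{{_ : ℕ.NonZero k}} → natℚ k * recip k ≡ 1ℚ
recip-inverseʳ (suc k) = recip-inverse k

0<recip : ∀ k .{{_ : ℕ.NonZero k}} → 0ℚ < recip k
0<recip (suc k) = recip-pos k

-- The term (iq)ᵏ / k!. Its partial sums `E n q` pair those of `cos` and `sin`, so `E n` at the n-th
-- approximation of a real θ is the n-th approximation of `e^i θ`.
term : ℚ → ℕ → ℚ[i]
term q k = (re-i^ k * (q ^ k * recip! k)) ,ᴳ (im-i^ k * (q ^ k * recip! k))

E : ℕ → ℚ → ℚ[i]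
E n q = partialSum re-i^ n q ,ᴳ partialSum im-i^ n q

E≡psum : ∀ n q → E n q ≡ psum (term q) n
E≡psum zero    q = refl
E≡psum (suc n) q = cong (_+ᴳ term q n) (E≡psum n q)

re-suc : ∀ k → re-i^ (suc k) ≡ - im-i^ k
re-suc 0             = refl
re-suc 1             = refl
re-suc (suc (suc k)) = cong -_ (re-suc k)

im-suc : ∀ k → im-i^ (suc k) ≡ re-i^ k
im-suc 0             = refl
im-suc 1             = refl
im-suc (suc (suc k)) = cong -_ (im-suc k)

∣i^∣ : ∀ k → ∣ re-i^ k ∣ + ∣ im-i^ k ∣ ≡ 1ℚ
∣i^∣ 0             = refl
∣i^∣ 1             = refl
∣i^∣ (suc (suc k)) = trans (cong₂ _+_ (∣-p∣≡∣p∣ (re-i^ k)) (∣-p∣≡∣p∣ (im-i^ k))) (∣i^∣ k)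

-- The differential equation of t ↦ exp (iqt), coefficient by coefficient.
derivative-term : ∀ q j → derivative (term q) j ≡ (0ℚ ,ᴳ q) *ᴳ term q j
derivative-term q j = cong₂ _,ᴳ_
  (begin
    N * (re-i^ (suc j) * t) + - (0ℚ * (im-i^ (suc j) * t))
      ≡⟨ cong (λ a → N * (a * t) + - (0ℚ * (im-i^ (suc j) * t))) (re-suc j) ⟩
    N * (- I * t) + - (0ℚ * (im-i^ (suc j) * t))
      ≡⟨ solve 7 (λ n i q Q r R m → n :* (:- i :* (q :* Q :* (r :* R))) :+ :- (con 0ℚ :* m)
           := (n :* r) :* :- (q :* (i :* (Q :* R)))) refl N I q (q ^ j) r (recip! j) (im-i^ (suc j) * t) ⟩
    (N * r) * - (q * (I * (q ^ j * recip! j)))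
      ≡⟨ cong (_* - (q * (I * (q ^ j * recip! j)))) (recip-inverse j) ⟩
    1ℚ * - (q * (I * (q ^ j * recip! j)))
      ≡⟨ solve 2 (λ a b → con 1ℚ :* :- a := con 0ℚ :* b :+ :- a) refl (q * (I * (q ^ j * recip! j))) (re-i^ j * (q ^ j * recip! j)) ⟩
    0ℚ * (re-i^ j * (q ^ j * recip! j)) + - (q * (I * (q ^ j * recip! j))) ∎)
  (begin
    N * (im-i^ (suc j) * t) + 0ℚ * (re-i^ (suc j) * t)
      ≡⟨ cong (λ a → N * (a * t) + 0ℚ * (re-i^ (suc j) * t)) (im-suc j) ⟩
    N * (Re * t) + 0ℚ * (re-i^ (suc j) * t)
      ≡⟨ solve 7 (λ n i q Q r R m → n :* (i :* (q :* Q :* (r :* R))) :+ con 0ℚ :* m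
           := (n :* r) :* (q :* (i :* (Q :* R)))) refl N Re q (q ^ j) r (recip! j) (re-i^ (suc j) * t) ⟩
    (N * r) * (q * (Re * (q ^ j * recip! j)))
      ≡⟨ cong (_* (q * (Re * (q ^ j * recip! j)))) (recip-inverse j) ⟩
    1ℚ * (q * (Re * (q ^ j * recip! j)))
      ≡⟨ solve 2 (λ a b → con 1ℚ :* a := con 0ℚ :* b :+ a) refl (q * (Re * (q ^ j * recip! j))) (I * (q ^ j * recip! j)) ⟩
    0ℚ * (I * (q ^ j * recip! j)) + q * (Re * (q ^ j * recip! j)) ∎)
  where
  open ≡-Reasoning
  N = natℚ (suc j)
  r = recip (suc j)
  t = q ^ suc j * recip! (suc j)
  I = im-i^ j
  Re = re-i^ j

recip-inverseᴳ : ∀ k .{{_ : ℕ.NonZero k}} → realᴳ (recip k) *ᴳ natᴳ k ≡ 1ᴳ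
recip-inverseᴳ k = cong₂ _,ᴳ_
  (trans (solve 2 (λ r n → r :* n :+ :- (con 0ℚ :* con 0ℚ) := n :* r) refl (recip k) (natℚ k)) (recip-inverseʳ k))
  (solve 2 (λ r n → r :* con 0ℚ :+ con 0ℚ :* n := con 0ℚ) refl (recip k) (natℚ k))

natᴳ-cancel : ∀ k {z w} → natᴳ (suc k) *ᴳ z ≡ natᴳ (suc k) *ᴳ w → z ≡ w
natᴳ-cancel k {z} {w} e = trans (sym (undo z)) (trans (cong (realᴳ (recip (suc k)) *ᴳ_) e) (undo w))
  where
  undo : ∀ z → realᴳ (recip (suc k)) *ᴳ (natᴳ (suc k) *ᴳ z) ≡ z
  undo z = trans (sym (G.*-assoc (realᴳ (recip (suc k))) (natᴳ (suc k)) z)) (trans (cong (_*ᴳ z) (recip-inverseᴳ (suc k))) (G.*-identityˡ z))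

-- Both sides are 1 at order 0 and are multiplied by i (x + y) under derivation.
conv-term : ∀ x y m → conv (term x) (term y) m ≡ term (x + y) m
conv-term x y zero    = refl
conv-term x y (suc m) = natᴳ-cancel m (begin
  natᴳ (suc m) *ᴳ conv (term x) (term y) (suc m)
    ≡⟨ leibniz m (term x) (term y) ⟩
  conv (derivative (term x)) (term y) m +ᴳ conv (term x) (derivative (term y)) m
    ≡⟨ cong₂ _+ᴳ_
         (trans (conv-cong {b = term y} (derivative-term x) (λ _ → refl) m) (conv-scaleˡ (0ℚ ,ᴳ x) (term x) (term y) m))
         (trans (conv-cong {a = term x} (λ _ → refl) (derivative-term y) m) (conv-scaleʳ (0ℚ ,ᴳ y) (term x) (term y) m)) ⟩
  (0ℚ ,ᴳ x) *ᴳ conv (term x) (term y) m +ᴳ (0ℚ ,ᴳ y) *ᴳ conv (term x) (term y) m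
    ≡⟨ G.distribʳ (conv (term x) (term y) m) (0ℚ ,ᴳ x) (0ℚ ,ᴳ y) ⟨
  (0ℚ ,ᴳ (x + y)) *ᴳ conv (term x) (term y) m
    ≡⟨ cong ((0ℚ ,ᴳ (x + y)) *ᴳ_) (conv-term x y m) ⟩
  (0ℚ ,ᴳ (x + y)) *ᴳ term (x + y) m
    ≡⟨ derivative-term (x + y) m ⟨
  natᴳ (suc m) *ᴳ term (x + y) (suc m) ∎)
  where open ≡-Reasoning

‖term‖ : ∀ {q B} → 0ℚ ≤ B → ∣ q ∣ ≤ B → ∀ k → ‖ term q k ‖ ≤ B ^ k * recip! k
‖term‖ {q} {B} 0≤B q≤B k = begin
  ∣ re-i^ k * t ∣ + ∣ im-i^ k * t ∣
    ≡⟨ cong₂ _+_ (∣p*q∣≡∣p∣*∣q∣ (re-i^ k) t) (∣p*q∣≡∣p∣*∣q∣ (im-i^ k) t) ⟩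
  ∣ re-i^ k ∣ * ∣ t ∣ + ∣ im-i^ k ∣ * ∣ t ∣
    ≡⟨ *-distribʳ-+ (∣ t ∣) (∣ re-i^ k ∣) (∣ im-i^ k ∣) ⟨
  (∣ re-i^ k ∣ + ∣ im-i^ k ∣) * ∣ t ∣
    ≡⟨ trans (cong (_* ∣ t ∣) (∣i^∣ k)) (*-identityˡ (∣ t ∣)) ⟩
  ∣ q ^ k * recip! k ∣
    ≡⟨ trans (∣p*q∣≡∣p∣*∣q∣ (q ^ k) (recip! k)) (cong (∣ q ^ k ∣ *_) (0≤p⇒∣p∣≡p (recip!-nonneg k))) ⟩
  ∣ q ^ k ∣ * recip! k
    ≤⟨ *-monoʳ-≤-nonNeg (recip! k) {{nonNegative (recip!-nonneg k)}} (∣^∣ q≤B k) ⟩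
  B ^ k * recip! k ∎
  where
  open ≤-Reasoning
  t = q ^ k * recip! k

-- One factor ½ᵏ makes the series converge, the other bounds remainder terms.
term-decay : ∀ B → 0ℚ ≤ B → ∃[ D ] (0ℚ ≤ D × ∀ q → ∣ q ∣ ≤ B → ∀ k → ‖ term q k ‖ ≤ D * (½ ^ k * ½ ^ k))
term-decay B 0≤B = let D , 0≤D , bd = geometric-bound (B + B) (+-nonneg 0≤B 0≤B) in D , 0≤D , λ q q≤B k → begin
  ‖ term q k ‖
    ≤⟨ ‖term‖ 0≤B q≤B k ⟩
  B ^ k * recip! k
    ≡⟨ cong (_* recip! k) (½^-* B k) ⟨
  (B + B) ^ k * ½ ^ k * recip! k
    ≡⟨ solve 3 (λ a h f → a :* h :* f := (a :* f) :* h) refl ((B + B) ^ k) (½ ^ k) (recip! k) ⟩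
  (B + B) ^ k * recip! k * ½ ^ k
    ≤⟨ *-monoʳ-≤-nonNeg (½ ^ k) {{nonNegative (0≤½^ k)}} (bd k) ⟩
  D * ½ ^ k * ½ ^ k
    ≡⟨ *-assoc D (½ ^ k) (½ ^ k) ⟩
  D * (½ ^ k * ½ ^ k) ∎
  where open ≤-Reasoning

decay-½ : ∀ (a : ℕ → ℚ[i]) {D} → 0ℚ ≤ D → (∀ k → ‖ a k ‖ ≤ D * (½ ^ k * ½ ^ k)) → ∀ k → ‖ a k ‖ ≤ D * ½ ^ k
decay-½ a {D} 0≤D bd k = ≤-trans (bd k) (*-monoˡ-≤-nonNeg D {{nonNegative 0≤D}}
  (≤-trans (*-monoʳ-≤-nonNeg (½ ^ k) {{nonNegative (0≤½^ k)}} (½^-anti {0} {k} ℕ.z≤n)) (≤-reflexive (*-identityˡ (½ ^ k)))))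

Boundedℚ : (ℕ → ℚ) → Set
Boundedℚ x = ∃[ B ] (0ℚ ≤ B × ∀ n → ∣ x n ∣ ≤ B)

E-bounded : ∀ {x} → Boundedℚ x → Bounded (λ n → E n (x n))
E-bounded {x} (B , 0≤B , x≤B) = let D , 0≤D , bd = term-decay B 0≤B in
  D + D , +-nonneg 0≤D 0≤D , λ n → subst (λ z → ‖ z ‖ ≤ D + D) (sym (E≡psum n (x n)))
    (psum-bounded (term (x n)) D 0≤D (decay-½ (term (x n)) 0≤D (bd (x n) (x≤B n))) n)

psum-cong : ∀ {a b : ℕ → ℚ[i]} → a ≗ b → psum a ≗ psum b
psum-cong e zero    = refl
psum-cong e (suc n) = cong₂ _+ᴳ_ (psum-cong e n) (e n)

-- Partial sums are not multiplicative; the error is the `remainder` of the two series, of order 2⁻ⁿ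
-- uniformly for bounded arguments.
E-add : ∀ {x y} → Boundedℚ x → Boundedℚ y → (λ n → E n (x n + y n)) ≈₀ (λ n → E n (x n) *ᴳ E n (y n))
E-add {x} {y} (B , 0≤B , x≤B) (B′ , 0≤B′ , y≤B′) =
  let D , 0≤D , bd = term-decay B 0≤B
      D′ , 0≤D′ , bd′ = term-decay B′ 0≤B′
      K = (D + D) * (D′ + D′)
      0≤K = *-nonneg (+-nonneg 0≤D 0≤D) (+-nonneg 0≤D′ 0≤D′)
  in ≈₀-sym (≈₀-intro (null-≤ 0 (λ n _ → begin
    ‖ E n (x n) *ᴳ E n (y n) ⊖ᴳ E n (x n + y n) ‖
      ≡⟨ cong ‖_‖ (cong₂ _⊖ᴳ_ (cong₂ _*ᴳ_ (E≡psum n (x n)) (E≡psum n (y n)))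
           (trans (E≡psum n (x n + y n)) (psum-cong (sym ∘ conv-term (x n) (y n)) n))) ⟩
    ‖ remainder (term (x n)) (term (y n)) n ‖
      ≤⟨ ≤-+ʳ (‖ remainder (term (x n)) (term (y n)) n ‖) (*-nonneg 0≤K (*-nonneg (0≤½^ n) (0≤½^ n))) ⟩
    ‖ remainder (term (x n)) (term (y n)) n ‖ + K * (½ ^ n * ½ ^ n)
      ≤⟨ remainder-bound n (term (x n)) (term (y n)) D D′ 0≤D 0≤D′ (decay-½ (term (x n)) 0≤D (bd (x n) (x≤B n))) (bd′ (y n) (y≤B′ n)) ⟩
    K * ½ ^ n ∎)
    (null-* K 0≤K null-½^)))
  where open ≤-Reasoning

-- The partial sum with no terms is 0, hence the condition on n.
E-0 : ∀ n → 1 ℕ.≤ n → E n 0ℚ ≡ 1ᴳ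
E-0 (suc n) _ = trans (E≡psum (suc n) 0ℚ) (go n)
  where
  term-0 : ∀ k → term 0ℚ (suc k) ≡ 0ᴳ
  term-0 k = cong₂ _,ᴳ_
    (solve 3 (λ a b c → a :* (con 0ℚ :* b :* c) := con 0ℚ) refl (re-i^ (suc k)) (0ℚ ^ k) (recip! (suc k)))
    (solve 3 (λ a b c → a :* (con 0ℚ :* b :* c) := con 0ℚ) refl (im-i^ (suc k)) (0ℚ ^ k) (recip! (suc k)))
  go : ∀ n → psum (term 0ℚ) (suc n) ≡ 1ᴳ
  go zero    = refl
  go (suc n) = trans (cong₂ _+ᴳ_ (go n) (term-0 n)) (G.+-identityʳ 1ᴳ)

E-neg : ∀ n q → E n (- q) ≡ conj (E n q)
E-neg zero    q = refl
E-neg (suc n) q = trans (cong (_+ᴳ term (- q) n) (E-neg n q)) (cong₂ _,ᴳ_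
  (cong (partialSum re-i^ n q +_) (trans (sym (*-assoc (re-i^ n) ((- q) ^ n) (recip! n)))
    (trans (cong (_* recip! n) (re-parity n)) (*-assoc (re-i^ n) (q ^ n) (recip! n)))))
  (trans (cong (- partialSum im-i^ n q +_) (trans (sym (*-assoc (im-i^ n) ((- q) ^ n) (recip! n))) (cong (_* recip! n) (im-parity n))))
    (solve 4 (λ s a b c → :- s :+ :- (a :* b) :* c := :- (s :+ a :* (b :* c))) refl (partialSum im-i^ n q) (im-i^ n) (q ^ n) (recip! n))))
  where
  re-parity : ∀ k → re-i^ k * (- q) ^ k ≡ re-i^ k * q ^ k
  re-parity 0 = refl
  re-parity 1 = trans (*-zeroˡ ((- q) ^ 1)) (sym (*-zeroˡ (q ^ 1)))
  re-parity (suc (suc k)) = trans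
    (solve 3 (λ a q x → :- a :* (:- q :* (:- q :* x)) := :- (q :* q) :* (a :* x)) refl (re-i^ k) q ((- q) ^ k))
    (trans (cong (- (q * q) *_) (re-parity k))
      (solve 3 (λ a q x → :- (q :* q) :* (a :* x) := :- a :* (q :* (q :* x))) refl (re-i^ k) q (q ^ k)))
  im-parity : ∀ k → im-i^ k * (- q) ^ k ≡ - (im-i^ k * q ^ k)
  im-parity 0 = refl
  im-parity 1 = solve 1 (λ q → con 1ℚ :* (:- q :* con 1ℚ) := :- (con 1ℚ :* (q :* con 1ℚ))) refl q
  im-parity (suc (suc k)) = trans
    (solve 3 (λ a q x → :- a :* (:- q :* (:- q :* x)) := :- (q :* q) :* (a :* x)) refl (im-i^ k) q ((- q) ^ k))
    (trans (cong (- (q * q) *_) (im-parity k))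
      (solve 3 (λ a q x → :- (q :* q) :* :- (a :* x) := :- (:- a :* (q :* (q :* x)))) refl (im-i^ k) q (q ^ k)))

infixr 8 _^ᴳ_
_^ᴳ_ : ℚ[i] → ℕ → ℚ[i]
z ^ᴳ zero  = 1ᴳ
z ^ᴳ suc k = z *ᴳ z ^ᴳ k

≡⇒≈₀ : ∀ {z w : ℕ → ℚ[i]} N → (∀ n → N ℕ.≤ n → z n ≡ w n) → z ≈₀ w
≡⇒≈₀ {z} {w} N e = ≈₀-intro λ ε 0<ε → N , λ n n≥ → ≤-trans
  (≤-reflexive (cong ‖_‖ (trans (cong (_⊖ᴳ w n) (e n n≥)) (G.-‿inverseʳ (w n))))) (<⇒≤ 0<ε)

boundedℚ-* : ∀ q {x} → Boundedℚ x → Boundedℚ (λ n → q * x n)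
boundedℚ-* q {x} (B , 0≤B , x≤B) = ∣ q ∣ * B , *-nonneg (0≤∣p∣ q) 0≤B , λ n →
  ≤-trans (≤-reflexive (∣p*q∣≡∣p∣*∣q∣ q (x n))) (*-monoˡ-≤-nonNeg (∣ q ∣) {{∣-∣-nonNeg q}} (x≤B n))

E-pow : ∀ {θ} → Boundedℚ θ → ∀ m → (λ n → E n (natℚ m * θ n)) ≈₀ (λ n → E n (θ n) ^ᴳ m)
E-pow {θ} bθ zero = ≡⇒≈₀ 1 λ n n≥1 → trans (cong (E n) (*-zeroˡ (θ n))) (E-0 n n≥1)
E-pow {θ} bθ (suc m) =
  ≈₀-trans
    (≈₀-trans
      (≡⇒≈₀ 0 λ n _ → cong (E n) (trans (cong (_* θ n) (natℚ-suc m))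
        (solve 2 (λ k t → (con 1ℚ :+ k) :* t := t :+ k :* t) refl (natℚ m) (θ n))))
      (E-add bθ (boundedℚ-* (natℚ m) bθ)))
    (≈₀-*ˡ (λ n → E n (θ n)) (E-bounded bθ) (E-pow bθ m))

E-conj : ∀ {x} → Boundedℚ x → (λ n → E n (x n) *ᴳ conj (E n (x n))) ≈₀ (λ _ → 1ᴳ)
E-conj {x} bx@(B , 0≤B , x≤B) =
  ≈₀-trans
    (≈₀-sym
      (≈₀-trans
        (E-add bx (B , 0≤B , λ n → subst (_≤ B) (sym (∣-p∣≡∣p∣ (x n))) (x≤B n)))
        (≡⇒≈₀ 0 λ n _ → cong (E n (x n) *ᴳ_) (E-neg n (x n)))))
    (≡⇒≈₀ 1 λ n n≥1 → trans (cong (E n) (+-inverseʳ (x n))) (E-0 n n≥1))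

-- Sums of powers of the approximate p-th root of unity.

module GeometricSums where

  open Algebra.Properties.CommutativeMonoid.Sum G.+-commutativeMonoid using (sum; sum-cong-≗)

  sum-*ˡ : ∀ {m} z (g : Fin m → ℚ[i]) → sum (λ j → z *ᴳ g j) ≡ z *ᴳ sum g
  sum-*ˡ {zero}  z g = sym (G.zeroʳ z)
  sum-*ˡ {suc m} z g = trans (cong (z *ᴳ g zero +ᴳ_) (sum-*ˡ z (g ∘ suc))) (sym (G.distribˡ z (g zero) (sum (g ∘ suc))))

  geometric-sum : ∀ z m → (1ᴳ ⊖ᴳ z) *ᴳ sum {m} (λ j → z ^ᴳ toℕ j) ≡ 1ᴳ ⊖ᴳ z ^ᴳ m
  geometric-sum z zero    = solveᴳ 1 (λ z → (𝟙 ⊞ ⊟ z) ⊠ 𝟘 ⩵ 𝟙 ⊞ ⊟ 𝟙) refl z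
  geometric-sum z (suc m) = begin
    (1ᴳ ⊖ᴳ z) *ᴳ (1ᴳ +ᴳ sum {m} (λ j → z *ᴳ z ^ᴳ toℕ j))
      ≡⟨ cong (λ s → (1ᴳ ⊖ᴳ z) *ᴳ (1ᴳ +ᴳ s)) (sum-*ˡ z (λ (j : Fin m) → z ^ᴳ toℕ j)) ⟩
    (1ᴳ ⊖ᴳ z) *ᴳ (1ᴳ +ᴳ z *ᴳ S)
      ≡⟨ solveᴳ 2 (λ z s → (𝟙 ⊞ ⊟ z) ⊠ (𝟙 ⊞ z ⊠ s) ⩵ (𝟙 ⊞ ⊟ z) ⊞ z ⊠ ((𝟙 ⊞ ⊟ z) ⊠ s)) refl z S ⟩
    (1ᴳ ⊖ᴳ z) +ᴳ z *ᴳ ((1ᴳ ⊖ᴳ z) *ᴳ S)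
      ≡⟨ cong (λ s → (1ᴳ ⊖ᴳ z) +ᴳ z *ᴳ s) (geometric-sum z m) ⟩
    (1ᴳ ⊖ᴳ z) +ᴳ z *ᴳ (1ᴳ ⊖ᴳ z ^ᴳ m)
      ≡⟨ solveᴳ 2 (λ z s → (𝟙 ⊞ ⊟ z) ⊞ z ⊠ (𝟙 ⊞ ⊟ s) ⩵ 𝟙 ⊞ ⊟ (z ⊠ s)) refl z (z ^ᴳ m) ⟩
    1ᴳ ⊖ᴳ z ^ᴳ suc m ∎
    where
    open ≡-Reasoning
    S = sum {m} (λ j → z ^ᴳ toℕ j)

2/ : ∀ k .{{_ : ℕ.NonZero k}} → ℤ.+ 2 / k ≡ recip k + recip k
2/ (suc k) = toℚᵘ-injective (begin
  toℚᵘ (ℤ.+ 2 / suc k)                           ≈⟨ toℚᵘ-fromℚᵘ (ℚᵘ.mkℚᵘ (ℤ.+ 2) k) ⟩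
  ℚᵘ.mkℚᵘ (ℤ.+ 2) k                              ≈⟨ ℚᵘ.*≡* (trans (cong (ℤ.+ 2 ℤ.*_) (ℤₚ.pos-* (suc k) (suc k))) (double (ℤ.+ suc k))) ⟩
  ℚᵘ.mkℚᵘ (ℤ.+ 1) k ℚᵘ.+ ℚᵘ.mkℚᵘ (ℤ.+ 1) k       ≈⟨ ℚᵘₚ.+-cong (toℚᵘ-fromℚᵘ (ℚᵘ.mkℚᵘ (ℤ.+ 1) k)) (toℚᵘ-fromℚᵘ (ℚᵘ.mkℚᵘ (ℤ.+ 1) k)) ⟨
  toℚᵘ (recip (suc k)) ℚᵘ.+ toℚᵘ (recip (suc k)) ≈⟨ ℚᵘₚ.≃-sym (toℚᵘ-homo-+ (recip (suc k)) (recip (suc k))) ⟩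
  toℚᵘ (recip (suc k) + recip (suc k))           ∎)
  where
  open ℚᵘₚ.≃-Reasoning
  double : ∀ d → ℤ.+ 2 ℤ.* (d ℤ.* d) ≡ (ℤ.+ 1 ℤ.* d ℤ.+ ℤ.+ 1 ℤ.* d) ℤ.* d
  double = ℤ-Solver.solve-∀

module RootsOfUnity (p : ℕ) .{{_ : ℕ.NonZero p}} (2≤p : 2 ℕ.≤ p) (π : ℝ) (isPi : IsPi π) where

  open GeometricSums
  open Algebra.Properties.CommutativeMonoid.Sum G.+-commutativeMonoid using (sum)

  private
    r : ℚ
    r = recip p

    x : ℕ → ℚ
    x = seq π

    0<r : 0ℚ < r
    0<r = 0<recip p

    bx : Boundedℚ x
    bx = cauchy-bound {x} (cauchy π)

    r+r≤1 : r + r ≤ 1ℚ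
    r+r≤1 = begin
      r + r                           ≡⟨ solve 1 (λ r → r :+ r := con (natℚ 2) :* r) refl r ⟩
      natℚ 2 * r                      ≤⟨ *-monoʳ-≤-nonNeg r {{nonNegative (<⇒≤ 0<r)}} (natℚ-mono 2≤p) ⟩
      natℚ p * r                      ≡⟨ recip-inverseʳ p ⟩
      1ℚ                              ∎
      where open ≤-Reasoning

    z : ℝ
    z = fromℚ r *ᴿ π

    0<z : 0ᴿ <ᴿ z
    0<z = let ε , 0<ε , N , le = proj₁ isPi in
      r * ε , *-pos 0<r 0<ε , N , λ n n≥ →
        subst (_≤ r * x n) (sym (+-identityˡ (r * ε)))
          (*-monoˡ-≤-nonNeg r {{nonNegative (<⇒≤ 0<r)}} (subst (_≤ x n) (+-identityˡ ε) (le n n≥)))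

    -- As p ≥ 2, π - π/p is at least π/2, hence at least half of any positive lower bound of π.
    z<π : z <ᴿ π
    z<π = let ε , 0<ε , N , le = proj₁ isPi in
      ½ * ε , *-pos 0<½ 0<ε , N , λ n n≥ →
        let ε≤x = subst (_≤ x n) (+-identityˡ ε) (le n n≥)
            0≤x = ≤-trans (<⇒≤ 0<ε) ε≤x
        in begin
        r * x n + ½ * ε
          ≤⟨ +-mono-≤ (≤-reflexive (solve 2 (λ r x → r :* x := con ½ :* ((r :+ r) :* x)) refl r (x n)))
               (*-monoˡ-≤-nonNeg ½ ε≤x) ⟩
        ½ * ((r + r) * x n) + ½ * x n
          ≤⟨ +-monoˡ-≤ (½ * x n) (*-monoˡ-≤-nonNeg ½ (*-monoʳ-≤-nonNeg (x n) {{nonNegative 0≤x}} r+r≤1)) ⟩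
        ½ * (1ℚ * x n) + ½ * x n
          ≡⟨ solve 1 (λ x → con ½ :* (con 1ℚ :* x) :+ con ½ :* x := x) refl (x n) ⟩
        x n ∎
      where open ≤-Reasoning

    Ez : ℕ → ℚ[i]
    Ez n = E n (r * x n)

  ω : ℕ → ℚ[i]
  ω n = E n ((ℤ.+ 2 / p) * x n)

  private
    ω≈Ez² : ω ≈₀ (λ n → Ez n *ᴳ Ez n)
    ω≈Ez² = ≈₀-trans (≡⇒≈₀ 0 λ n _ → cong (E n) (trans (cong (_* x n) (2/ p)) (*-distribʳ-+ (x n) r r)))
      (E-add (boundedℚ-* r bx) (boundedℚ-* r bx))

    ω-bounded : Bounded ω
    ω-bounded = E-bounded (boundedℚ-* (ℤ.+ 2 / p) bx)

    -- sin π = 0 makes exp (iπ) asymptotically real. Hence exp (2πi) is the product of exp (iπ) and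
    -- its conjugate, which tends to 1, and the value of cos π never has to be found.
    Eπ≈conj : (λ n → E n (x n)) ≈₀ (λ n → conj (E n (x n)))
    Eπ≈conj = ≈₀-intro (null-≤ 0 (λ n _ → bound (E n (x n))) (null-+ sin-null sin-null))
      where
      sin-null : Null (λ n → ∣ imᴳ (E n (x n)) ∣)
      sin-null ε 0<ε = let N , le = proj₁ (proj₂ isPi) ε 0<ε in N , λ n n≥ →
        subst (λ q → ∣ q ∣ ≤ ε) (+-identityʳ (imᴳ (E n (x n)))) (le n n≥)
      bound : ∀ z → ‖ z ⊖ᴳ conj z ‖ ≤ ∣ imᴳ z ∣ + ∣ imᴳ z ∣
      bound (a ,ᴳ b) = begin
        ∣ a + - a ∣ + ∣ b + - - b ∣
          ≡⟨ cong₂ (λ s t → ∣ s ∣ + ∣ t ∣) (+-inverseʳ a) (solve 1 (λ b → b :+ :- :- b := b :+ b) refl b) ⟩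
        ∣ 0ℚ ∣ + ∣ b + b ∣
          ≡⟨ +-identityˡ (∣ b + b ∣) ⟩
        ∣ b + b ∣
          ≤⟨ ∣p+q∣≤∣p∣+∣q∣ b b ⟩
        ∣ b ∣ + ∣ b ∣ ∎
        where open ≤-Reasoning

    ωᵖ≈1 : (λ n → ω n ^ᴳ p) ≈₀ (λ _ → 1ᴳ)
    ωᵖ≈1 = ≈₀-trans (≈₀-sym (E-pow (boundedℚ-* (ℤ.+ 2 / p) bx) p))
      (≈₀-trans (≡⇒≈₀ 0 λ n _ → cong (E n) (full-turn n))
      (≈₀-trans (E-add bx bx)
      (≈₀-trans (≈₀-*ˡ (λ n → E n (x n)) (E-bounded bx) Eπ≈conj) (E-conj bx))))
      where
      full-turn : ∀ n → natℚ p * ((ℤ.+ 2 / p) * x n) ≡ x n + x n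
      full-turn n = begin
        natℚ p * ((ℤ.+ 2 / p) * x n)   ≡⟨ cong (λ q → natℚ p * (q * x n)) (2/ p) ⟩
        natℚ p * ((r + r) * x n)       ≡⟨ solve 3 (λ p r x → p :* ((r :+ r) :* x) := (p :* r) :* (x :+ x)) refl (natℚ p) r (x n) ⟩
        (natℚ p * r) * (x n + x n)     ≡⟨ cong (_* (x n + x n)) (recip-inverseʳ p) ⟩
        1ℚ * (x n + x n)               ≡⟨ *-identityˡ (x n + x n) ⟩
        x n + x n                      ∎
        where open ≡-Reasoning

    -- 1 - Re ω = 2 sin²(π/p), and sin (π/p) > 0 because 0 < π/p < π.
    ω-far-from-1 : ∃[ κ ] (0ℚ < κ × ∃[ N ] (∀ n → N ℕ.≤ n → κ ≤ 1ℚ - reᴳ (ω n)))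
    ω-far-from-1 =
      let ε , 0<ε , N , sin≥ = proj₂ (proj₂ isPi) z 0<z z<π
          -- 2 sin² is at least 2 ε²; the two errors of ½ κ use up one ε² and leave the other.
          κ = ε * ε
          0<κ = *-pos 0<ε 0<ε
          N₁ , c₁ = ≈₀-null (E-conj (boundedℚ-* r bx)) (½ * κ) (*-pos 0<½ 0<κ)
          N₂ , c₂ = ≈₀-null ω≈Ez² (½ * κ) (*-pos 0<½ 0<κ)
      in κ , 0<κ , N ℕ.⊔ (N₁ ℕ.⊔ N₂) , λ n n≥ →
        let n≥′ = ℕₚ.m⊔n≤o⇒n≤o N (N₁ ℕ.⊔ N₂) n≥
            s≥ε = subst (_≤ imᴳ (Ez n)) (+-identityˡ ε) (sin≥ n (ℕₚ.m⊔n≤o⇒m≤o N (N₁ ℕ.⊔ N₂) n≥))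
        in lower (<⇒≤ 0<ε) (Ez n) (ω n) s≥ε
             (≤-trans (p≤∣p∣ (reᴳ (Ez n *ᴳ conj (Ez n) ⊖ᴳ 1ᴳ))) (≤-trans (∣re∣≤ (Ez n *ᴳ conj (Ez n) ⊖ᴳ 1ᴳ)) (c₁ n (ℕₚ.m⊔n≤o⇒m≤o N₁ N₂ n≥′))))
             (≤-trans (p≤∣p∣ (reᴳ (ω n ⊖ᴳ Ez n *ᴳ Ez n))) (≤-trans (∣re∣≤ (ω n ⊖ᴳ Ez n *ᴳ Ez n)) (c₂ n (ℕₚ.m⊔n≤o⇒n≤o N₁ N₂ n≥′))))
      where
      lower : ∀ {ε} → 0ℚ ≤ ε → ∀ u w → ε ≤ imᴳ u → reᴳ (u *ᴳ conj u ⊖ᴳ 1ᴳ) ≤ ½ * (ε * ε) →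
              reᴳ (w ⊖ᴳ u *ᴳ u) ≤ ½ * (ε * ε) → ε * ε ≤ 1ℚ - reᴳ w
      lower {ε} 0≤ε (c ,ᴳ s) (a ,ᴳ b) ε≤s le₁ le₂ = +-cancelʳ-≤ (ε * ε) (begin
        ε * ε + ε * ε
          ≤⟨ +-mono-≤ ε²≤s² ε²≤s² ⟩
        s * s + s * s
          ≡⟨ solve 3 (λ c s a → s :* s :+ s :* s := con 1ℚ :- a :+
               ((c :* c :+ :- (s :* :- s) :+ :- con 1ℚ) :+ (a :+ :- (c :* c :+ :- (s :* s))))) refl c s a ⟩
        1ℚ - a + ((c * c + - (s * - s) + - 1ℚ) + (a + - (c * c + - (s * s))))
          ≤⟨ +-monoʳ-≤ (1ℚ - a) (+-mono-≤ le₁ le₂) ⟩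
        1ℚ - a + (½ * (ε * ε) + ½ * (ε * ε))
          ≡⟨ cong (1ℚ - a +_) (½+½ (ε * ε)) ⟩
        1ℚ - a + ε * ε ∎)
        where
        open ≤-Reasoning
        ε²≤s² : ε * ε ≤ s * s
        ε²≤s² = *-mono 0≤ε (≤-trans 0≤ε ε≤s) ε≤s ε≤s

  rootSum : ℕ → ℚ[i]
  rootSum n = sum {p} λ j → ω n ^ᴳ toℕ j

  -- Multiplying the geometric sum by the conjugate of 1 - ω avoids division: |1 - ω|² times the sum
  -- is a bounded factor times 1 - ωᵖ, and |1 - ω|² ≥ (1 - Re ω)² ≥ κ².
  rootSum-null : Null (λ n → ‖ rootSum n ‖)
  rootSum-null =
    let κ , 0<κ , N , far = ω-far-from-1
        B , 0≤B , ω≤B = ω-bounded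
    in null-cancel (κ * κ) (*-pos 0<κ 0<κ) (null-≤ N (λ n n≥ → begin
      κ * κ * ‖ rootSum n ‖
        ≤⟨ *-monoʳ-≤-nonNeg (‖ rootSum n ‖) {{nonNegative (0≤‖ rootSum n ‖)}}
             (≤-trans (*-mono (<⇒≤ 0<κ) (≤-trans (<⇒≤ 0<κ) (far n n≥)) (far n n≥) (far n n≥))
               (≤-+ʳ ((1ℚ - reᴳ (ω n)) * (1ℚ - reᴳ (ω n))) (square≥0 (0ℚ - imᴳ (ω n))))) ⟩
      normSquare (1ᴳ ⊖ᴳ ω n) * ‖ rootSum n ‖
        ≡⟨ ‖real*‖ (normSquare (1ᴳ ⊖ᴳ ω n)) (rootSum n) (+-nonneg (square≥0 (1ℚ - reᴳ (ω n))) (square≥0 (0ℚ - imᴳ (ω n)))) ⟨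
      ‖ realᴳ (normSquare (1ᴳ ⊖ᴳ ω n)) *ᴳ rootSum n ‖
        ≡⟨ cong ‖_‖ (trans (cong (_*ᴳ rootSum n) (conj-* (1ᴳ ⊖ᴳ ω n))) (trans (G.*-assoc (conj (1ᴳ ⊖ᴳ ω n)) (1ᴳ ⊖ᴳ ω n) (rootSum n))
             (cong (conj (1ᴳ ⊖ᴳ ω n) *ᴳ_) (geometric-sum (ω n) p)))) ⟩
      ‖ conj (1ᴳ ⊖ᴳ ω n) *ᴳ (1ᴳ ⊖ᴳ ω n ^ᴳ p) ‖
        ≤⟨ ‖*‖ (conj (1ᴳ ⊖ᴳ ω n)) (1ᴳ ⊖ᴳ ω n ^ᴳ p) ⟩
      ‖ conj (1ᴳ ⊖ᴳ ω n) ‖ * ‖ 1ᴳ ⊖ᴳ ω n ^ᴳ p ‖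
        ≤⟨ *-monoʳ-≤-nonNeg (‖ 1ᴳ ⊖ᴳ ω n ^ᴳ p ‖) {{nonNegative (0≤‖ 1ᴳ ⊖ᴳ ω n ^ᴳ p ‖)}}
             (≤-trans (≤-reflexive (‖conj‖ (1ᴳ ⊖ᴳ ω n))) (≤-trans (‖+‖ 1ᴳ (-ᴳ ω n))
               (+-monoʳ-≤ 1ℚ (≤-trans (≤-reflexive (‖-‖ (ω n))) (ω≤B n))))) ⟩
      (1ℚ + B) * ‖ 1ᴳ ⊖ᴳ ω n ^ᴳ p ‖ ∎)
      (null-* (1ℚ + B) (+-nonneg 0≤1 0≤B) (≈₀-null (≈₀-sym ωᵖ≈1))))
    where
    open ≤-Reasoning
    normSquare : ℚ[i] → ℚ
    normSquare z = reᴳ z * reᴳ z + imᴳ z * imᴳ z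
    conj-* : ∀ z → realᴳ (normSquare z) ≡ conj z *ᴳ z
    conj-* (a ,ᴳ b) = cong₂ _,ᴳ_
      (solve 2 (λ a b → a :* a :+ b :* b := a :* a :+ :- (:- b :* b)) refl a b)
      (solve 2 (λ a b → con 0ℚ := a :* b :+ :- b :* a) refl a b)
    ‖conj‖ : ∀ z → ‖ conj z ‖ ≡ ‖ z ‖
    ‖conj‖ (a ,ᴳ b) = cong (∣ a ∣ +_) (∣-p∣≡∣p∣ b)

-- Bounds for the exponential and the logarithm.

^-suc-pos : ∀ {q} → 0ℚ < q → ∀ k → 0ℚ < q ^ k
^-suc-pos 0<q zero    = 0<1
^-suc-pos 0<q (suc k) = *-pos 0<q (^-suc-pos 0<q k)

^-≤1 : ∀ {q} → 0ℚ ≤ q → q ≤ 1ℚ → ∀ k → q ^ k ≤ 1ℚ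
^-≤1 0≤q q≤1 zero    = ≤-refl
^-≤1 0≤q q≤1 (suc k) = *-mono (^-nonneg 0≤q k) 0≤1 q≤1 (^-≤1 0≤q q≤1 k)

^-*-distrib : ∀ q r k → (q * r) ^ k ≡ q ^ k * r ^ k
^-*-distrib q r zero    = refl
^-*-distrib q r (suc k) = trans (cong (q * r *_) (^-*-distrib q r k))
  (solve 4 (λ q r a b → q :* r :* (a :* b) := q :* a :* (r :* b)) refl q r (q ^ k) (r ^ k))

^-+ : ∀ q j k → q ^ (j ℕ.+ k) ≡ q ^ j * q ^ k
^-+ q zero    k = sym (*-identityˡ (q ^ k))
^-+ q (suc j) k = trans (cong (q *_) (^-+ q j k)) (sym (*-assoc q (q ^ j) (q ^ k)))

^-swap : ∀ q j k → (q ^ j) ^ k ≡ (q ^ k) ^ j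
^-swap q zero    k = one k
  where
  one : ∀ k → 1ℚ ^ k ≡ 1ℚ
  one zero    = refl
  one (suc k) = trans (*-identityˡ (1ℚ ^ k)) (one k)
^-swap q (suc j) k = trans (^-*-distrib q (q ^ j) k) (cong (q ^ k *_) (^-swap q j k))

bernoulli : ∀ x → 0ℚ ≤ x → x ≤ 1ℚ → ∀ m → 1ℚ - natℚ m * x ≤ (1ℚ - x) ^ m
bernoulli x 0≤x x≤1 zero    = ≤-reflexive (solve 1 (λ x → con 1ℚ :- con 0ℚ :* x := con 1ℚ) refl x)
bernoulli x 0≤x x≤1 (suc m) = begin
  1ℚ - natℚ (suc m) * x
    ≡⟨ cong (λ k → 1ℚ - k * x) (natℚ-suc m) ⟩
  1ℚ - (1ℚ + natℚ m) * x
    ≤⟨ ≤-+ʳ _ (*-nonneg (natℚ-nonneg m) (*-nonneg 0≤x 0≤x)) ⟩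
  1ℚ - (1ℚ + natℚ m) * x + natℚ m * (x * x)
    ≡⟨ solve 2 (λ x k → con 1ℚ :- (con 1ℚ :+ k) :* x :+ k :* (x :* x) := (con 1ℚ :- x) :* (con 1ℚ :- k :* x)) refl x (natℚ m) ⟩
  (1ℚ - x) * (1ℚ - natℚ m * x)
    ≤⟨ *-monoˡ-≤-nonNeg (1ℚ - x) {{nonNegative (0≤1- x≤1)}} (bernoulli x 0≤x x≤1 m) ⟩
  (1ℚ - x) * (1ℚ - x) ^ m ∎
  where
  open ≤-Reasoning

P : ℕ → ℚ → ℚ
P = partialSum (λ _ → 1ℚ)

P-mono : ∀ {q r} → 0ℚ ≤ q → q ≤ r → ∀ n → P n q ≤ P n r
P-mono 0≤q q≤r zero    = ≤-refl
P-mono 0≤q q≤r (suc n) = +-mono-≤ (P-mono 0≤q q≤r n)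
  (*-monoˡ-≤-nonNeg 1ℚ (*-monoʳ-≤-nonNeg (recip! n) {{nonNegative (recip!-nonneg n)}} (^-mono 0≤q q≤r n)))

∣P∣≤ : ∀ q n → ∣ P n q ∣ ≤ P n ∣ q ∣
∣P∣≤ q zero    = ≤-refl
∣P∣≤ q (suc n) = ≤-trans (∣p+q∣≤∣p∣+∣q∣ (P n q) (1ℚ * (q ^ n * recip! n))) (+-mono-≤ (∣P∣≤ q n) (begin
  ∣ 1ℚ * (q ^ n * recip! n) ∣     ≡⟨ cong ∣_∣ (*-identityˡ (q ^ n * recip! n)) ⟩
  ∣ q ^ n * recip! n ∣            ≡⟨ trans (∣p*q∣≡∣p∣*∣q∣ (q ^ n) (recip! n)) (cong (∣ q ^ n ∣ *_) (0≤p⇒∣p∣≡p (recip!-nonneg n))) ⟩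
  ∣ q ^ n ∣ * recip! n            ≤⟨ *-monoʳ-≤-nonNeg (recip! n) {{nonNegative (recip!-nonneg n)}} (∣^∣ ≤-refl n) ⟩
  ∣ q ∣ ^ n * recip! n            ≡⟨ *-identityˡ (∣ q ∣ ^ n * recip! n) ⟨
  1ℚ * (∣ q ∣ ^ n * recip! n)     ∎))
  where open ≤-Reasoning

power-increment : ∀ a x → 0ℚ ≤ a → 0ℚ ≤ x → ∀ k →
                  (a + x) ^ suc k ≤ a ^ suc k + natℚ (suc k) * (x * (a + x) ^ k)
power-increment a x 0≤a 0≤x zero = ≤-reflexive
  (solve 2 (λ a x → (a :+ x) :* con 1ℚ := a :* con 1ℚ :+ con 1ℚ :* (x :* con 1ℚ)) refl a x)
power-increment a x 0≤a 0≤x (suc k) = begin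
  (a + x) * (a + x) ^ suc k
    ≡⟨ *-distribʳ-+ ((a + x) ^ suc k) a x ⟩
  a * (a + x) ^ suc k + x * (a + x) ^ suc k
    ≤⟨ +-monoˡ-≤ (x * (a + x) ^ suc k) (*-monoˡ-≤-nonNeg a {{nonNegative 0≤a}} (power-increment a x 0≤a 0≤x k)) ⟩
  a * (a ^ suc k + N * (x * (a + x) ^ k)) + x * (a + x) ^ suc k
    ≡⟨ solve 5 (λ a A n x S → a :* (A :+ n :* (x :* S)) :+ x :* ((a :+ x) :* S)
         := (a :* A :+ x :* ((a :+ x) :* S)) :+ n :* (x :* (a :* S))) refl a (a ^ suc k) N x ((a + x) ^ k) ⟩
  (a * a ^ suc k + x * (a + x) ^ suc k) + N * (x * (a * (a + x) ^ k))
    ≤⟨ +-monoʳ-≤ (a * a ^ suc k + x * (a + x) ^ suc k) (*-monoˡ-≤-nonNeg N {{nonNegative (natℚ-nonneg (suc k))}}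
         (*-monoˡ-≤-nonNeg x {{nonNegative 0≤x}}
           (*-monoʳ-≤-nonNeg ((a + x) ^ k) {{nonNegative (^-nonneg (+-nonneg 0≤a 0≤x) k)}} (≤-+ʳ a 0≤x)))) ⟩
  (a * a ^ suc k + x * (a + x) ^ suc k) + N * (x * ((a + x) * (a + x) ^ k))
    ≡⟨ solve 4 (λ A x S n → (A :+ x :* S) :+ n :* (x :* S) := A :+ (con 1ℚ :+ n) :* (x :* S)) refl
         (a * a ^ suc k) x ((a + x) ^ suc k) N ⟩
  a * a ^ suc k + (1ℚ + N) * (x * (a + x) ^ suc k)
    ≡⟨ cong (λ n → a * a ^ suc k + n * (x * (a + x) ^ suc k)) (natℚ-suc (suc k)) ⟨
  a ^ suc (suc k) + natℚ (suc (suc k)) * (x * (a + x) ^ suc k) ∎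
  where
  open ≤-Reasoning
  N = natℚ (suc k)

-- The mean value bound exp (a + x) - exp a ≤ x exp (a + x). It holds for partial sums because the
-- derivative of `P (suc n)` is `P n`.
P-increment : ∀ a x → 0ℚ ≤ a → 0ℚ ≤ x → ∀ n → P (suc n) (a + x) ≤ P (suc n) a + x * P n (a + x)
P-increment a x 0≤a 0≤x zero = ≤-reflexive (solve 1 (λ x → con 1ℚ := con 1ℚ :+ x :* con 0ℚ) refl x)
P-increment a x 0≤a 0≤x (suc n) = begin
  P (suc n) (a + x) + 1ℚ * ((a + x) ^ suc n * (r * R))
    ≤⟨ +-mono-≤ (P-increment a x 0≤a 0≤x n) (*-monoˡ-≤-nonNeg 1ℚ
         (*-monoʳ-≤-nonNeg (r * R) {{nonNegative (recip!-nonneg (suc n))}} (power-increment a x 0≤a 0≤x n))) ⟩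
  (P (suc n) a + x * P n (a + x)) + 1ℚ * ((a ^ suc n + N * (x * (a + x) ^ n)) * (r * R))
    ≡⟨ solve 8 (λ p x q A N S r R → (p :+ x :* q) :+ con 1ℚ :* ((A :+ N :* (x :* S)) :* (r :* R))
         := (p :+ con 1ℚ :* (A :* (r :* R))) :+ x :* (q :+ (N :* r) :* (S :* R))) refl
         (P (suc n) a) x (P n (a + x)) (a ^ suc n) N ((a + x) ^ n) r R ⟩
  P (suc (suc n)) a + x * (P n (a + x) + N * r * ((a + x) ^ n * R))
    ≡⟨ cong (λ k → P (suc (suc n)) a + x * (P n (a + x) + k * ((a + x) ^ n * R))) (recip-inverse n) ⟩
  P (suc (suc n)) a + x * P (suc n) (a + x) ∎
  where
  open ≤-Reasoning
  N = natℚ (suc n)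
  r = recip (suc n)
  R = recip! n

P-suc : ∀ q → 0ℚ ≤ q → ∀ n → P n q ≤ P (suc n) q
P-suc q 0≤q n = ≤-+ʳ (P n q) (*-nonneg 0≤1 (*-nonneg (^-nonneg 0≤q n) (recip!-nonneg n)))

P-step : ∀ a x → 0ℚ ≤ a → 0ℚ ≤ x → ∀ n → P n (a + x) * (1ℚ - x) ≤ P n a
P-step a x 0≤a 0≤x zero    = ≤-reflexive (*-zeroˡ (1ℚ - x))
P-step a x 0≤a 0≤x (suc n) = +-cancelʳ-≤ (x * S) (begin
  S * (1ℚ - x) + x * S          ≡⟨ solve 2 (λ s x → s :* (con 1ℚ :- x) :+ x :* s := s) refl S x ⟩
  S                             ≤⟨ P-increment a x 0≤a 0≤x n ⟩
  P (suc n) a + x * P n (a + x) ≤⟨ +-monoʳ-≤ (P (suc n) a) (*-monoˡ-≤-nonNeg x {{nonNegative 0≤x}} (P-suc (a + x) (+-nonneg 0≤a 0≤x) n)) ⟩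
  P (suc n) a + x * S           ∎)
  where
  open ≤-Reasoning
  S = P (suc n) (a + x)

-- Iterating `P-step` yields exp (m x) ≤ (1 - x)⁻ᵐ for every partial sum, without the functional
-- equation of exp.
P-multiple : ∀ x → 0ℚ ≤ x → x ≤ 1ℚ → ∀ m n → P n (natℚ m * x) * (1ℚ - x) ^ m ≤ 1ℚ
P-multiple x 0≤x x≤1 zero n = subst (_≤ 1ℚ) (trans (cong (P n) (sym (*-zeroˡ x))) (sym (*-identityʳ (P n (0ℚ * x))))) (P-0 n)
  where
  P-0 : ∀ n → P n 0ℚ ≤ 1ℚ
  P-0 zero          = 0≤1
  P-0 (suc zero)    = ≤-refl
  P-0 (suc (suc n)) = subst (_≤ 1ℚ) (solve 3 (λ p a b → p := p :+ con 1ℚ :* (con 0ℚ :* a :* b)) refl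
    (P (suc n) 0ℚ) (0ℚ ^ n) (recip! (suc n))) (P-0 (suc n))
P-multiple x 0≤x x≤1 (suc m) n = begin
  P n (natℚ (suc m) * x) * ((1ℚ - x) * (1ℚ - x) ^ m)
    ≡⟨ cong (λ q → P n q * ((1ℚ - x) * (1ℚ - x) ^ m)) (trans (cong (_* x) (natℚ-suc m))
         (solve 2 (λ k x → (con 1ℚ :+ k) :* x := k :* x :+ x) refl (natℚ m) x)) ⟩
  P n (natℚ m * x + x) * ((1ℚ - x) * (1ℚ - x) ^ m)
    ≡⟨ *-assoc (P n (natℚ m * x + x)) (1ℚ - x) ((1ℚ - x) ^ m) ⟨
  P n (natℚ m * x + x) * (1ℚ - x) * (1ℚ - x) ^ m
    ≤⟨ *-monoʳ-≤-nonNeg ((1ℚ - x) ^ m) {{nonNegative (^-nonneg (0≤1- x≤1) m)}}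
         (P-step (natℚ m * x) x (*-nonneg (natℚ-nonneg m) 0≤x) 0≤x n) ⟩
  P n (natℚ m * x) * (1ℚ - x) ^ m
    ≤⟨ P-multiple x 0≤x x≤1 m n ⟩
  1ℚ ∎
  where
  open ≤-Reasoning

-- If |l| < k/40 then eˡ ≤ (39/40)⁻ᵏ and e⁻¹⁶ˡ ≥ (39/40)¹⁶ᵏ ≥ (3/5)ᵏ, which exceeds (9/16)ᵏ.
log-lower-bound : ∀ (l δ : ℝ) k → exp l *ᴿ δ ≈ᴿ 1ᴿ →
  (∀ ε → 0ℚ < ε → ∃[ N ] (∀ n → N ℕ.≤ n → seq δ n ^ 16 ≤ (ℤ.+ 9 / 16) ^ suc k + ε)) →
  ∃[ N ] (∀ n → N ℕ.≤ n → natℚ (suc k) * (ℤ.+ 1 / 40) ≤ ∣ seq l n ∣)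
log-lower-bound l δ k inverse δ¹⁶≤ =
  let N₁ , c₁ = inverse (ℤ.+ 1 / 400) (positive⁻¹ (ℤ.+ 1 / 400))
      N₂ , c₂ = δ¹⁶≤ ε 0<ε
  in N₁ ℕ.⊔ N₂ , λ n n≥ → bound n (c₁ n (ℕₚ.m⊔n≤o⇒m≤o N₁ N₂ n≥)) (c₂ n (ℕₚ.m⊔n≤o⇒n≤o N₁ N₂ n≥))
  where
  open ≤-Reasoning
  x η y Y ε : ℚ
  -- Bernoulli gives (1 - x)¹⁶ ≥ 1 - 16/40 = 3/5 and (1 - η)¹⁶ ≥ 1 - 16/400 = 24/25. As 9/16 = 15/16
  -- · 3/5, the slack 1/64 in ε leaves 15/16 + 1/64 = 61/64, still below 24/25.
  x = ℤ.+ 1 / 40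
  η = ℤ.+ 1 / 400
  y = (1ℚ - x) ^ suc k
  Y = (ℤ.+ 3 / 5) ^ suc k
  ε = (ℤ.+ 1 / 64) * Y
  0≤x : 0ℚ ≤ x
  0≤x = nonNegative⁻¹ x
  0<Y : 0ℚ < Y
  0<Y = ^-suc-pos (positive⁻¹ (ℤ.+ 3 / 5)) (suc k)
  0<ε : 0ℚ < ε
  0<ε = *-pos (positive⁻¹ (ℤ.+ 1 / 64)) 0<Y
  0≤y : 0ℚ ≤ y
  0≤y = ^-nonneg (nonNegative⁻¹ (1ℚ - x)) (suc k)
  Y≤y¹⁶ : Y ≤ y ^ 16
  Y≤y¹⁶ = begin
    (ℤ.+ 3 / 5) ^ suc k         ≤⟨ ^-mono (nonNegative⁻¹ (ℤ.+ 3 / 5)) (bernoulli x 0≤x (toWitness {a? = x ≤? 1ℚ} _) 16) (suc k) ⟩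
    ((1ℚ - x) ^ 16) ^ suc k     ≡⟨ ^-swap (1ℚ - x) 16 (suc k) ⟩
    y ^ 16                      ∎
  ratio : (ℤ.+ 9 / 16) ^ suc k ≤ (ℤ.+ 15 / 16) * Y
  ratio = begin
    (ℤ.+ 9 / 16) ^ suc k
      ≡⟨ ^-*-distrib (ℤ.+ 15 / 16) (ℤ.+ 3 / 5) (suc k) ⟩
    (ℤ.+ 15 / 16) * (ℤ.+ 15 / 16) ^ k * Y
      ≤⟨ *-monoʳ-≤-nonNeg Y {{nonNegative (<⇒≤ 0<Y)}} (*-monoˡ-≤-nonNeg (ℤ.+ 15 / 16) (^-≤1 (nonNegative⁻¹ (ℤ.+ 15 / 16)) (toWitness {a? = (ℤ.+ 15 / 16) ≤? 1ℚ} _) k)) ⟩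
    (ℤ.+ 15 / 16) * 1ℚ * Y
      ≡⟨ cong (_* Y) (*-identityʳ (ℤ.+ 15 / 16)) ⟩
    (ℤ.+ 15 / 16) * Y ∎
  bound : ∀ n → ∣ P n (seq l n) * seq δ n - 1ℚ ∣ ≤ η → seq δ n ^ 16 ≤ (ℤ.+ 9 / 16) ^ suc k + ε →
          natℚ (suc k) * x ≤ ∣ seq l n ∣
  bound n close δ≤ with natℚ (suc k) * x ≤? ∣ seq l n ∣
  ... | yes le = le
  ... | no ¬le = ⊥-elim (<-irrefl refl (<-≤-trans (toWitness {a? = (ℤ.+ 61 / 64) <? (ℤ.+ 24 / 25)} _) contradictory))
    where
    a = P n (seq l n)
    d = seq δ n
    -- The approximations of l may be negative, so the estimate passes through the partial sum at
    -- |l|.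
    ∣a∣y≤1 : ∣ a * y ∣ ≤ 1ℚ
    ∣a∣y≤1 = begin
      ∣ a * y ∣          ≡⟨ trans (∣p*q∣≡∣p∣*∣q∣ a y) (cong (∣ a ∣ *_) (0≤p⇒∣p∣≡p 0≤y)) ⟩
      ∣ a ∣ * y          ≤⟨ *-monoʳ-≤-nonNeg y {{nonNegative 0≤y}} (≤-trans (∣P∣≤ (seq l n) n)
                              (P-mono (0≤∣p∣ (seq l n)) (<⇒≤ (≰⇒> ¬le)) n)) ⟩
      P n (natℚ (suc k) * x) * y  ≤⟨ P-multiple x 0≤x (toWitness {a? = x ≤? 1ℚ} _) (suc k) n ⟩
      1ℚ                 ∎
    1-η≤ad : 1ℚ - η ≤ a * d
    1-η≤ad = +-cancelʳ-≤ η (begin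
      1ℚ - η + η              ≡⟨ solve 1 (λ e → con 1ℚ :- e :+ e := con 1ℚ) refl η ⟩
      1ℚ                      ≡⟨ solve 1 (λ s → con 1ℚ := s :+ :- (s :- con 1ℚ)) refl (a * d) ⟩
      a * d + - (a * d - 1ℚ)  ≤⟨ +-monoʳ-≤ (a * d) (≤-trans (p≤∣p∣ (- (a * d - 1ℚ)))
                                   (≤-trans (≤-reflexive (∣-p∣≡∣p∣ (a * d - 1ℚ))) close)) ⟩
      a * d + η               ∎)
    even : ∀ q → 0ℚ ≤ q ^ 16
    even q = subst (0ℚ ≤_) (sym (^-+ q 8 8)) (square≥0 (q ^ 8))
    contradictory : ℤ.+ 24 / 25 ≤ ℤ.+ 61 / 64
    contradictory = *-cancelʳ-≤-pos Y {{positive 0<Y}} (begin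
      (ℤ.+ 24 / 25) * Y
        ≤⟨ *-mono (<⇒≤ 0<Y) (^-nonneg (nonNegative⁻¹ (1ℚ - η)) 16) (bernoulli η (nonNegative⁻¹ η) (toWitness {a? = η ≤? 1ℚ} _) 16) Y≤y¹⁶ ⟩
      (1ℚ - η) ^ 16 * y ^ 16
        ≤⟨ *-monoʳ-≤-nonNeg (y ^ 16) {{nonNegative (^-nonneg 0≤y 16)}} (^-mono (nonNegative⁻¹ (1ℚ - η)) 1-η≤ad 16) ⟩
      (a * d) ^ 16 * y ^ 16
        ≡⟨ trans (sym (^-*-distrib (a * d) y 16)) (trans (cong (_^ 16)
             (solve 3 (λ a d y → a :* d :* y := a :* y :* d) refl a d y)) (^-*-distrib (a * y) d 16)) ⟩
      (a * y) ^ 16 * d ^ 16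
        ≤⟨ *-monoʳ-≤-nonNeg (d ^ 16) {{nonNegative (even d)}} (≤-trans (p≤∣p∣ ((a * y) ^ 16)) (∣^∣ ∣a∣y≤1 16)) ⟩
      1ℚ * d ^ 16
        ≡⟨ *-identityˡ (d ^ 16) ⟩
      d ^ 16
        ≤⟨ ≤-trans δ≤ (+-monoˡ-≤ ε ratio) ⟩
      (ℤ.+ 15 / 16) * Y + (ℤ.+ 1 / 64) * Y
        ≡⟨ *-distribʳ-+ Y (ℤ.+ 15 / 16) (ℤ.+ 1 / 64) ⟨
      (ℤ.+ 61 / 64) * Y ∎)

-- The Gowers mean of a cubic at each rational approximation.

natᴳ-+ : ∀ a b → natᴳ (a ℕ.+ b) ≡ natᴳ a +ᴳ natᴳ b
natᴳ-+ zero    b = sym (G.+-identityˡ (natᴳ b))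
natᴳ-+ (suc a) b = trans (natᴳ-suc (a ℕ.+ b)) (trans (cong (1ᴳ +ᴳ_) (natᴳ-+ a b))
  (trans (sym (G.+-assoc 1ᴳ (natᴳ a) (natᴳ b))) (cong (_+ᴳ natᴳ b) (sym (natᴳ-suc a)))))

natᴳ-* : ∀ a b → natᴳ (a ℕ.* b) ≡ natᴳ a *ᴳ natᴳ b
natᴳ-* zero    b = sym (G.zeroˡ (natᴳ b))
natᴳ-* (suc a) b = trans (natᴳ-+ b (a ℕ.* b)) (trans (cong (natᴳ b +ᴳ_) (natᴳ-* a b))
  (trans (solveᴳ 2 (λ a b → b ⊞ a ⊠ b ⩵ (𝟙 ⊞ a) ⊠ b) refl (natᴳ a) (natᴳ b)) (cong (_*ᴳ natᴳ b) (sym (natᴳ-suc a)))))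

-- The k-th rational approximation, a homomorphism from ℂ to ℚ[i].
approx : ℕ → ℂ → ℚ[i]
approx k z = seq (re z) k ,ᴳ seq (im z) k

approx-^ : ∀ k z m → approx k (z ^ᶜ m) ≡ approx k z ^ᴳ m
approx-^ k z zero    = refl
approx-^ k z (suc m) = cong (approx k z *ᴳ_) (approx-^ k z m)

approx-· : ∀ k q z → approx k (q ·ᶜ z) ≡ realᴳ q *ᴳ approx k z
approx-· k q z = cong₂ _,ᴳ_
  (solve 3 (λ q a b → q :* a := q :* a :+ :- (con 0ℚ :* b)) refl q (seq (re z) k) (seq (im z) k))
  (solve 3 (λ q a b → q :* b := q :* b :+ con 0ℚ :* a) refl q (seq (re z) k) (seq (im z) k))

real-* : ∀ q r → realᴳ q *ᴳ realᴳ r ≡ realᴳ (q * r)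
real-* q r = cong₂ _,ᴳ_ (solve 2 (λ q r → q :* r :+ :- (con 0ℚ :* con 0ℚ) := q :* r) refl q r)
                        (solve 2 (λ q r → q :* con 0ℚ :+ con 0ℚ :* r := con 0ℚ) refl q r)

approx-𝔼 : ∀ k {A : Set} (xs : List A) (h : A → ℂ) →
           approx k (𝔼 xs h) ≡ realᴳ (recip (List.length xs)) *ᴳ List.foldr (λ x s → approx k (h x) +ᴳ s) 0ᴳ xs
approx-𝔼 k xs h = trans (approx-· k (recip (List.length xs)) (List.foldr (λ x s → h x +ᶜ s) 0ᶜ xs))
  (cong (realᴳ (recip (List.length xs)) *ᴳ_) (approx-sum xs))
  where
  approx-sum : ∀ xs → approx k (List.foldr (λ x s → h x +ᶜ s) 0ᶜ xs) ≡ List.foldr (λ x s → approx k (h x) +ᴳ s) 0ᴳ xs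
  approx-sum []       = refl
  approx-sum (x ∷ xs) = cong (approx k (h x) +ᴳ_) (approx-sum xs)

module IteratedSums (p : ℕ) .{{_ : NonZero p}} {c ℓ} (M : CommutativeMonoid c ℓ) where

  open PrimeField p
  open CommutativeMonoid M using (Carrier; _≈_; identityʳ) renaming (trans to ≈-trans)
  open VecSums p M

  sum-4-tuples : ∀ n (h : Vec (Vec 𝔽 n) 4 → Carrier) →
    sumList (vectors (vectors (List.allFin p) n) 4) h
    ≈ ∑ᵛ n λ x → ∑ᵛ n λ y → ∑ᵛ n λ z → ∑ᵛ n λ w → h (x ∷ y ∷ z ∷ w ∷ [])
  sum-4-tuples n h =
    layer 3 h λ x → layer 2 (λ v → h (x ∷ v)) λ y → layer 1 (λ v → h (x ∷ y ∷ v)) λ z →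
    layer 0 (λ v → h (x ∷ y ∷ z ∷ v)) λ w → identityʳ (h (x ∷ y ∷ z ∷ w ∷ []))
    where
    layer : ∀ m (h : Vec (Vec 𝔽 n) (suc m) → Carrier) {s : Vec 𝔽 n → Carrier} →
            (∀ x → sumList (vectors (vectors (List.allFin p) n) m) (λ v → h (x ∷ v)) ≈ s x) →
            sumList (vectors (vectors (List.allFin p) n) (suc m)) h ≈ ∑ᵛ n s
    layer m h e = ≈-trans (sumList-vectors (vectors (List.allFin p) n) m h)
      (≈-trans (sumList-∑ᵛ n λ x → sumList (vectors (vectors (List.allFin p) n) m) (λ v → h (x ∷ v)))
        (∑ᵛ-cong n e))

module Mean (p : ℕ) .{{_ : NonZero p}} (pr : Prime p) (n : ℕ) {f : Vec (Fin p) n → Fin p}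
            (cubic : Differences.Vanish p 4 f) where

  open PrimeField p
  open Differences p
  open Decomposition p
  open Trilinear p pr n
  open Cubic cubic
  open ℕSums p using () renaming (∑ᵛ to ∑ℕ; ∑ᵛ-const to ∑ℕ-const; ∑ᵛ-*ʳ to ∑ℕ-*ʳ; ∑ᵛ-cong to ∑ℕ-cong; sumList to sumListℕ)
  open VecSums p G.+-commutativeMonoid
  open ≡-Reasoning

  private
    T′ : V → V → V → 𝔽
    T′ = third f

  listLength : ∀ {A : Set} (xs : List A) → List.length xs ≡ sumListℕ xs (λ _ → 1)
  listLength []       = refl
  listLength (x ∷ xs) = cong suc (listLength xs)

  pⁿ M : ℕ
  pⁿ = p ℕ.^ n
  M = pⁿ ℕ.* pⁿ

  ∑²-const : ∀ k → ∑ℕ n (λ _ → ∑ℕ n λ _ → k) ≡ M ℕ.* k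
  ∑²-const k = trans (∑ℕ-cong n λ _ → ∑ℕ-const n k) (trans (∑ℕ-const n (pⁿ ℕ.* k)) (sym (ℕₚ.*-assoc pⁿ pⁿ k)))

  length-4-tuples : List.length (vectors (vectors (List.allFin p) n) 4) ≡ M ℕ.* M
  length-4-tuples = begin
    List.length (vectors (vectors (List.allFin p) n) 4)
      ≡⟨ listLength (vectors (vectors (List.allFin p) n) 4) ⟩
    sumListℕ (vectors (vectors (List.allFin p) n) 4) (λ _ → 1)
      ≡⟨ IteratedSums.sum-4-tuples p ℕₚ.+-0-commutativeMonoid n (λ _ → 1) ⟩
    ∑ℕ n (λ _ → ∑ℕ n λ _ → ∑ℕ n λ _ → ∑ℕ n λ _ → 1)
      ≡⟨ ∑ℕ-cong n (λ _ → ∑ℕ-cong n λ _ → ∑²-const 1) ⟩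
    ∑ℕ n (λ _ → ∑ℕ n λ _ → M ℕ.* 1)
      ≡⟨ trans (∑²-const (M ℕ.* 1)) (cong (M ℕ.*_) (ℕₚ.*-identityʳ M)) ⟩
    M ℕ.* M ∎

  sum-linear : ∀ {m} (u v : Fin m → ℕ) A B →
    sum (λ i → natᴳ (u i) *ᴳ A +ᴳ natᴳ (v i) *ᴳ B) ≡ natᴳ (ℕSums.sum p u) *ᴳ A +ᴳ natᴳ (ℕSums.sum p v) *ᴳ B
  sum-linear {zero}  u v A B = solveᴳ 2 (λ a b → 𝟘 ⩵ 𝟘 ⊠ a ⊞ 𝟘 ⊠ b) refl A B
  sum-linear {suc m} u v A B = trans (cong (natᴳ (u zero) *ᴳ A +ᴳ natᴳ (v zero) *ᴳ B +ᴳ_) (sum-linear (u ∘ suc) (v ∘ suc) A B))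
    (trans (solveᴳ 6 (λ x y s t a b → (x ⊠ a ⊞ y ⊠ b) ⊞ (s ⊠ a ⊞ t ⊠ b) ⩵ (x ⊞ s) ⊠ a ⊞ (y ⊞ t) ⊠ b) refl
        (natᴳ (u zero)) (natᴳ (v zero)) (natᴳ (ℕSums.sum p (u ∘ suc))) (natᴳ (ℕSums.sum p (v ∘ suc))) A B)
      (sym (cong₂ (λ s t → s *ᴳ A +ᴳ t *ᴳ B) (natᴳ-+ (u zero) (ℕSums.sum p (u ∘ suc))) (natᴳ-+ (v zero) (ℕSums.sum p (v ∘ suc))))))

  ∑ᵛ-linear : ∀ k (u v : Vec 𝔽 k → ℕ) A B →
    ∑ᵛ k (λ x → natᴳ (u x) *ᴳ A +ᴳ natᴳ (v x) *ᴳ B) ≡ natᴳ (∑ℕ k u) *ᴳ A +ᴳ natᴳ (∑ℕ k v) *ᴳ B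
  ∑ᵛ-linear zero    u v A B = refl
  ∑ᵛ-linear (suc k) u v A B = trans (sum-cong-≗ λ a → ∑ᵛ-linear k (λ x → u (a ∷ x)) (λ x → v (a ∷ x)) A B)
    (sum-linear (λ a → ∑ℕ k λ x → u (a ∷ x)) (λ a → ∑ℕ k λ x → v (a ∷ x)) A B)

  ∑ᵛ-const : ∀ k A → ∑ᵛ k (λ _ → A) ≡ natᴳ (p ℕ.^ k) *ᴳ A
  ∑ᵛ-const k A = begin
    ∑ᵛ k (λ _ → A)
      ≡⟨ ∑ᵛ-cong k (λ _ → solveᴳ 1 (λ a → a ⩵ 𝟙 ⊠ a ⊞ 𝟘 ⊠ 𝟘) refl A) ⟩
    ∑ᵛ k (λ _ → natᴳ 1 *ᴳ A +ᴳ natᴳ 0 *ᴳ 0ᴳ)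
      ≡⟨ ∑ᵛ-linear k (λ _ → 1) (λ _ → 0) A 0ᴳ ⟩
    natᴳ (∑ℕ k λ _ → 1) *ᴳ A +ᴳ natᴳ (∑ℕ k λ _ → 0) *ᴳ 0ᴳ
      ≡⟨ cong₂ _+ᴳ_ (cong (λ s → natᴳ s *ᴳ A) (trans (∑ℕ-const k 1) (ℕₚ.*-identityʳ (p ℕ.^ k)))) (G.zeroʳ (natᴳ (∑ℕ k λ _ → 0))) ⟩
    natᴳ (p ℕ.^ k) *ᴳ A +ᴳ 0ᴳ
      ≡⟨ G.+-identityʳ (natᴳ (p ℕ.^ k) *ᴳ A) ⟩
    natᴳ (p ℕ.^ k) *ᴳ A ∎

  sum-constᴳ : ∀ m A → sum {m} (λ _ → A) ≡ natᴳ m *ᴳ A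
  sum-constᴳ zero    A = sym (G.zeroˡ A)
  sum-constᴳ (suc m) A = trans (cong (A +ᴳ_) (sum-constᴳ m A))
    (trans (solveᴳ 2 (λ m a → a ⊞ m ⊠ a ⩵ (𝟙 ⊞ m) ⊠ a) refl (natᴳ m) A) (cong (_*ᴳ A) (sym (natᴳ-suc m))))

  module Character (ω : ℚ[i]) where

    χ : 𝔽 → ℚ[i]
    χ a = ω ^ᴳ toℕ a

    γ : ℚ[i]
    γ = realᴳ (recip p) *ᴳ sum χ

    -- On every line in direction `e` the values of φ run once through 𝔽. This uses no property of
    -- ω, so it applies to an approximation that is not itself a root of unity.
    character-sum : ∀ (φ : V → 𝔽) → Additive φ → ∀ e → φ e ≡ 1ᶠ → ∑ᵛ n (χ ∘ φ) ≡ natᴳ pⁿ *ᴳ γ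
    character-sum φ add e φe≡1 = begin
      ∑ᵛ n (χ ∘ φ)
        ≡⟨ trans (sym (G.*-identityˡ (∑ᵛ n (χ ∘ φ)))) (cong (_*ᴳ ∑ᵛ n (χ ∘ φ)) (sym (recip-inverseᴳ p))) ⟩
      realᴳ (recip p) *ᴳ natᴳ p *ᴳ ∑ᵛ n (χ ∘ φ)
        ≡⟨ trans (G.*-assoc (realᴳ (recip p)) (natᴳ p) (∑ᵛ n (χ ∘ φ))) (cong (realᴳ (recip p) *ᴳ_) (begin
             natᴳ p *ᴳ ∑ᵛ n (χ ∘ φ)
               ≡⟨ sum-constᴳ p (∑ᵛ n (χ ∘ φ)) ⟨
             sum {p} (λ _ → ∑ᵛ n (χ ∘ φ))
               ≡⟨ ∑ᵛ-lines n e (χ ∘ φ) ⟨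
             ∑ᵛ n (λ w → sum λ c → χ (φ (w ⊕ c • e)))
               ≡⟨ ∑ᵛ-cong n (λ w → trans (sum-cong-≗ λ c → cong χ (shift w c)) (sum-translate (φ w) χ)) ⟩
             ∑ᵛ n (λ _ → sum χ)
               ≡⟨ ∑ᵛ-const n (sum χ) ⟩
             natᴳ pⁿ *ᴳ sum χ ∎)) ⟩
      realᴳ (recip p) *ᴳ (natᴳ pⁿ *ᴳ sum χ)
        ≡⟨ solveᴳ 3 (λ r m s → r ⊠ (m ⊠ s) ⩵ m ⊠ (r ⊠ s)) refl (realᴳ (recip p)) (natᴳ pⁿ) (sum χ) ⟩
      natᴳ pⁿ *ᴳ γ ∎
      where
      shift : ∀ w c → φ (w ⊕ c • e) ≡ c +ᶠ φ w
      shift w c = trans (add w (c • e)) (trans (cong (φ w +ᶠ_) (trans (additive-• {φ = φ} add c e)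
        (trans (cong (c *ᶠ_) φe≡1) (F.*-identityʳ c)))) (F.+-comm (φ w) c))

    -- The inner sum is pⁿ γ off the kernel and pⁿ on it. Writing both as one combination of γ and 1
    -- - γ with natural coefficients reduces the outer sums to counting.
    kernel-sum : ∀ y z (d : ∃ (λ w → T′ y z w ≢ 0ᶠ) ⊎ Kernel cubic y z) → ∑ᵛ n (λ w → χ (T′ y z w))
               ≡ natᴳ pⁿ *ᴳ γ +ᴳ natᴳ (indicator cubic d ℕ.* pⁿ) *ᴳ (1ᴳ ⊖ᴳ γ)
    kernel-sum y z (inj₁ (w , Tw≢0)) = trans
      (character-sum (T′ y z) (third-additive₃ y z) (i • w)
        (trans (additive-• {φ = T′ y z} (third-additive₃ y z) i w) (proj₂ (inverse pr (T′ y z w) Tw≢0))))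
      (solveᴳ 2 (λ m g → m ⊠ g ⩵ m ⊠ g ⊞ 𝟘 ⊠ (𝟙 ⊞ ⊟ g)) refl (natᴳ pⁿ) γ)
      where i = proj₁ (inverse pr (T′ y z w) Tw≢0)
    kernel-sum y z (inj₂ T≡0) = begin
      ∑ᵛ n (λ w → χ (T′ y z w))
        ≡⟨ ∑ᵛ-cong n (λ w → cong (ω ^ᴳ_) (trans (cong toℕ (T≡0 w)) (toℕ-⟦⟧ 0))) ⟩
      ∑ᵛ n (λ w → ω ^ᴳ (0 ℕ.% p))
        ≡⟨ ∑ᵛ-cong n (λ w → cong (ω ^ᴳ_) (0%p)) ⟩
      ∑ᵛ n (λ w → 1ᴳ)
        ≡⟨ ∑ᵛ-const n 1ᴳ ⟩
      natᴳ pⁿ *ᴳ 1ᴳ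
        ≡⟨ solveᴳ 2 (λ m g → m ⊠ 𝟙 ⩵ m ⊠ g ⊞ m ⊠ (𝟙 ⊞ ⊟ g)) refl (natᴳ pⁿ) γ ⟩
      natᴳ pⁿ *ᴳ γ +ᴳ natᴳ pⁿ *ᴳ (1ᴳ ⊖ᴳ γ)
        ≡⟨ cong (λ s → natᴳ pⁿ *ᴳ γ +ᴳ natᴳ s *ᴳ (1ᴳ ⊖ᴳ γ)) (ℕₚ.*-identityˡ pⁿ) ⟨
      natᴳ pⁿ *ᴳ γ +ᴳ natᴳ (1 ℕ.* pⁿ) *ᴳ (1ᴳ ⊖ᴳ γ) ∎
      where
      open import Data.Nat.DivMod using (m*n%n≡0)
      0%p : 0 ℕ.% p ≡ 0
      0%p = m*n%n≡0 0 p

    kernelWeight : V → V → ℕ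
    kernelWeight y z = indicator cubic (kernel? cubic y z) ℕ.* pⁿ

    sum₂ : ∀ y → ∑ᵛ n (λ z → ∑ᵛ n λ w → χ (T′ y z w))
         ≡ natᴳ (∑ℕ n λ _ → pⁿ) *ᴳ γ +ᴳ natᴳ (∑ℕ n (kernelWeight y)) *ᴳ (1ᴳ ⊖ᴳ γ)
    sum₂ y = trans (∑ᵛ-cong n λ z → kernel-sum y z (kernel? cubic y z))
      (∑ᵛ-linear n (λ _ → pⁿ) (kernelWeight y) γ (1ᴳ ⊖ᴳ γ))

    sum₃ : ∑ᵛ n (λ y → ∑ᵛ n λ z → ∑ᵛ n λ w → χ (T′ y z w))
         ≡ natᴳ (∑ℕ n λ _ → ∑ℕ n λ _ → pⁿ) *ᴳ γ +ᴳ natᴳ (∑ℕ n λ y → ∑ℕ n (kernelWeight y)) *ᴳ (1ᴳ ⊖ᴳ γ)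
    sum₃ = trans (∑ᵛ-cong n sum₂) (∑ᵛ-linear n (λ _ → ∑ℕ n λ _ → pⁿ) (λ y → ∑ℕ n (kernelWeight y)) γ (1ᴳ ⊖ᴳ γ))

    sum₄ : ∑ᵛ n (λ x → ∑ᵛ n λ y → ∑ᵛ n λ z → ∑ᵛ n λ w → χ (T′ y z w))
         ≡ natᴳ (∑ℕ n λ _ → ∑ℕ n λ _ → ∑ℕ n λ _ → pⁿ) *ᴳ γ +ᴳ natᴳ (∑ℕ n λ _ → ∑ℕ n λ y → ∑ℕ n (kernelWeight y)) *ᴳ (1ᴳ ⊖ᴳ γ)
    sum₄ = trans (∑ᵛ-cong n λ _ → sum₃)
      (∑ᵛ-linear n (λ _ → ∑ℕ n λ _ → ∑ℕ n λ _ → pⁿ) (λ _ → ∑ℕ n λ y → ∑ℕ n (kernelWeight y)) γ (1ᴳ ⊖ᴳ γ))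

    total-sum : ∑ᵛ n (λ x → ∑ᵛ n λ y → ∑ᵛ n λ z → ∑ᵛ n λ w → χ (T′ y z w))
              ≡ natᴳ (M ℕ.* M) *ᴳ γ +ᴳ natᴳ (M ℕ.* kernelPairs cubic) *ᴳ (1ᴳ ⊖ᴳ γ)
    total-sum = subst₂ (λ s t → ∑ᵛ n (λ x → ∑ᵛ n λ y → ∑ᵛ n λ z → ∑ᵛ n λ w → χ (T′ y z w)) ≡ natᴳ s *ᴳ γ +ᴳ natᴳ t *ᴳ (1ᴳ ⊖ᴳ γ))
      (trans (∑ℕ-cong n λ _ → ∑²-const pⁿ) (trans (∑ℕ-const n (M ℕ.* pⁿ)) (regroup pⁿ)))
      (trans (∑ℕ-const n _) (trans (cong (pⁿ ℕ.*_) weights) (regroup′ pⁿ (kernelPairs cubic))))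
      sum₄
      where
      weights : (∑ℕ n λ y → ∑ℕ n (kernelWeight y)) ≡ kernelPairs cubic ℕ.* pⁿ
      weights = trans (∑ℕ-cong n λ y → sym (∑ℕ-*ʳ n (λ z → indicator cubic (kernel? cubic y z)) pⁿ))
                      (sym (∑ℕ-*ʳ n (kernelSize cubic) pⁿ))
      regroup : ∀ a → a ℕ.* (a ℕ.* a ℕ.* a) ≡ a ℕ.* a ℕ.* (a ℕ.* a)
      regroup = ℕ-Solver.solve-∀
      regroup′ : ∀ a b → a ℕ.* (b ℕ.* a) ≡ a ℕ.* a ℕ.* b
      regroup′ = ℕ-Solver.solve-∀

  -- This is `kernelPairs` divided by M. The factor M is left uncancelled because the mean divides
  -- by the number M² of quadruples, and the sums over x and w contribute M to the numerator.
  β : ℚ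
  β = recip (M ℕ.* M) * natℚ (M ℕ.* kernelPairs cubic)

  private
    tuples : List (Vec V 4)
    tuples = vectors (vectors (List.allFin p) n) 4

    phase : ℂ → Vec V 4 → ℂ
    phase ζ v = ζ ^ᶜ toℕ (Δ* (Vec.tail v) f (Vec.head v))

    approx-phase : ∀ ζ k x y z w → approx k (phase ζ (x ∷ y ∷ z ∷ w ∷ [])) ≡ approx k ζ ^ᴳ toℕ (T′ y z w)
    approx-phase ζ k x y z w = trans (approx-^ k ζ (toℕ (Δ* (y ∷ z ∷ w ∷ []) f x)))
      (cong (λ a → approx k ζ ^ᴳ toℕ a) (third-constant y z w x))

    approx-total : ∀ ζ k → let open Character (approx k ζ) in
      sumList tuples (approx k ∘ phase ζ)
      ≡ natᴳ (M ℕ.* M) *ᴳ γ +ᴳ natᴳ (M ℕ.* kernelPairs cubic) *ᴳ (1ᴳ ⊖ᴳ γ)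
    approx-total ζ k = trans (IteratedSums.sum-4-tuples p G.+-commutativeMonoid n (approx k ∘ phase ζ))
      (trans (∑ᵛ-cong n λ x → ∑ᵛ-cong n λ y → ∑ᵛ-cong n λ z → ∑ᵛ-cong n λ w → approx-phase ζ k x y z w)
        (Character.total-sum (approx k ζ)))

    M²≢0 : NonZero (M ℕ.* M)
    M²≢0 = ℕₚ.m*n≢0 M M {{M≢0}} {{M≢0}}
      where
      pⁿ≢0 : NonZero pⁿ
      pⁿ≢0 = ℕₚ.m^n≢0 p n
      M≢0 : NonZero M
      M≢0 = ℕₚ.m*n≢0 pⁿ pⁿ {{pⁿ≢0}} {{pⁿ≢0}}

  normalise : ∀ g → realᴳ (recip (M ℕ.* M)) *ᴳ (natᴳ (M ℕ.* M) *ᴳ g +ᴳ natᴳ (M ℕ.* kernelPairs cubic) *ᴳ (1ᴳ ⊖ᴳ g))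
            ≡ g +ᴳ realᴳ β *ᴳ (1ᴳ ⊖ᴳ g)
  normalise g = trans
    (solveᴳ 4 (λ r l g m → r ⊠ (l ⊠ g ⊞ m ⊠ (𝟙 ⊞ ⊟ g)) ⩵ (r ⊠ l) ⊠ g ⊞ (r ⊠ m) ⊠ (𝟙 ⊞ ⊟ g)) refl
      (realᴳ (recip (M ℕ.* M))) (natᴳ (M ℕ.* M)) g (natᴳ (M ℕ.* kernelPairs cubic)))
    (cong₂ _+ᴳ_ (trans (cong (_*ᴳ g) (recip-inverseᴳ (M ℕ.* M) {{M²≢0}})) (G.*-identityˡ g))
      (cong (_*ᴳ (1ᴳ ⊖ᴳ g)) (real-* (recip (M ℕ.* M)) (natℚ (M ℕ.* kernelPairs cubic)))))

  -- A name for the unfolded Gowers mean, with a variable in place of ω: comparing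
  -- real numbers by unfolding would also compare their Cauchy proofs.
  character-mean : ℂ → ℕ → ℂ
  character-mean ζ d = 𝔼 (vectors (vectors (List.allFin p) n) (suc d))
    λ v → ζ ^ᶜ toℕ (PrimeField.Δ* p (Vec.tail v) f (Vec.head v))

  gowersMean≡ : ∀ π d → PrimeField.gowersMean p π d f ≡ character-mean (PrimeField.ω p π) d
  gowersMean≡ π d = refl

  approx-character-mean : ∀ ζ d k → approx k (character-mean ζ d)
    ≡ realᴳ (recip (List.length (vectors (vectors (List.allFin p) n) (suc d))))
      *ᴳ List.foldr (λ v s → approx k (ζ ^ᶜ toℕ (PrimeField.Δ* p (Vec.tail v) f (Vec.head v))) +ᴳ s) 0ᴳ
           (vectors (vectors (List.allFin p) n) (suc d))
  approx-character-mean ζ d k = approx-𝔼 k (vectors (vectors (List.allFin p) n) (suc d))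
    λ v → ζ ^ᶜ toℕ (PrimeField.Δ* p (Vec.tail v) f (Vec.head v))

  mean-approx : ∀ ζ k → let open Character (approx k ζ) in
                approx k (character-mean ζ 3) ≡ γ +ᴳ realᴳ β *ᴳ (1ᴳ ⊖ᴳ γ)
  mean-approx ζ k = trans (approx-character-mean ζ 3 k)
    (trans (cong₂ (λ L s → realᴳ (recip L) *ᴳ s) length-eq sum-eq) (normalise (Character.γ (approx k ζ))))
    where
    length-eq : List.length (vectors (vectors (List.allFin p) n) (suc 3)) ≡ M ℕ.* M
    length-eq = length-4-tuples
    sum-eq : List.foldr (λ v s → approx k (ζ ^ᶜ toℕ (PrimeField.Δ* p (Vec.tail v) f (Vec.head v))) +ᴳ s) 0ᴳ
               (vectors (vectors (List.allFin p) n) (suc 3))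
           ≡ natᴳ (M ℕ.* M) *ᴳ Character.γ (approx k ζ) +ᴳ natᴳ (M ℕ.* kernelPairs cubic) *ᴳ (1ᴳ ⊖ᴳ Character.γ (approx k ζ))
    sum-eq = approx-total ζ k

  mean-approx-≡ : ∀ z ζ → z ≡ character-mean ζ 3 → ∀ k → let open Character (approx k ζ) in
                  approx k z ≡ γ +ᴳ realᴳ β *ᴳ (1ᴳ ⊖ᴳ γ)
  mean-approx-≡ z ζ refl = mean-approx ζ

-- From the mean to bounds on δ and on the number of products.

natℚ-* : ∀ a b → natℚ (a ℕ.* b) ≡ natℚ a * natℚ b
natℚ-* a b = trans (cong reᴳ (natᴳ-* a b))
  (solve 2 (λ a b → a :* b :+ :- (con 0ℚ :* con 0ℚ) := a :* b) refl (natℚ a) (natℚ b))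

re²+im²≤ : ∀ z → reᴳ z * reᴳ z + imᴳ z * imᴳ z ≤ ‖ z ‖ * ‖ z ‖
re²+im²≤ (a ,ᴳ b) = begin
  a * a + b * b
    ≤⟨ +-mono-≤ (≤-trans (p≤∣p∣ (a * a)) (≤-reflexive (∣p*q∣≡∣p∣*∣q∣ a a)))
                (≤-trans (p≤∣p∣ (b * b)) (≤-reflexive (∣p*q∣≡∣p∣*∣q∣ b b))) ⟩
  ∣ a ∣ * ∣ a ∣ + ∣ b ∣ * ∣ b ∣
    ≤⟨ ≤-+ʳ (∣ a ∣ * ∣ a ∣ + ∣ b ∣ * ∣ b ∣) (+-nonneg (*-nonneg (0≤∣p∣ a) (0≤∣p∣ b)) (*-nonneg (0≤∣p∣ a) (0≤∣p∣ b))) ⟩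
  ∣ a ∣ * ∣ a ∣ + ∣ b ∣ * ∣ b ∣ + (∣ a ∣ * ∣ b ∣ + ∣ a ∣ * ∣ b ∣)
    ≡⟨ solve 2 (λ a b → a :* a :+ b :* b :+ (a :* b :+ a :* b) := (a :+ b) :* (a :+ b)) refl (∣ a ∣) (∣ b ∣) ⟩
  (∣ a ∣ + ∣ b ∣) * (∣ a ∣ + ∣ b ∣) ∎
  where open ≤-Reasoning

-- The left-hand side is the convex combination β + (1 - β) γ of 1 and γ.
‖mix‖ : ∀ β → 0ℚ ≤ β → β ≤ 1ℚ → ∀ γ → ‖ γ +ᴳ realᴳ β *ᴳ (1ᴳ ⊖ᴳ γ) ‖ ≤ β + ‖ γ ‖
‖mix‖ β 0≤β β≤1 γ = begin
  ‖ γ +ᴳ realᴳ β *ᴳ (1ᴳ ⊖ᴳ γ) ‖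
    ≡⟨ cong ‖_‖ (mix γ) ⟩
  ‖ realᴳ β +ᴳ realᴳ (1ℚ - β) *ᴳ γ ‖
    ≤⟨ ‖+‖ (realᴳ β) (realᴳ (1ℚ - β) *ᴳ γ) ⟩
  ‖ realᴳ β ‖ + ‖ realᴳ (1ℚ - β) *ᴳ γ ‖
    ≡⟨ cong₂ _+_ (trans (+-identityʳ (∣ β ∣)) (0≤p⇒∣p∣≡p 0≤β)) (‖real*‖ (1ℚ - β) γ (0≤1- β≤1)) ⟩
  β + (1ℚ - β) * ‖ γ ‖
    ≤⟨ +-monoʳ-≤ β (≤-trans (*-monoʳ-≤-nonNeg (‖ γ ‖) {{nonNegative (0≤‖ γ ‖)}} 1-β≤1) (≤-reflexive (*-identityˡ (‖ γ ‖)))) ⟩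
  β + ‖ γ ‖ ∎
  where
  open ≤-Reasoning
  1-β≤1 : 1ℚ - β ≤ 1ℚ
  1-β≤1 = +-cancelʳ-≤ β (subst (_≤ 1ℚ + β) (solve 1 (λ b → con 1ℚ := con 1ℚ :- b :+ b) refl β) (≤-+ʳ 1ℚ 0≤β))
  mix : ∀ γ → γ +ᴳ realᴳ β *ᴳ (1ᴳ ⊖ᴳ γ) ≡ realᴳ β +ᴳ realᴳ (1ℚ - β) *ᴳ γ
  mix (a ,ᴳ b) = cong₂ _,ᴳ_
    (solve 3 (λ β a b → a :+ (β :* (con 1ℚ :+ :- a) :+ :- (con 0ℚ :* (con 0ℚ :+ :- b)))
      := β :+ ((con 1ℚ :- β) :* a :+ :- (con 0ℚ :* b))) refl β a b)
    (solve 3 (λ β a b → b :+ (β :* (con 0ℚ :+ :- b) :+ con 0ℚ :* (con 1ℚ :+ :- a))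
      := con 0ℚ :+ ((con 1ℚ :- β) :* b :+ con 0ℚ :* a)) refl β a b)

square-close : ∀ {β t} → 0ℚ ≤ β → β ≤ 1ℚ → 0ℚ ≤ t → t ≤ 1ℚ → (β + t) * (β + t) ≤ β * β + natℚ 3 * t
square-close {β} {t} 0≤β β≤1 0≤t t≤1 = begin
  (β + t) * (β + t)
    ≡⟨ solve 2 (λ β t → (β :+ t) :* (β :+ t) := β :* β :+ (β :+ β :+ t) :* t) refl β t ⟩
  β * β + (β + β + t) * t
    ≤⟨ +-monoʳ-≤ (β * β) (*-monoʳ-≤-nonNeg t {{nonNegative 0≤t}} (+-mono-≤ (+-mono-≤ β≤1 β≤1) t≤1)) ⟩
  β * β + natℚ 3 * t ∎
  where open ≤-Reasoning

modulus-bound : ∀ (r : ℝ) (z : ℂ) → r IsModulusOf z → ∀ β → 0ℚ ≤ β → β ≤ 1ℚ → (γ : ℕ → ℚ[i]) →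
  Null (λ n → ‖ γ n ‖) → (∀ n → approx n z ≡ γ n +ᴳ realᴳ β *ᴳ (1ᴳ ⊖ᴳ γ n)) →
  ∀ ε → 0ℚ < ε → ∃[ N ] (∀ n → N ℕ.≤ n → seq r n * seq r n ≤ β * β + ε)
modulus-bound r z (_ , r²≈) β 0≤β β≤1 γ γ-null mean ε 0<ε =
  let N₁ , c₁ = r²≈ (½ * ε) (*-pos 0<½ 0<ε)
      N₂ , c₂ = γ-null 1ℚ 0<1
      N₃ , c₃ = null-* (natℚ 3) (natℚ-nonneg 3) γ-null (½ * ε) (*-pos 0<½ 0<ε)
  in N₁ ℕ.⊔ (N₂ ℕ.⊔ N₃) , λ n n≥ →
    let n≥′ = ℕₚ.m⊔n≤o⇒n≤o N₁ (N₂ ℕ.⊔ N₃) n≥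
    in bound (seq r n) (approx n z) (γ n) (c₁ n (ℕₚ.m⊔n≤o⇒m≤o N₁ (N₂ ℕ.⊔ N₃) n≥)) (mean n)
         (c₂ n (ℕₚ.m⊔n≤o⇒m≤o N₂ N₃ n≥′)) (c₃ n (ℕₚ.m⊔n≤o⇒n≤o N₂ N₃ n≥′))
  where
  open ≤-Reasoning
  bound : ∀ ρ z γ → ∣ ρ * (ρ * 1ℚ) - (reᴳ z * (reᴳ z * 1ℚ) + imᴳ z * (imᴳ z * 1ℚ)) ∣ ≤ ½ * ε →
          z ≡ γ +ᴳ realᴳ β *ᴳ (1ᴳ ⊖ᴳ γ) → ‖ γ ‖ ≤ 1ℚ → natℚ 3 * ‖ γ ‖ ≤ ½ * ε → ρ * ρ ≤ β * β + ε
  bound ρ z γ close eq γ≤1 3γ≤ = begin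
    ρ * ρ
      ≡⟨ solve 3 (λ ρ a b → ρ :* ρ := (ρ :* (ρ :* con 1ℚ) :- (a :* (a :* con 1ℚ) :+ b :* (b :* con 1ℚ))) :+ (a :* a :+ b :* b))
           refl ρ (reᴳ z) (imᴳ z) ⟩
    (ρ * (ρ * 1ℚ) - (reᴳ z * (reᴳ z * 1ℚ) + imᴳ z * (imᴳ z * 1ℚ))) + (reᴳ z * reᴳ z + imᴳ z * imᴳ z)
      ≤⟨ +-mono-≤ (≤-trans (p≤∣p∣ _) close) (re²+im²≤ z) ⟩
    ½ * ε + ‖ z ‖ * ‖ z ‖
      ≤⟨ +-monoʳ-≤ (½ * ε) (*-mono (0≤‖ z ‖) (+-nonneg 0≤β (0≤‖ γ ‖)) ‖z‖≤ ‖z‖≤) ⟩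
    ½ * ε + (β + ‖ γ ‖) * (β + ‖ γ ‖)
      ≤⟨ +-monoʳ-≤ (½ * ε) (≤-trans (square-close 0≤β β≤1 (0≤‖ γ ‖) γ≤1) (+-monoʳ-≤ (β * β) 3γ≤)) ⟩
    ½ * ε + (β * β + ½ * ε)
      ≡⟨ solve 2 (λ e b → con ½ :* e :+ (b :+ con ½ :* e) := b :+ e) refl ε (β * β) ⟩
    β * β + ε ∎
    where
    ‖z‖≤ : ‖ z ‖ ≤ β + ‖ γ ‖
    ‖z‖≤ = subst (λ w → ‖ w ‖ ≤ β + ‖ γ ‖) (sym eq) (‖mix‖ β 0≤β β≤1 γ)

seq-^ : ∀ x m n → seq (x ^ᴿ m) n ≡ seq x n ^ m
seq-^ x zero    n = refl
seq-^ x (suc m) n = cong (seq x n *_) (seq-^ x m n)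

ratio-bound : ∀ M N j .{{_ : NonZero (M ℕ.* M)}} → 4 ℕ.^ j ℕ.* N ℕ.≤ 3 ℕ.^ j ℕ.* M →
              recip (M ℕ.* M) * natℚ (M ℕ.* N) ≤ (ℤ.+ 3 / 4) ^ j
ratio-bound M N j le = *-cancelʳ-≤-pos (natℚ (4 ℕ.^ j)) {{positive 0<4ʲ}} (begin
  recip (M ℕ.* M) * natℚ (M ℕ.* N) * natℚ (4 ℕ.^ j)
    ≡⟨ trans (*-assoc (recip (M ℕ.* M)) (natℚ (M ℕ.* N)) (natℚ (4 ℕ.^ j)))
         (cong (recip (M ℕ.* M) *_) (sym (natℚ-* (M ℕ.* N) (4 ℕ.^ j)))) ⟩
  recip (M ℕ.* M) * natℚ (M ℕ.* N ℕ.* 4 ℕ.^ j)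
    ≤⟨ *-monoˡ-≤-nonNeg (recip (M ℕ.* M)) {{nonNegative (<⇒≤ (0<recip (M ℕ.* M)))}} (natℚ-mono
         (subst₂ ℕ._≤_ (regroup M (4 ℕ.^ j) N) (regroup′ M (3 ℕ.^ j)) (ℕₚ.*-monoʳ-≤ M le))) ⟩
  recip (M ℕ.* M) * natℚ (3 ℕ.^ j ℕ.* (M ℕ.* M))
    ≡⟨ trans (cong (recip (M ℕ.* M) *_) (natℚ-* (3 ℕ.^ j) (M ℕ.* M)))
         (solve 3 (λ r a l → r :* (a :* l) := a :* (l :* r)) refl (recip (M ℕ.* M)) (natℚ (3 ℕ.^ j)) (natℚ (M ℕ.* M))) ⟩
  natℚ (3 ℕ.^ j) * (natℚ (M ℕ.* M) * recip (M ℕ.* M))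
    ≡⟨ trans (cong (natℚ (3 ℕ.^ j) *_) (recip-inverseʳ (M ℕ.* M))) (*-identityʳ (natℚ (3 ℕ.^ j))) ⟩
  natℚ (3 ℕ.^ j)
    ≡⟨ power j ⟨
  (ℤ.+ 3 / 4) ^ j * natℚ (4 ℕ.^ j) ∎)
  where
  open ≤-Reasoning
  0<4ʲ : 0ℚ < natℚ (4 ℕ.^ j)
  0<4ʲ = <-≤-trans 0<1 (natℚ-mono {1} (ℕₚ.m^n>0 4 j))
  regroup : ∀ m a n → m ℕ.* (a ℕ.* n) ≡ m ℕ.* n ℕ.* a
  regroup = ℕ-Solver.solve-∀
  regroup′ : ∀ m a → m ℕ.* (a ℕ.* m) ≡ a ℕ.* (m ℕ.* m)
  regroup′ = ℕ-Solver.solve-∀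
  power : ∀ j → (ℤ.+ 3 / 4) ^ j * natℚ (4 ℕ.^ j) ≡ natℚ (3 ℕ.^ j)
  power zero    = refl
  power (suc j) = trans (cong ((ℤ.+ 3 / 4) ^ suc j *_) (natℚ-* 4 (4 ℕ.^ j)))
    (trans (solve 4 (λ a q b m → a :* q :* (b :* m) := (a :* b) :* (q :* m)) refl (ℤ.+ 3 / 4) ((ℤ.+ 3 / 4) ^ j) (natℚ 4) (natℚ (4 ℕ.^ j)))
    (trans (cong (natℚ 3 *_) (power j)) (sym (natℚ-* 3 (3 ℕ.^ j)))))

-- 11200 = 7 · 40².
square-of-log : ∀ (l : ℝ) j c → suc c ℕ.≤ 7 ℕ.* (suc j ℕ.* suc j) →
                ∃[ N ] (∀ n → N ℕ.≤ n → natℚ (suc j) * (ℤ.+ 1 / 40) ≤ ∣ seq l n ∣) →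
                fromℚ (natℚ (suc c)) ≤ᴿ fromℚ (natℚ 11200) *ᴿ l ^ᴿ 2
square-of-log l j c c≤ (N , large) ε 0<ε = N , λ n n≥ → ≤-trans (bound (seq l n) (large n n≥)) (≤-+ʳ _ (<⇒≤ 0<ε))
  where
  open ≤-Reasoning
  J′ : ℚ
  J′ = natℚ (suc j)
  bound : ∀ q → J′ * (ℤ.+ 1 / 40) ≤ ∣ q ∣ → natℚ (suc c) ≤ natℚ 11200 * (q * (q * 1ℚ))
  bound q le = begin
    natℚ (suc c)
      ≤⟨ natℚ-mono c≤ ⟩
    natℚ (7 ℕ.* (suc j ℕ.* suc j))
      ≡⟨ trans (natℚ-* 7 (suc j ℕ.* suc j)) (cong (natℚ 7 *_) (natℚ-* (suc j) (suc j))) ⟩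
    natℚ 7 * (J′ * J′)
      ≡⟨ solve 1 (λ J → con (natℚ 7) :* (J :* J) := con (natℚ 11200) :* ((J :* con (ℤ.+ 1 / 40)) :* (J :* con (ℤ.+ 1 / 40)))) refl J′ ⟩
    natℚ 11200 * (J′ * (ℤ.+ 1 / 40) * (J′ * (ℤ.+ 1 / 40)))
      ≤⟨ *-monoˡ-≤-nonNeg (natℚ 11200) (*-mono (*-nonneg (natℚ-nonneg (suc j)) (nonNegative⁻¹ (ℤ.+ 1 / 40))) (0≤∣p∣ q) le le) ⟩
    natℚ 11200 * (∣ q ∣ * ∣ q ∣)
      ≡⟨ cong (natℚ 11200 *_) (trans (sym (∣p*q∣≡∣p∣*∣q∣ q q)) (trans (0≤p⇒∣p∣≡p (square≥0 q))
           (solve 1 (λ q → q :* q := q :* (q :* con 1ℚ)) refl q))) ⟩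
    natℚ 11200 * (q * (q * 1ℚ)) ∎

-- Combining the count of kernel pairs with the norm.

module CubicStructure (p : ℕ) .{{nz : NonZero p}} (pr : Prime p) (n : ℕ) where

  2≤p : 2 ℕ.≤ p
  2≤p = ℕ.nonTrivial⇒n>1 p {{prime⇒nonTrivial pr}}

  open Differences p
  open Degrees pr
  open Decomposition p
  open Trilinear p pr n
  open ℕSums p using (sum; ∑ᵛ)

  term≤sum : ∀ {m} (g : Fin m → ℕ) i → g i ℕ.≤ sum g
  term≤sum g zero    = ℕₚ.m≤m+n (g zero) _
  term≤sum g (suc i) = ℕₚ.≤-trans (term≤sum (λ i → g (suc i)) i) (ℕₚ.m≤n+m _ (g zero))

  term≤∑ᵛ : ∀ n (g : Vec (Fin p) n → ℕ) x → g x ℕ.≤ ∑ᵛ n g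
  term≤∑ᵛ zero    g []      = ℕₚ.≤-refl
  term≤∑ᵛ (suc n) g (a ∷ x) = ℕₚ.≤-trans (term≤∑ᵛ n (λ x → g (a ∷ x)) x) (term≤sum (λ a → ∑ᵛ n λ x → g (a ∷ x)) a)

  module _ {f : V → PrimeField.𝔽 p} (cubic : Vanish 4 f) where

    open Cubic cubic

    M : ℕ
    M = p ℕ.^ n ℕ.* p ℕ.^ n

    M≢0 : NonZero M
    M≢0 = ℕₚ.m*n≢0 (p ℕ.^ n) (p ℕ.^ n) {{ℕₚ.m^n≢0 p n}} {{ℕₚ.m^n≢0 p n}}

    kernelPairs≥1 : 1 ℕ.≤ kernelPairs cubic
    kernelPairs≥1 = ℕₚ.≤-trans (origin (kernel? cubic 0ᵛ 0ᵛ))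
      (ℕₚ.≤-trans (term≤∑ᵛ n (λ z → indicator cubic (kernel? cubic 0ᵛ z)) 0ᵛ) (term≤∑ᵛ n (kernelSize cubic) 0ᵛ))
      where
      origin : ∀ (d : ∃ (λ w → third f 0ᵛ 0ᵛ w ≢ PrimeField.0ᶠ p) ⊎ Kernel cubic 0ᵛ 0ᵛ) → 1 ℕ.≤ indicator cubic d
      origin (inj₁ (w , ne)) = ⊥-elim (ne (additive-0 {φ = λ z → third f 0ᵛ z w} (third-additive₂ 0ᵛ w)))
      origin (inj₂ _)        = ℕₚ.≤-refl

    -- The hypothesis is the minimality clause of `HasDegree 3` at exponent 2: if T were identically
    -- zero, f would have degree at most 2.
    third-nonzero : (PrimeField.DegreeAtMost p 2 f → 3 ℕ.≤ 2) →
                    ∃ λ yzw → third f (proj₁ yzw) (proj₁ (proj₂ yzw)) (proj₂ (proj₂ yzw)) ≢ PrimeField.0ᶠ p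
    third-nonzero not-quadratic with search-× search-V (search-× search-V search-V)
        (λ yzw → vanishing? (third f (proj₁ yzw) (proj₁ (proj₂ yzw)) (proj₂ (proj₂ yzw))))
    ... | inj₁ found = found
    ... | inj₂ zeros = ⊥-elim (ℕₚ.<-irrefl refl (not-quadratic
            (deg⇒degreeAtMost (vanish-deg 2 (third-0⇒vanish λ y z w → zeros (y , z , w))))))

  γ-null : ∀ π → IsPi π → {f : V → PrimeField.𝔽 p {{nz}}} (cubic : Vanish 4 f) →
           Null (λ i → ‖ Mean.Character.γ p {{nz}} pr n cubic (approx i (PrimeField.ω p {{nz}} π)) ‖)
  γ-null π isPi cubic = null-≤ 0 (λ i _ → bound i) (RootsOfUnity.rootSum-null p 2≤p π isPi)
    where
    open ≤-Reasoning
    bound : ∀ i → ‖ Mean.Character.γ p {{nz}} pr n cubic (approx i (PrimeField.ω p {{nz}} π)) ‖ ≤ ‖ RootsOfUnity.rootSum p 2≤p π isPi i ‖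
    bound i = begin
      ‖ realᴳ (recip p) *ᴳ RootsOfUnity.rootSum p 2≤p π isPi i ‖
        ≡⟨ ‖real*‖ (recip p) (RootsOfUnity.rootSum p 2≤p π isPi i) (<⇒≤ (0<recip p)) ⟩
      recip p * ‖ RootsOfUnity.rootSum p 2≤p π isPi i ‖
        ≤⟨ *-monoʳ-≤-nonNeg (‖ RootsOfUnity.rootSum p 2≤p π isPi i ‖) {{nonNegative (0≤‖ RootsOfUnity.rootSum p 2≤p π isPi i ‖)}} recip≤1 ⟩
      1ℚ * ‖ RootsOfUnity.rootSum p 2≤p π isPi i ‖
        ≡⟨ *-identityˡ (‖ RootsOfUnity.rootSum p 2≤p π isPi i ‖) ⟩
      ‖ RootsOfUnity.rootSum p 2≤p π isPi i ‖ ∎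
      where
      recip≤1 : recip p ≤ 1ℚ
      recip≤1 = subst₂ _≤_ (*-identityˡ (recip p)) (recip-inverseʳ p)
        (*-monoʳ-≤-nonNeg (recip p) {{nonNegative (<⇒≤ (0<recip p))}} (natℚ-mono {1} {p} (ℕ.>-nonZero⁻¹ p)))

  mixture : {f : V → PrimeField.𝔽 p {{nz}}} → Vanish 4 f → ℂ → ℕ → ℚ[i]
  mixture cubic ζ i = Mean.Character.γ p {{nz}} pr n cubic (approx i ζ) +ᴳ realᴳ (Mean.β p {{nz}} pr n cubic) *ᴳ (1ᴳ ⊖ᴳ Mean.Character.γ p {{nz}} pr n cubic (approx i ζ))

  mean-at : ∀ {f : V → PrimeField.𝔽 p {{nz}}} (cubic : Vanish 4 f) π i →
            approx i (PrimeField.gowersMean p {{nz}} π 3 f) ≡ mixture cubic (PrimeField.ω p {{nz}} π) i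
  mean-at {f} cubic π i = Mean.mean-approx-≡ p {{nz}} pr n cubic (PrimeField.gowersMean p {{nz}} π 3 f) (PrimeField.ω p {{nz}} π)
    (Mean.gowersMean≡ p {{nz}} pr n cubic π 3) i

  -- The exponent is 16 because δ⁸ is the modulus of the mean and a modulus is specified by its
  -- square. Correspondingly β ≤ (3/4)ʲ⁺¹ enters squared, as (9/16)ʲ⁺¹.
  norm-bound : ∀ {f : V → PrimeField.𝔽 p {{nz}}} (cubic : Vanish 4 f) π δ → IsPi π → PrimeField.IsGowersNorm p {{nz}} π 3 f δ →
               ∀ j → 4 ℕ.^ suc j ℕ.* kernelPairs cubic ℕ.≤ 3 ℕ.^ suc j ℕ.* M cubic →
               ∀ ε → 0ℚ < ε → ∃[ N ] (∀ i → N ℕ.≤ i → seq δ i ^ 16 ≤ (ℤ.+ 9 / 16) ^ suc j + ε)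
  norm-bound {f} cubic π δ isPi (_ , modulus) j le ε 0<ε =
    let N , c = modulus-bound (δ ^ᴿ (2 ℕ.^ 3)) (PrimeField.gowersMean p {{nz}} π 3 f) modulus β 0≤β β≤1
                  (λ i → Mean.Character.γ p {{nz}} pr n cubic (approx i (PrimeField.ω p {{nz}} π))) (γ-null π isPi cubic) (mean-at cubic π) ε 0<ε
    in N , λ i i≥ → begin
      seq δ i ^ 16
        ≡⟨ ^-+ (seq δ i) 8 8 ⟩
      seq δ i ^ 8 * seq δ i ^ 8
        ≡⟨ cong (λ q → q * q) (seq-^ δ 8 i) ⟨
      seq (δ ^ᴿ 8) i * seq (δ ^ᴿ 8) i
        ≤⟨ c i i≥ ⟩
      β * β + ε
        ≤⟨ +-monoˡ-≤ ε (≤-trans (*-mono 0≤β (≤-trans 0≤β β≤) β≤ β≤)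
             (≤-reflexive (sym (^-*-distrib (ℤ.+ 3 / 4) (ℤ.+ 3 / 4) (suc j))))) ⟩
      (ℤ.+ 9 / 16) ^ suc j + ε ∎
    where
    open ≤-Reasoning
    M²≢0 : NonZero (M cubic ℕ.* M cubic)
    M²≢0 = ℕₚ.m*n≢0 (M cubic) (M cubic) {{M≢0 cubic}} {{M≢0 cubic}}
    β : ℚ
    β = Mean.β p {{nz}} pr n cubic
    β≤ : β ≤ (ℤ.+ 3 / 4) ^ suc j
    β≤ = ratio-bound (M cubic) (kernelPairs cubic) (suc j) {{M²≢0}} le
    0≤β : 0ℚ ≤ β
    0≤β = *-nonneg (<⇒≤ (0<recip (M cubic ℕ.* M cubic) {{M²≢0}})) (natℚ-nonneg (M cubic ℕ.* kernelPairs cubic))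
    β≤1 : β ≤ 1ℚ
    β≤1 = ≤-trans β≤ (^-≤1 (nonNegative⁻¹ (ℤ.+ 3 / 4)) (toWitness {a? = (ℤ.+ 3 / 4) ≤? 1ℚ} _) (suc j))

module _ (p : ℕ) .{{nz : NonZero p}} (pr : Prime p) (n : ℕ) {f : Vec (PrimeField.𝔽 p {{nz}}) n → PrimeField.𝔽 p {{nz}}} where

  open Differences p {{nz}} using (Vanish; deg-vanish; degreeAtMost⇒deg)
  open Decomposition p {{nz}} using (Decomposed)
  open CubicStructure p {{nz}} pr n
  open Trilinear p {{nz}} pr n using (nonzero-bound; structure; kernelPairs)

  few-products : (cubic : Vanish 4 f) → ∀ m → 3 ℕ.^ m ℕ.* M cubic ℕ.< 4 ℕ.^ m ℕ.* kernelPairs cubic →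
                 ∃[ c ] (c ℕ.≤ m ℕ.* m ℕ.+ m × Decomposed c f)
  few-products cubic m lt = structure cubic m
    (few-thin 2≤p {M cubic} {kernelPairs cubic} m lt) (no-long-chain 2≤p {M cubic} {kernelPairs cubic} m lt)

  exponent : (cubic : Vanish 4 f) → (PrimeField.DegreeAtMost p {{nz}} 2 f → 3 ℕ.≤ 2) →
             ∃[ j ] (4 ℕ.^ suc j ℕ.* kernelPairs cubic ℕ.≤ 3 ℕ.^ suc j ℕ.* M cubic ×
                     3 ℕ.^ suc (suc j) ℕ.* M cubic ℕ.< 4 ℕ.^ suc (suc j) ℕ.* kernelPairs cubic)
  exponent cubic not-quadratic = let (y , z , w) , ne = third-nonzero cubic not-quadratic in
    bias-exponent (M cubic) (kernelPairs cubic) (ℕ.>-nonZero⁻¹ (M cubic) {{M≢0 cubic}}) (kernelPairs≥1 cubic)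
      (bias≤3/4 2≤p {M cubic} {kernelPairs cubic} (nonzero-bound cubic y z w ne))

  log-bound : (cubic : Vanish 4 f) → ∀ π δ l → IsPi π → PrimeField.IsGowersNorm p {{nz}} π 3 f δ → l IsLogOfInverse δ →
              ∀ j → 4 ℕ.^ suc j ℕ.* kernelPairs cubic ℕ.≤ 3 ℕ.^ suc j ℕ.* M cubic →
              ∀ c → c ℕ.≤ suc (suc j) ℕ.* suc (suc j) ℕ.+ suc (suc j) →
              fromℚ (natℚ (suc c)) ≤ᴿ fromℚ (natℚ 11200) *ᴿ l ^ᴿ 2
  log-bound cubic π δ l isPi norm log j le c c≤ =
    square-of-log l j c (count-bound j c c≤) (log-lower-bound l δ j log (norm-bound cubic π δ isPi norm j le))

  cubic-structure : ∀ π δ l → IsPi π → PrimeField.HasDegree p {{nz}} 3 f → PrimeField.IsGowersNorm p {{nz}} π 3 f δ →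
    l IsLogOfInverse δ → ∃[ c ] (fromℚ (natℚ (suc c)) ≤ᴿ fromℚ (natℚ 11200) *ᴿ l ^ᴿ 2 × Decomposed c f)
  cubic-structure π δ l isPi (degree , minimal) norm log = combine (exponent cubic (minimal 2))
    where
    cubic : Vanish 4 f
    cubic = deg-vanish (degreeAtMost⇒deg degree)
    combine : ∃[ j ] (4 ℕ.^ suc j ℕ.* kernelPairs cubic ℕ.≤ 3 ℕ.^ suc j ℕ.* M cubic ×
                      3 ℕ.^ suc (suc j) ℕ.* M cubic ℕ.< 4 ℕ.^ suc (suc j) ℕ.* kernelPairs cubic) →
              ∃[ c ] (fromℚ (natℚ (suc c)) ≤ᴿ fromℚ (natℚ 11200) *ᴿ l ^ᴿ 2 × Decomposed c f)
    -- m = j + 2: the bound β ≤ (3/4)ʲ⁺¹ makes the logarithm at least (j+1)/40 in absolute value,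
    -- and β > (3/4)ʲ⁺² is what the structural argument needs. The two exponents differ by one, so
    -- m² is of the order of log².
    combine (j , le , lt) = let c , c≤ , D = few-products cubic (suc (suc j)) lt in
      c , log-bound cubic π δ l isPi norm log j le c c≤ , D

  open Differences p {{nz}} using (deg⇒degreeAtMost)
  open PrimeField p {{nz}}

  unpack : ∀ (l : ℝ) → ∃[ c ] (fromℚ (natℚ (suc c)) ≤ᴿ fromℚ (natℚ 11200) *ᴿ l ^ᴿ 2 × Decomposed c f) →
    ∃[ c ] (fromℚ (natℚ (suc c)) ≤ᴿ fromℚ (natℚ 11200) *ᴿ l ^ᴿ 2 ×
    Σ (Vec 𝔽 n → 𝔽) λ q₀ →
    Σ (Fin c → Vec 𝔽 n → 𝔽) λ q →
    Σ (Fin c → Vec 𝔽 n → 𝔽) λ ℓ →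
    DegreeAtMost 2 q₀ ×
    (∀ j → DegreeAtMost 2 (q j)) ×
    (∀ j → DegreeAtMost 1 (ℓ j)) ×
    (∀ x → f x ≡ ∑ (λ j → ℓ j x *ᶠ q j x) +ᶠ q₀ x))
  unpack l (c , c≤ , D) = c , c≤ , D.q₀ , D.q , D.ℓ ,
    deg⇒degreeAtMost D.deg-q₀ , (λ j → deg⇒degreeAtMost (D.deg-q j)) , (λ j → deg⇒degreeAtMost (D.deg-ℓ j)) , D.expand
    where module D = Decomposed D

theorem2 : (p : ℕ) .{{_ : NonZero p}} → Prime p → let open PrimeField p in
    ∃[ C ] ((n : ℕ) (f : Vec 𝔽 n → 𝔽) (π δ l : ℝ) →
    IsPi π →
    HasDegree 3 f →
    IsGowersNorm π 3 f δ →
    l IsLogOfInverse δ →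
    ∃[ c ] (fromℚ (natℚ (suc c)) ≤ᴿ fromℚ (natℚ C) *ᴿ l ^ᴿ 2 ×
    Σ (Vec 𝔽 n → 𝔽) λ q₀ →
    Σ (Fin c → Vec 𝔽 n → 𝔽) λ q →
    Σ (Fin c → Vec 𝔽 n → 𝔽) λ ℓ →
    DegreeAtMost 2 q₀ ×
    (∀ j → DegreeAtMost 2 (q j)) ×
    (∀ j → DegreeAtMost 1 (ℓ j)) ×
    (∀ x → f x ≡ ∑ (λ j → ℓ j x *ᶠ q j x) +ᶠ q₀ x)))
-- One constant serves all primes, as p has entered the bounds only through (2p-1)/p² ≤ 3/4 and p ≥
-- 2.
theorem2 p {{nz}} pr = 11200 , λ n f π δ l isPi degree norm log →
  unpack p {{nz}} pr n {f} l (cubic-structure p {{nz}} pr n {f} π δ l isPi degree norm log)
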